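{- Let $W$ be the affine Weyl group of type $\tilde B_2$ and let $u,w\in c_2$ with $u\le w$, $u\sim_L w$ and $u\not\sim_R w$. (i) If $\mathcal{L}(w)\not\subseteq\mathcal{L}(u)$, then $\mu(u,w)=1$ if $l(w)-l(u)=1$ and $0$ otherwise. (ii) If $\mathcal{L}(w)\subseteq\mathcal{L}(u)$, then $\mu(u,w)=1$ if $l(w)-l(u)=5$ and $0$ otherwise.
   Context: $W$ is the Coxeter group with simple reflections $S=\{r,s,t\}$ and relations $r^2=s^2=t^2=e$, $rt=tr$, $(rs)^4=(st)^4=e$; $l$ is the length and $\le$ the Bruhat order. $\mathcal{L}(w)=\{s'\in S\mid s'w<w\}$, $\mathcal{R}(w)=\{s'\in S\mid ws'<w\}$. $\sim_L,\sim_R$ are the Kazhdan–Lusztig left and right cell equivalences. $c_2=\{w\in W\mid a(w)=2\}$ for Lusztig's $a$-function; explicitly $c_2=\{u\,rt(srt)^m\,v\mid u\in\{e,s,ts,rs\},\ v\in\{e,s,st,sr\},\ m\in\mathbb{N}\}$. $P_{u,w}$ are the Kazhdan–Lusztig polynomials and, for $u\le w$, $\mu(u,w)$ is the coefficient of $q^{\frac12(l(w)-l(u)-1)}$ in $P_{u,w}$ (zero if the exponent is not an integer). -}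

module Defs where

open import Data.Nat as ℕ using (ℕ; zero; suc; _<_; _≤_; _+_; _∸_; _<?_)
open import Data.Nat.DivMod using (_/_; _%_)
open import Data.Integer as ℤ using (ℤ; +_; 0ℤ; 1ℤ)
open import Data.List using (List; []; _∷_; _++_; map; concat; concatMap; length; reverse; foldr; deduplicate; upTo)
open import Data.List.Relation.Unary.Any using (any?)
open import Data.List.Membership.Propositional using (_∈_)
open import Data.Bool using (Bool; true; false; if_then_else_)
open import Data.Maybe using (Maybe; just; nothing)
open import Data.Product using (Σ; ∃; _×_; _,_)
open import Data.Product.Properties using (≡-dec)
open import Data.Sum using (_⊎_)
open import Relation.Nullary using (¬_; Dec; yes; no)
open import Relation.Nullary.Decidable using (⌊_⌋)
open import Relation.Binary.PropositionalEquality using (_≡_; _≢_)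
open import Relation.Binary.Definitions using (DecidableEquality)
open import Relation.Binary.Construct.Closure.ReflexiveTransitive using (Star)

-- The Coxeter group W of type B̃₂ (= C̃₂):  r² = s² = t² = e, rt = tr,
-- (rs)⁴ = (st)⁴ = e.  Elements are represented by words in r,s,t;
-- two words denote the same element iff they have the same image under
-- the faithful geometric realisation of W as the group generated by the
-- reflections of ℤ² in the walls y = 0 (r), y = x (s), x = 1 (t) of the
-- triangle 0 < y < x < 1 (angles π/4, π/4, π/2).

data Gen : Set where
  r s t : Gen

gens : List Gen
gens = r ∷ s ∷ t ∷ []

W : Set
W = List Gen

Pt : Set
Pt = ℤ × ℤ

act : Gen → Pt → Pt
act r (x , y) = (x , ℤ.- y)
act s (x , y) = (y , x)
act t (x , y) = ((+ 2) ℤ.- x , y)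

evPt : W → Pt → Pt
evPt [] p = p
evPt (g ∷ w) p = act g (evPt w p)

-- an affine map of the plane is determined by the images of three points
Elt : Set
Elt = Pt × Pt × Pt

ev : W → Elt
ev w = evPt w (0ℤ , 0ℤ) , evPt w (1ℤ , 0ℤ) , evPt w (0ℤ , 1ℤ)

_≟P_ : DecidableEquality Pt
_≟P_ = ≡-dec ℤ._≟_ ℤ._≟_

_≟E_ : DecidableEquality Elt
_≟E_ = ≡-dec _≟P_ (≡-dec _≟P_ _≟P_)

_≈_ : W → W → Set
u ≈ w = ev u ≡ ev w

allWords : ℕ → List W
allWords zero = [] ∷ []
allWords (suc n) = concatMap (λ w → map (_∷ w) gens) (allWords n)

-- Length: the minimal length of a word representing the element
-- (search k = 0,1,…,|w|; w itself is a word of length |w|).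

lenFrom : ℕ → ℕ → W → ℕ
lenFrom k zero w = k
lenFrom k (suc f) w =
  if ⌊ any? (λ v → ev v ≟E ev w) (allWords k) ⌋ then k else lenFrom (suc k) f w

ℓ : W → ℕ
ℓ w = lenFrom 0 (length w) w

_∈𝓛_ : Gen → W → Set
g ∈𝓛 w = ℓ (g ∷ w) < ℓ w

_∈𝓡_ : Gen → W → Set
g ∈𝓡 w = ℓ (w ++ g ∷ []) < ℓ w

_⊆𝓛_ : W → W → Set
w ⊆𝓛 u = ∀ g → g ∈𝓛 w → g ∈𝓛 u

_⊆𝓡_ : W → W → Set
w ⊆𝓡 u = ∀ g → g ∈𝓡 w → g ∈𝓡 u

-- Bruhat order: reflexive-transitive closure of x → xτ for a reflection
-- τ = a g a⁻¹ with l(x) < l(xτ).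

BruhatStep : W → W → Set
BruhatStep x y = ∃ λ (a : W) → ∃ λ (g : Gen) →
  (y ≈ (x ++ a ++ g ∷ reverse a)) × (ℓ x < ℓ y)

_≤B_ : W → W → Set
_≤B_ = Star (λ x y → (x ≈ y) ⊎ BruhatStep x y)

-- Polynomials in q with integer coefficients (coefficient lists,
-- lowest degree first).

Poly : Set
Poly = List ℤ

_⊕_ : Poly → Poly → Poly
[] ⊕ q = q
(a ∷ p) ⊕ [] = a ∷ p
(a ∷ p) ⊕ (b ∷ q) = (a ℤ.+ b) ∷ (p ⊕ q)

scale : ℤ → Poly → Poly
scale c p = map (c ℤ.*_) p

_⊖_ : Poly → Poly → Poly
p ⊖ q = p ⊕ scale (ℤ.- 1ℤ) q

shift : ℕ → Poly → Poly
shift zero p = p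
shift (suc k) p = 0ℤ ∷ shift k p

coeff : ℕ → Poly → ℤ
coeff _ [] = 0ℤ
coeff zero (a ∷ p) = a
coeff (suc i) (a ∷ p) = coeff i p

sumP : List Poly → Poly
sumP = foldr _⊕_ []

μFrom : Poly → W → W → ℤ
μFrom p z v with ℓ z <? ℓ v | (ℓ v ∸ ℓ z) % 2 ℕ.≟ 1
... | yes _ | yes _ = coeff ((ℓ v ∸ ℓ z ∸ 1) / 2) p
... | _ | _ = 0ℤ

-- Kazhdan–Lusztig polynomials via the recursion of KL79 (2.2.c):
-- for w = gv > v,
--  P_{x,w} = q^{1-c} P_{gx,v} + q^c P_{x,v}
--            - Σ_{z<v, gz<z} μ(z,v) q^{(l(w)-l(z))/2} P_{x,z},
-- c = 1 if gx < x, c = 0 otherwise; P_{x,e} = δ_{x,e}.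
-- The first argument is fuel (≥ l(w)).

δe : W → Poly
δe x with ev x ≟E ev []
... | yes _ = 1ℤ ∷ []
... | no _ = []

pickDesc : W → Maybe Gen
pickDesc w with ℓ (r ∷ w) <? ℓ w
... | yes _ = just r
... | no _ with ℓ (s ∷ w) <? ℓ w
...   | yes _ = just s
...   | no _ with ℓ (t ∷ w) <? ℓ w
...     | yes _ = just t
...     | no _ = nothing

elemsBelow : ℕ → List W
elemsBelow n = deduplicate (λ u v → ev u ≟E ev v) (concat (map allWords (upTo n)))

KL : ℕ → W → W → Poly
KL zero x w = δe x
KL (suc n) x w with pickDesc w
... | nothing = δe x
... | just g = main ⊖ corr
  where
  v : W
  v = g ∷ w
  main : Poly
  main with ℓ (g ∷ x) <? ℓ x
  ... | yes _ = KL n (g ∷ x) v ⊕ shift 1 (KL n x v)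
  ... | no _ = shift 1 (KL n (g ∷ x) v) ⊕ KL n x v
  term : W → Poly
  term z with ℓ (g ∷ z) <? ℓ z
  ... | yes _ = scale (μFrom (KL n z v) z v) (shift ((ℓ w ∸ ℓ z) / 2) (KL n x z))
  ... | no _ = []
  corr : Poly
  corr = sumP (map term (elemsBelow (ℓ v)))

P : W → W → Poly
P x w = KL (ℓ w) x w

μ : W → W → ℤ
μ u w = μFrom (P u w) u w

Edge : W → W → Set
Edge x y = ((x ≤B y) × (μ x y ≢ 0ℤ)) ⊎ ((y ≤B x) × (μ y x ≢ 0ℤ))

_≤L_ : W → W → Set
_≤L_ = Star (λ x y → (x ≈ y) ⊎ (Edge x y × ¬ (x ⊆𝓛 y)))

_≤R_ : W → W → Set
_≤R_ = Star (λ x y → (x ≈ y) ⊎ (Edge x y × ¬ (x ⊆𝓡 y)))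

_∼L_ : W → W → Set
x ∼L y = (x ≤L y) × (y ≤L x)

_∼R_ : W → W → Set
x ∼R y = (x ≤R y) × (y ≤R x)

srtPow : ℕ → W
srtPow zero = []
srtPow (suc m) = s ∷ r ∷ t ∷ srtPow m

Us : List W
Us = [] ∷ (s ∷ []) ∷ (t ∷ s ∷ []) ∷ (r ∷ s ∷ []) ∷ []

Vs : List W
Vs = [] ∷ (s ∷ []) ∷ (s ∷ t ∷ []) ∷ (s ∷ r ∷ []) ∷ []

InC2 : W → Set
InC2 w = ∃ λ (a : W) → ∃ λ (b : W) → ∃ λ (m : ℕ) →
  (a ∈ Us) × (b ∈ Vs) × (w ≈ (a ++ (r ∷ t ∷ srtPow m) ++ b))

{-# OPTIONS --safe #-}
module Submission where

-- W acts on the plane, and the length and the left descents of an element are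
-- read off from the position of its alcove relative to the four parallel
-- classes of walls.  Left and right multiplications of the Hecke algebra
-- commute by the exchange property, so the braid relations only need checking
-- at the identity; they show that the Kazhdan–Lusztig recursion may be run with
-- any left descent.  Consequently μ(x,w) = δ_{gx,w} whenever g ∈ L(w) ∖ L(x), and
-- likewise on the right, which gives R(x) ⊇ R(y) for x ≤_L y.
--
-- An element of c₂ has a left arm in {e, s, ts, rs}, determined by its left
-- descents, and a right arm, determined by its right descents, so u ∼_L w forces
-- equal right arms.  Equal left arms would give u ∼_R w.  For different left arms
-- with L(w) ⊄ L(u), μ(u,w) = δ_{gu,w}, and gu = w means ℓ(w) = ℓ(u) + 1.  Otherwise u
-- has left arm e and w = gsy with g ∈ {r, t}; Lusztig's symmetry of μ along
-- ⟨g,s⟩-strings gives μ(u,gsy) = μ(gsu,y), which again is a δ, nonzero exactly for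
-- ℓ(w) = ℓ(u) + 5.

open import Defs
open import Data.Bool using (Bool; true; false; not; if_then_else_)
open import Data.Bool.Properties using (not-involutive)
import Data.Bool.Properties as Bool
open import Data.Empty using (⊥-elim)
open import Data.Integer using (ℤ; +_; -[1+_]; 0ℤ; 1ℤ; -1ℤ; ∣_∣)
import Data.Integer as ℤ
import Data.Integer.Properties as ℤ
open import Data.List using (List; []; _∷_; _++_; length; reverse; map; concat; upTo)
open import Data.List.Membership.Propositional using (_∈_; find; lose)
open import Data.List.Membership.Propositional.Properties
  using (∈-map⁺; ∈-map⁻; ∈-concatMap⁺; ∈-concatMap⁻; ∈-concat⁺′; ∈-concat⁻′; ∈-upTo⁺; ∈-upTo⁻; ∈-deduplicate⁻)
open import Data.List.Properties using (++-assoc; length-reverse; reverse-++; unfold-reverse)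
import Data.List.Relation.Unary.All as All
open import Data.List.Relation.Unary.AllPairs using ([]; _∷_)
import Data.List.Relation.Unary.AllPairs as AllPairs
import Data.List.Relation.Unary.AllPairs.Properties as AllPairs
open import Data.List.Relation.Unary.Any using (here; there; any?)
import Data.List.Relation.Unary.Any as Any
import Data.List.Relation.Unary.Any.Properties as Any
import Data.List.Relation.Unary.Unique.DecSetoid.Properties as DecSetoid
open import Data.List.Relation.Unary.Unique.Propositional using (Unique)
open import Data.List.Relation.Unary.Unique.Propositional.Properties using (upTo⁺)
open import Data.Maybe using (Maybe; just; nothing)
open import Data.Nat using (ℕ; zero; suc; _≤_; _<_; z≤n; s≤s; _∸_; _<?_)
import Data.Nat as ℕ
open import Data.Nat.DivMod using (_/_; _%_; m≡m%n+[m/n]*n; m*n/n≡m; m%n<n)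
import Data.Nat.Properties as ℕ
open import Data.Product using (Σ; ∃; ∃₂; _×_; _,_; proj₁; proj₂)
open import Data.Sum using (_⊎_; inj₁; inj₂)
open import Function using (_∘_)
open import Relation.Binary.Construct.Closure.ReflexiveTransitive using () renaming (ε to done; _◅_ to _then_; _◅◅_ to _++ˢ_)
import Relation.Binary.Construct.On as On
open import Relation.Binary.Definitions using (DecidableEquality)
open import Relation.Binary.PropositionalEquality
import Relation.Binary.PropositionalEquality.Properties as ≡
open import Relation.Nullary using (yes; no; ¬_)
open import Relation.Nullary.Decidable using (map′; _×-dec_)

-- `KL` always strips the first left descent in the order r, s, t, while later arguments need a
-- descent of their own choice. Bar-invariance, the usual way to see that the choice is immaterial,
-- is replaced by `Span`: the candidates for C_w built from descents g and h differ by a combination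
-- of shorter C_z over ℤ[v + v⁻¹] all of whose coefficients lie in v⁻¹ℤ[v⁻¹], and such a combination
-- is zero. The braid relation is what confines the difference to shorter elements. The same
-- uniqueness shows that inversion carries C_w to the basis element of w⁻¹, so left-hand facts hold
-- on the right. The arms e, s, ts, rs have descents {r,t}, {s}, {t}, {r}; for different arms, L(w)
-- ⊆ L(u) leaves only u with arm e and w with arm ts or rs. There the δ asks for y = hgsu with {g,h}
-- = {r,t}, so w = gshgsu: this is the 5. Such edges are also what makes elements with equal left
-- arms right equivalent, because the one-letter edge from m to m + 1 enlarges the right descent set
-- and serves only one direction of the preorder.

module AffineGroup where

  -- Signed permutations with translations as a model of W.

  open import Data.Integer using (_+_; _-_; -_)
  open import Data.Integer.Tactic.RingSolver using (solve-∀)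

  -- ⟨ σ , e₁ , e₂ , a , b ⟩ is the affine map
  -- (x , y) ↦ (2a ± x , 2b ± y), or (2a ± y , 2b ± x) when σ holds, the signs
  -- being negative when e₁, resp. e₂, holds.
  record G : Set where
    constructor ⟨_,_,_,_,_⟩
    field
      σ e₁ e₂ : Bool
      a b : ℤ

  ε : G
  ε = ⟨ false , false , false , 0ℤ , 0ℤ ⟩

  _≟_ : DecidableEquality G
  ⟨ σ , e₁ , e₂ , a , b ⟩ ≟ ⟨ σ' , e₁' , e₂' , a' , b' ⟩ =
    map′ (λ { (refl , refl , refl , refl , refl) → refl }) (λ { refl → refl , refl , refl , refl , refl })
      (σ Bool.≟ σ' ×-dec e₁ Bool.≟ e₁' ×-dec e₂ Bool.≟ e₂' ×-dec a ℤ.≟ a' ×-dec b ℤ.≟ b')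

  infixr 7 _·_
  infixl 7 _◂_

  _·_ : Gen → G → G
  r · ⟨ σ , e₁ , e₂ , a , b ⟩ = ⟨ σ , e₁ , not e₂ , a , - b ⟩
  s · ⟨ σ , e₁ , e₂ , a , b ⟩ = ⟨ not σ , e₂ , e₁ , b , a ⟩
  t · ⟨ σ , e₁ , e₂ , a , b ⟩ = ⟨ σ , not e₁ , e₂ , 1ℤ - a , b ⟩

  sign : Bool → ℤ
  sign false = 1ℤ
  sign true = -1ℤ

  _◂_ : G → Gen → G
  ⟨ false , e₁ , e₂ , a , b ⟩ ◂ r = ⟨ false , e₁ , not e₂ , a , b ⟩
  ⟨ true , e₁ , e₂ , a , b ⟩ ◂ r = ⟨ true , not e₁ , e₂ , a , b ⟩
  ⟨ false , e₁ , e₂ , a , b ⟩ ◂ s = ⟨ true , e₁ , e₂ , a , b ⟩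
  ⟨ true , e₁ , e₂ , a , b ⟩ ◂ s = ⟨ false , e₁ , e₂ , a , b ⟩
  ⟨ false , e₁ , e₂ , a , b ⟩ ◂ t = ⟨ false , not e₁ , e₂ , a + sign e₁ , b ⟩
  ⟨ true , e₁ , e₂ , a , b ⟩ ◂ t = ⟨ true , e₁ , not e₂ , a , b + sign e₂ ⟩

  neg-if : Bool → ℤ → ℤ
  neg-if false z = z
  neg-if true z = - z

  inv : G → G
  inv ⟨ false , e₁ , e₂ , a , b ⟩ = ⟨ false , e₁ , e₂ , neg-if (not e₁) a , neg-if (not e₂) b ⟩
  inv ⟨ true , e₁ , e₂ , a , b ⟩ = ⟨ true , e₂ , e₁ , neg-if (not e₂) b , neg-if (not e₁) a ⟩

  cong-G : ∀ {σ e₁ e₂ a a' b b'} → a ≡ a' → b ≡ b' → ⟨ σ , e₁ , e₂ , a , b ⟩ ≡ ⟨ σ , e₁ , e₂ , a' , b' ⟩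
  cong-G refl refl = refl

  cong-G′ : ∀ {σ σ' e₁ e₁' e₂ e₂' a a' b b'} → σ ≡ σ' → e₁ ≡ e₁' → e₂ ≡ e₂' → a ≡ a' → b ≡ b' →
    ⟨ σ , e₁ , e₂ , a , b ⟩ ≡ ⟨ σ' , e₁' , e₂' , a' , b' ⟩
  cong-G′ refl refl refl refl refl = refl

  one-minus-involutive : ∀ a → 1ℤ - (1ℤ - a) ≡ a
  one-minus-involutive = solve-∀

  ·-involutive : ∀ g x → g · g · x ≡ x
  ·-involutive r ⟨ σ , e₁ , e₂ , a , b ⟩ = cong-G′ refl refl (not-involutive e₂) refl (ℤ.neg-involutive b)
  ·-involutive s ⟨ σ , e₁ , e₂ , a , b ⟩ = cong-G′ (not-involutive σ) refl refl refl refl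
  ·-involutive t ⟨ σ , e₁ , e₂ , a , b ⟩ = cong-G′ refl (not-involutive e₁) refl (one-minus-involutive a) refl

  neg-sign : ∀ e z → - (z + sign e) ≡ - z + sign (not e)
  neg-sign e z = trans (ℤ.neg-distrib-+ z (sign e)) (cong (_+_ (- z)) (neg-sign' e))
    where neg-sign' : ∀ e → - sign e ≡ sign (not e)
          neg-sign' false = refl
          neg-sign' true = refl

  one-minus-sign : ∀ e z → 1ℤ - (z + sign e) ≡ (1ℤ - z) + sign (not e)
  one-minus-sign false z = lem z
    where lem : ∀ z → 1ℤ - (z + 1ℤ) ≡ (1ℤ - z) + -1ℤ
          lem = solve-∀
  one-minus-sign true z = lem z
    where lem : ∀ z → 1ℤ - (z + -1ℤ) ≡ (1ℤ - z) + 1ℤ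
          lem = solve-∀

  ·-◂-assoc : ∀ g x h → (g · x) ◂ h ≡ g · (x ◂ h)
  ·-◂-assoc r ⟨ false , e₁ , e₂ , a , b ⟩ r = refl
  ·-◂-assoc r ⟨ true , e₁ , e₂ , a , b ⟩ r = refl
  ·-◂-assoc r ⟨ false , e₁ , e₂ , a , b ⟩ s = refl
  ·-◂-assoc r ⟨ true , e₁ , e₂ , a , b ⟩ s = refl
  ·-◂-assoc r ⟨ false , e₁ , e₂ , a , b ⟩ t = refl
  ·-◂-assoc r ⟨ true , e₁ , e₂ , a , b ⟩ t = cong-G refl (sym (neg-sign e₂ b))
  ·-◂-assoc s ⟨ false , e₁ , e₂ , a , b ⟩ r = refl
  ·-◂-assoc s ⟨ true , e₁ , e₂ , a , b ⟩ r = refl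
  ·-◂-assoc s ⟨ false , e₁ , e₂ , a , b ⟩ s = refl
  ·-◂-assoc s ⟨ true , e₁ , e₂ , a , b ⟩ s = refl
  ·-◂-assoc s ⟨ false , e₁ , e₂ , a , b ⟩ t = refl
  ·-◂-assoc s ⟨ true , e₁ , e₂ , a , b ⟩ t = refl
  ·-◂-assoc t ⟨ false , e₁ , e₂ , a , b ⟩ r = refl
  ·-◂-assoc t ⟨ true , e₁ , e₂ , a , b ⟩ r = refl
  ·-◂-assoc t ⟨ false , e₁ , e₂ , a , b ⟩ s = refl
  ·-◂-assoc t ⟨ true , e₁ , e₂ , a , b ⟩ s = refl
  ·-◂-assoc t ⟨ false , e₁ , e₂ , a , b ⟩ t = cong-G (sym (one-minus-sign e₁ a)) refl
  ·-◂-assoc t ⟨ true , e₁ , e₂ , a , b ⟩ t = refl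

  neg-if-involutive : ∀ e z → neg-if e (neg-if e z) ≡ z
  neg-if-involutive false z = refl
  neg-if-involutive true z = ℤ.neg-involutive z

  inv-involutive : ∀ x → inv (inv x) ≡ x
  inv-involutive ⟨ false , e₁ , e₂ , a , b ⟩ = cong-G (neg-if-involutive (not e₁) a) (neg-if-involutive (not e₂) b)
  inv-involutive ⟨ true , e₁ , e₂ , a , b ⟩ = cong-G (neg-if-involutive (not e₁) a) (neg-if-involutive (not e₂) b)

  neg-if-neg : ∀ e z → neg-if (not (not e)) (- z) ≡ neg-if (not e) z
  neg-if-neg false z = refl
  neg-if-neg true z = ℤ.neg-involutive z

  neg-if-one-minus : ∀ e z → neg-if (not (not e)) (1ℤ - z) ≡ neg-if (not e) z + sign e
  neg-if-one-minus false z = lem z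
    where lem : ∀ z → 1ℤ - z ≡ - z + 1ℤ
          lem = solve-∀
  neg-if-one-minus true z = lem z
    where lem : ∀ z → - (1ℤ - z) ≡ z + -1ℤ
          lem = solve-∀

  inv-· : ∀ g x → inv (g · x) ≡ inv x ◂ g
  inv-· r ⟨ false , e₁ , e₂ , a , b ⟩ = cong-G refl (neg-if-neg e₂ b)
  inv-· r ⟨ true , e₁ , e₂ , a , b ⟩ = cong-G (neg-if-neg e₂ b) refl
  inv-· s ⟨ false , e₁ , e₂ , a , b ⟩ = refl
  inv-· s ⟨ true , e₁ , e₂ , a , b ⟩ = refl
  inv-· t ⟨ false , e₁ , e₂ , a , b ⟩ = cong-G (neg-if-one-minus e₁ a) refl
  inv-· t ⟨ true , e₁ , e₂ , a , b ⟩ = cong-G refl (neg-if-one-minus e₁ a)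

  inv-◂ : ∀ x g → inv (x ◂ g) ≡ g · inv x
  inv-◂ x g = begin
    inv (x ◂ g)             ≡⟨ cong (λ y → inv (y ◂ g)) (inv-involutive x) ⟨
    inv (inv (inv x) ◂ g)   ≡⟨ cong inv (inv-· g (inv x)) ⟨
    inv (inv (g · inv x))   ≡⟨ inv-involutive _ ⟩
    g · inv x               ∎
    where open ≡-Reasoning

  -- Alcove coordinates, descents and length.

  -- The alcove of x consists of the points with i < X < i + 1, j < Y < j + 1,
  -- 2k < X − Y < 2k + 2 and 2l < X + Y < 2l + 2.
  ι : Bool → ℤ
  ι false = 0ℤ
  ι true = 1ℤ

  coord-i coord-j coord-k coord-l : G → ℤ
  coord-i ⟨ σ , e₁ , e₂ , a , b ⟩ = a + a - ι e₁
  coord-j ⟨ σ , e₁ , e₂ , a , b ⟩ = b + b - ι e₂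
  -- In the base alcove 0 < y < x, so ±x ± y has the sign of its term in x. The correction is read
  -- from the entry carrying x: the first one here, the second one after a swap, where X - Y
  -- reverses its sign.
  coord-k ⟨ false , e₁ , e₂ , a , b ⟩ = a - b - ι e₁
  coord-k ⟨ true , e₁ , e₂ , a , b ⟩ = a - b - ι (not e₂)
  coord-l ⟨ false , e₁ , e₂ , a , b ⟩ = a + b - ι e₁
  coord-l ⟨ true , e₁ , e₂ , a , b ⟩ = a + b - ι e₂

  j-r : ∀ x → coord-j (r · x) ≡ -1ℤ - coord-j x
  j-r ⟨ σ , e₁ , false , a , b ⟩ = lem b
    where lem : ∀ b → - b + - b - 1ℤ ≡ -1ℤ - (b + b - 0ℤ)
          lem = solve-∀
  j-r ⟨ σ , e₁ , true , a , b ⟩ = lem b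
    where lem : ∀ b → - b + - b - 0ℤ ≡ -1ℤ - (b + b - 1ℤ)
          lem = solve-∀

  k-r : ∀ x → coord-k (r · x) ≡ coord-l x
  k-r ⟨ false , e₁ , e₂ , a , b ⟩ = cong (λ z → a + z - ι e₁) (ℤ.neg-involutive b)
  k-r ⟨ true , e₁ , e₂ , a , b ⟩ = cong₂ (λ z e → a + z - ι e) (ℤ.neg-involutive b) (not-involutive e₂)

  l-r : ∀ x → coord-l (r · x) ≡ coord-k x
  l-r ⟨ false , e₁ , e₂ , a , b ⟩ = refl
  l-r ⟨ true , e₁ , e₂ , a , b ⟩ = refl

  ι-not : ∀ e → ι (not e) ≡ 1ℤ - ι e
  ι-not false = refl
  ι-not true = refl

  k-s : ∀ x → coord-k (s · x) ≡ -1ℤ - coord-k x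
  k-s ⟨ false , e₁ , e₂ , a , b ⟩ = trans (cong (_-_ (b - a)) (ι-not e₁)) (lem a b (ι e₁))
    where lem : ∀ a b e → b - a - (1ℤ - e) ≡ -1ℤ - (a - b - e)
          lem = solve-∀
  k-s ⟨ true , e₁ , e₂ , a , b ⟩ = trans (lem a b (ι e₂)) (cong (λ z → -1ℤ - (a - b - z)) (sym (ι-not e₂)))
    where lem : ∀ a b e → b - a - e ≡ -1ℤ - (a - b - (1ℤ - e))
          lem = solve-∀

  l-s : ∀ x → coord-l (s · x) ≡ coord-l x
  l-s ⟨ false , e₁ , e₂ , a , b ⟩ = cong (_- ι e₁) (ℤ.+-comm b a)
  l-s ⟨ true , e₁ , e₂ , a , b ⟩ = cong (_- ι e₂) (ℤ.+-comm b a)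

  i-t : ∀ x → coord-i (t · x) ≡ 1ℤ - coord-i x
  i-t ⟨ σ , e₁ , e₂ , a , b ⟩ = trans (cong (_-_ (1ℤ - a + (1ℤ - a))) (ι-not e₁)) (lem a (ι e₁))
    where lem : ∀ a e → 1ℤ - a + (1ℤ - a) - (1ℤ - e) ≡ 1ℤ - (a + a - e)
          lem = solve-∀

  k-t : ∀ x → coord-k (t · x) ≡ - coord-l x
  k-t ⟨ false , e₁ , e₂ , a , b ⟩ = trans (cong (_-_ (1ℤ - a - b)) (ι-not e₁)) (lem a b (ι e₁))
    where lem : ∀ a b e → 1ℤ - a - b - (1ℤ - e) ≡ - (a + b - e)
          lem = solve-∀
  k-t ⟨ true , e₁ , e₂ , a , b ⟩ = trans (cong (_-_ (1ℤ - a - b)) (ι-not e₂)) (lem a b (ι e₂))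
    where lem : ∀ a b e → 1ℤ - a - b - (1ℤ - e) ≡ - (a + b - e)
          lem = solve-∀

  l-t : ∀ x → coord-l (t · x) ≡ - coord-k x
  l-t ⟨ false , e₁ , e₂ , a , b ⟩ = trans (cong (_-_ (1ℤ - a + b)) (ι-not e₁)) (lem a b (ι e₁))
    where lem : ∀ a b e → 1ℤ - a + b - (1ℤ - e) ≡ - (a - b - e)
          lem = solve-∀
  l-t ⟨ true , e₁ , e₂ , a , b ⟩ = trans (lem a b (ι e₂)) (cong (λ z → - (a - b - z)) (sym (ι-not e₂)))
    where lem : ∀ a b e → 1ℤ - a + b - e ≡ - (a - b - (1ℤ - e))
          lem = solve-∀

  is-neg is-pos : ℤ → Bool
  is-neg (+ _) = false
  is-neg -[1+ _ ] = true
  is-pos (+ zero) = false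
  is-pos (+ suc _) = true
  is-pos -[1+ _ ] = false

  descent : Gen → G → Bool
  descent r x = is-neg (coord-j x)
  descent s x = is-neg (coord-k x)
  descent t x = is-pos (coord-i x)

  len : G → ℕ
  len x = ∣ coord-i x ∣ ℕ.+ ∣ coord-j x ∣ ℕ.+ (∣ coord-k x ∣ ℕ.+ ∣ coord-l x ∣)

  is-neg-refl : ∀ z → is-neg (-1ℤ - z) ≡ not (is-neg z)
  is-neg-refl (+ zero) = refl
  is-neg-refl (+ suc n) = refl
  is-neg-refl -[1+ n ] = refl

  is-pos-refl : ∀ z → is-pos (1ℤ - z) ≡ not (is-pos z)
  is-pos-refl (+ zero) = refl
  is-pos-refl (+ suc zero) = refl
  is-pos-refl (+ suc (suc n)) = refl
  is-pos-refl -[1+ n ] = refl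

  descent-· : ∀ g x → descent g (g · x) ≡ not (descent g x)
  descent-· r x = trans (cong is-neg (j-r x)) (is-neg-refl (coord-j x))
  descent-· s x = trans (cong is-neg (k-s x)) (is-neg-refl (coord-k x))
  descent-· t x = trans (cong is-pos (i-t x)) (is-pos-refl (coord-i x))

  -- +1 at a descent and -1 otherwise: both the drop in length under g and the power of v by which
  -- T_g + v⁻¹ multiplies its diagonal term at Tₓ.
  sgn : Gen → G → ℤ
  sgn g x = - sign (descent g x)

  abs-refl-neg : ∀ z → + ∣ -1ℤ - z ∣ ≡ + ∣ z ∣ + sign (is-neg z)
  abs-refl-neg (+ zero) = refl
  abs-refl-neg (+ suc n) = cong (λ m → + suc m) (sym (ℕ.+-comm n 1))
  abs-refl-neg -[1+ n ] = refl

  abs-refl-pos : ∀ z → + ∣ 1ℤ - z ∣ ≡ + ∣ z ∣ + sign (is-pos z)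
  abs-refl-pos (+ zero) = refl
  abs-refl-pos (+ suc zero) = refl
  abs-refl-pos (+ suc (suc n)) = refl
  abs-refl-pos -[1+ n ] = cong (λ m → + suc m) (sym (ℕ.+-comm n 1))

  -- A generator permutes the coordinates up to sign, except that the one deciding its own descent
  -- is reflected about -1/2 or 1/2, which changes its absolute value by one.
  len-· : ∀ g x → + len (g · x) ≡ + len x - sgn g x
  len-· r x rewrite j-r x | k-r x | l-r x = 
    lem (+ ∣ coord-i x ∣) (+ ∣ coord-j x ∣) (+ ∣ -1ℤ - coord-j x ∣) (+ ∣ coord-k x ∣) (+ ∣ coord-l x ∣) (sign (is-neg (coord-j x))) (abs-refl-neg (coord-j x))
    where
    lem : ∀ i j j' k l d → j' ≡ j + d → i + j' + (l + k) ≡ i + j + (k + l) - - d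
    lem i j _ k l d refl = identity i j k l d
      where identity : ∀ i j k l d → i + (j + d) + (l + k) ≡ i + j + (k + l) - - d
            identity = solve-∀
  len-· s x rewrite k-s x | l-s x = 
    lem (+ ∣ coord-i x ∣) (+ ∣ coord-j x ∣) (+ ∣ coord-k x ∣) (+ ∣ -1ℤ - coord-k x ∣) (+ ∣ coord-l x ∣) (sign (is-neg (coord-k x))) (abs-refl-neg (coord-k x))
    where
    lem : ∀ i j k k' l d → k' ≡ k + d → j + i + (k' + l) ≡ i + j + (k + l) - - d
    lem i j k _ l d refl = identity i j k l d
      where identity : ∀ i j k l d → j + i + (k + d + l) ≡ i + j + (k + l) - - d
            identity = solve-∀
  len-· t x rewrite i-t x | k-t x | l-t x | ℤ.∣-i∣≡∣i∣ (coord-k x) | ℤ.∣-i∣≡∣i∣ (coord-l x) =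
    lem (+ ∣ coord-i x ∣) (+ ∣ 1ℤ - coord-i x ∣) (+ ∣ coord-j x ∣) (+ ∣ coord-k x ∣) (+ ∣ coord-l x ∣) (sign (is-pos (coord-i x))) (abs-refl-pos (coord-i x))
    where
    lem : ∀ i i' j k l d → i' ≡ i + d → i' + j + (l + k) ≡ i + j + (k + l) - - d
    lem i _ j k l d refl = identity i j k l d
      where identity : ∀ i j k l d → i + d + j + (l + k) ≡ i + j + (k + l) - - d
            identity = solve-∀

  len-down : ∀ g x → descent g x ≡ true → len x ≡ suc (len (g · x))
  len-down g x p = ℤ.+-injective (begin
    + len x                    ≡⟨ lem (+ len x) ⟩
    1ℤ + (+ len x - 1ℤ)        ≡⟨ cong (λ d → 1ℤ + (+ len x - - sign d)) p ⟨
    1ℤ + (+ len x - sgn g x)   ≡⟨ cong (λ z → 1ℤ + z) (len-· g x) ⟨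
    + suc (len (g · x))        ∎)
    where
    open ≡-Reasoning
    lem : ∀ z → z ≡ 1ℤ + (z - 1ℤ)
    lem = solve-∀

  len-up : ∀ g x → descent g x ≡ false → len (g · x) ≡ suc (len x)
  len-up g x p = trans (len-down g (g · x) (trans (descent-· g x) (cong not p))) (cong (λ y → suc (len y)) (·-involutive g x))

open AffineGroup

-- The exchange property and descents in dihedral subgroups.

module Descents where
  open import Data.Integer using (_+_; _-_; -_)
  open import Data.Integer.Tactic.RingSolver using (solve-∀)

  private
    even≷odd : ∀ b → is-neg (b + b - 1ℤ) ≡ is-neg (b + b - 0ℤ) ⊎ b ≡ 0ℤ
    even≷odd (+ zero) = inj₂ refl
    even≷odd (+ suc n) = inj₁ refl
    even≷odd -[1+ n ] = inj₁ refl

    d≷d-1 : ∀ d → is-neg (d - 1ℤ) ≡ is-neg (d - 0ℤ) ⊎ d ≡ 0ℤ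
    d≷d-1 (+ zero) = inj₂ refl
    d≷d-1 (+ suc n) = inj₁ refl
    d≷d-1 -[1+ n ] = inj₁ refl

    flip-⊎ : ∀ {A P Q : Set} {x y : A} → (x ≡ y ⊎ P) → (P → Q) → (y ≡ x ⊎ Q)
    flip-⊎ (inj₁ p) f = inj₁ (sym p)
    flip-⊎ (inj₂ p) f = inj₂ (f p)

    map-⊎ : ∀ {A P Q : Set} → (A ⊎ P) → (P → Q) → (A ⊎ Q)
    map-⊎ (inj₁ p) f = inj₁ p
    map-⊎ (inj₂ p) f = inj₂ (f p)

    neg-2b+1 : ∀ b → is-neg (b + 1ℤ + (b + 1ℤ) - 1ℤ) ≡ is-neg (b + b - 0ℤ)
    neg-2b+1 (+ n) rewrite ℕ.+-comm n 1 = refl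
    neg-2b+1 -[1+ zero ] = refl
    neg-2b+1 -[1+ suc n ] = refl

    neg-2b-2 : ∀ b → is-neg (b + -1ℤ + (b + -1ℤ) - 0ℤ) ≡ is-neg (b + b - 1ℤ)
    neg-2b-2 (+ zero) = refl
    neg-2b-2 (+ suc zero) = refl
    neg-2b-2 (+ suc (suc n)) = refl
    neg-2b-2 -[1+ n ] = refl

    pos-2a-1 : ∀ a → is-pos (a + a - 1ℤ) ≡ is-pos (a + a - 0ℤ)
    pos-2a-1 (+ zero) = refl
    pos-2a-1 (+ suc n) rewrite ℕ.+-suc n n = refl
    pos-2a-1 -[1+ n ] = refl

    pos-2a+1 : ∀ a → is-pos (a + 1ℤ + (a + 1ℤ) - 1ℤ) ≡ is-pos (a + a - 0ℤ) ⊎ a ≡ 0ℤ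
    pos-2a+1 (+ zero) = inj₂ refl
    pos-2a+1 (+ suc n) rewrite ℕ.+-comm n 1 = inj₁ refl
    pos-2a+1 -[1+ zero ] = inj₁ refl
    pos-2a+1 -[1+ suc n ] = inj₁ refl

    pos-2a-2 : ∀ a → is-pos (a + -1ℤ + (a + -1ℤ) - 0ℤ) ≡ is-pos (a + a - 1ℤ) ⊎ a ≡ 1ℤ
    pos-2a-2 (+ zero) = inj₁ refl
    pos-2a-2 (+ suc zero) = inj₂ refl
    pos-2a-2 (+ suc (suc n)) = inj₁ refl
    pos-2a-2 -[1+ n ] = inj₁ refl

    k-crossed : ∀ {σ σ' e₁ e₂ a b} → a - b ≡ 0ℤ → e₁ ≡ e₂ → σ' ≡ not σ →
      ⟨ not σ , e₂ , e₁ , b , a ⟩ ≡ ⟨ σ' , e₁ , e₂ , a , b ⟩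
    k-crossed {a = a} {b} p refl refl with ℤ.i-j≡0⇒i≡j a b p
    ... | refl = refl

    k-shift : ∀ e a b → (a + sign e) - b - ι (not e) ≡ a - b - ι e
    k-shift false = lem
      where lem : ∀ a b → (a + 1ℤ) - b - 1ℤ ≡ a - b - 0ℤ
            lem = solve-∀
    k-shift true = lem
      where lem : ∀ a b → (a + -1ℤ) - b - 0ℤ ≡ a - b - 1ℤ
            lem = solve-∀

    k-shift′ : ∀ e a b → a - (b + sign e) - ι (not (not e)) ≡ a - b - ι (not e)
    k-shift′ false = lem
      where lem : ∀ a b → a - (b + 1ℤ) - 0ℤ ≡ a - b - 1ℤ
            lem = solve-∀
    k-shift′ true = lem
      where lem : ∀ a b → a - (b + -1ℤ) - 1ℤ ≡ a - b - 0ℤ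
            lem = solve-∀

  -- Passing from an alcove to an adjacent one crosses exactly one wall; if the
  -- reflection g separates the two, that wall is the one of g.
  exchange : ∀ g x h → descent g (x ◂ h) ≡ descent g x ⊎ g · x ≡ x ◂ h
  exchange r ⟨ false , e₁ , false , a , b ⟩ r = map-⊎ (even≷odd b) λ { refl → refl }
  exchange r ⟨ false , e₁ , true , a , b ⟩ r = flip-⊎ (even≷odd b) λ { refl → refl }
  exchange r ⟨ true , e₁ , e₂ , a , b ⟩ r = inj₁ refl
  exchange r ⟨ false , e₁ , e₂ , a , b ⟩ s = inj₁ refl
  exchange r ⟨ true , e₁ , e₂ , a , b ⟩ s = inj₁ refl
  exchange r ⟨ false , e₁ , e₂ , a , b ⟩ t = inj₁ refl
  exchange r ⟨ true , e₁ , false , a , b ⟩ t = inj₁ (neg-2b+1 b)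
  exchange r ⟨ true , e₁ , true , a , b ⟩ t = inj₁ (neg-2b-2 b)
  exchange s ⟨ false , e₁ , e₂ , a , b ⟩ r = inj₁ refl
  exchange s ⟨ true , e₁ , e₂ , a , b ⟩ r = inj₁ refl
  exchange s ⟨ false , false , false , a , b ⟩ s = map-⊎ (d≷d-1 (a - b)) λ p → k-crossed p refl refl
  exchange s ⟨ false , false , true , a , b ⟩ s = inj₁ refl
  exchange s ⟨ false , true , false , a , b ⟩ s = inj₁ refl
  exchange s ⟨ false , true , true , a , b ⟩ s = flip-⊎ (d≷d-1 (a - b)) λ p → k-crossed p refl refl
  exchange s ⟨ true , false , false , a , b ⟩ s = flip-⊎ (d≷d-1 (a - b)) λ p → k-crossed p refl refl
  exchange s ⟨ true , false , true , a , b ⟩ s = inj₁ refl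
  exchange s ⟨ true , true , false , a , b ⟩ s = inj₁ refl
  exchange s ⟨ true , true , true , a , b ⟩ s = map-⊎ (d≷d-1 (a - b)) λ p → k-crossed p refl refl
  exchange s ⟨ false , e₁ , e₂ , a , b ⟩ t = inj₁ (cong is-neg (k-shift e₁ a b))
  exchange s ⟨ true , e₁ , e₂ , a , b ⟩ t = inj₁ (cong is-neg (k-shift′ e₂ a b))
  exchange t ⟨ false , e₁ , e₂ , a , b ⟩ r = inj₁ refl
  exchange t ⟨ true , false , e₂ , a , b ⟩ r = inj₁ (pos-2a-1 a)
  exchange t ⟨ true , true , e₂ , a , b ⟩ r = inj₁ (sym (pos-2a-1 a))
  exchange t ⟨ false , e₁ , e₂ , a , b ⟩ s = inj₁ refl
  exchange t ⟨ true , e₁ , e₂ , a , b ⟩ s = inj₁ refl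
  exchange t ⟨ false , false , e₂ , a , b ⟩ t = map-⊎ (pos-2a+1 a) λ { refl → refl }
  exchange t ⟨ false , true , e₂ , a , b ⟩ t = map-⊎ (pos-2a-2 a) λ { refl → refl }
  exchange t ⟨ true , e₁ , e₂ , a , b ⟩ t = inj₁ refl

  -- From 2X = (X - Y) + (X + Y) and X + Y = (X - Y) + 2Y; the Booleans are the carries lost in
  -- rounding to strips.
  coord-constraint : ∀ x → ∃₂ λ p q → coord-i x ≡ coord-k x + coord-l x + ι p × coord-l x ≡ coord-k x + coord-j x + ι q
  coord-constraint ⟨ false , e₁ , e₂ , a , b ⟩ = e₁ , e₂ , lem₁ a b (ι e₁) , lem₂ a b (ι e₁) (ι e₂)
    where
    lem₁ : ∀ a b e → a + a - e ≡ a - b - e + (a + b - e) + e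
    lem₁ = solve-∀
    lem₂ : ∀ a b e e' → a + b - e ≡ a - b - e + (b + b - e') + e'
    lem₂ = solve-∀
  coord-constraint ⟨ true , e₁ , e₂ , a , b ⟩ rewrite ι-not e₂ = not e₁ , not e₂ ,
    trans (lem₁ a b (ι e₁) (ι e₂)) (cong (λ z → a - b - (1ℤ - ι e₂) + (a + b - ι e₂) + z) (sym (ι-not e₁))) ,
    trans (lem₂ a b (ι e₂)) (cong (λ z → a - b - (1ℤ - ι e₂) + (b + b - ι e₂) + z) (sym (ι-not e₂)))
    where
    lem₁ : ∀ a b e e' → a + a - e ≡ a - b - (1ℤ - e') + (a + b - e') + (1ℤ - e)
    lem₁ = solve-∀
    lem₂ : ∀ a b e → a + b - e ≡ a - b - (1ℤ - e) + (b + b - e) + (1ℤ - e)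
    lem₂ = solve-∀

  is-neg-+ : ∀ x y p {z} → z ≡ x + y + ι p → is-neg x ≡ true → is-neg y ≡ true → is-neg z ≡ true
  is-neg-+ -[1+ m ] -[1+ n ] false refl _ _ = refl
  is-neg-+ -[1+ m ] -[1+ n ] true refl _ _ = refl

  is-pos-- : ∀ x y p {z} → x ≡ y + z + ι p → is-neg y ≡ true → is-pos x ≡ true → is-pos z ≡ true
  is-pos-- (+ suc m) -[1+ n ] p {z} eq _ _ = helper p (trans (lem z -[1+ n ] (ι p)) (cong (λ w → w - -[1+ n ] - ι p) (sym eq)))
    where
    lem : ∀ z y p → z ≡ y + z + p - y - p
    lem = solve-∀
    helper : ∀ p → z ≡ + suc m - -[1+ n ] - ι p → is-pos z ≡ true
    helper false refl = refl
    helper true refl rewrite ℕ.+-suc m n = refl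

  -- An alcove beyond Y = 0 and X = Y is opposite to the base alcove at the origin, hence also
  -- beyond the other two walls through it, X + Y = 0 and X = 0.
  coords-neg : ∀ x → is-neg (coord-j x) ≡ true → is-neg (coord-k x) ≡ true →
    is-neg (coord-l x) ≡ true × is-neg (coord-i x) ≡ true
  coords-neg x nj nk with coord-constraint x
  ... | p , q , pi , pl = nl , is-neg-+ (coord-k x) (coord-l x) p pi nk nl
    where nl = is-neg-+ (coord-k x) (coord-j x) q pl nk nj

  -- The same at the vertex (1,1), whose other two walls are X + Y = 2 and Y = 1.
  coords-pos : ∀ x → is-neg (coord-k x) ≡ true → is-pos (coord-i x) ≡ true →
    is-pos (coord-l x) ≡ true × is-pos (coord-j x) ≡ true
  coords-pos x nk pi with coord-constraint x
  ... | p , q , ei , el = pl , is-pos-- (coord-l x) (coord-k x) q el nk pl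
    where pl = is-pos-- (coord-i x) (coord-k x) p ei nk pi

  is-neg-neg : ∀ z → is-neg (- z) ≡ is-pos z
  is-neg-neg (+ zero) = refl
  is-neg-neg (+ suc n) = refl
  is-neg-neg -[1+ n ] = refl

  true≢false : ∀ {A : Set} {b} → b ≡ true → b ≡ false → A
  true≢false refl ()

  data Bond : Gen → Gen → Set where
    rs : Bond r s
    sr : Bond s r
    st : Bond s t
    ts : Bond t s

  data Commute : Gen → Gen → Set where
    rt : Commute r t
    tr : Commute t r

  commute-sym : ∀ {g h} → Commute g h → Commute h g
  commute-sym rt = tr
  commute-sym tr = rt

  bond-sym : ∀ {g h} → Bond g h → Bond h g
  bond-sym rs = sr
  bond-sym sr = rs
  bond-sym st = ts
  bond-sym ts = st

  trichotomy : ∀ g h → g ≡ h ⊎ (Bond g h ⊎ Commute g h)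
  trichotomy r r = inj₁ refl
  trichotomy r s = inj₂ (inj₁ rs)
  trichotomy r t = inj₂ (inj₂ rt)
  trichotomy s r = inj₂ (inj₁ sr)
  trichotomy s s = inj₁ refl
  trichotomy s t = inj₂ (inj₁ st)
  trichotomy t r = inj₂ (inj₂ tr)
  trichotomy t s = inj₂ (inj₁ ts)
  trichotomy t t = inj₁ refl

  commute-· : ∀ {g h} → Commute g h → ∀ x → g · h · x ≡ h · g · x
  commute-· rt x = refl
  commute-· tr x = refl

  commute-descent : ∀ {g h} → Commute g h → ∀ x → descent g (h · x) ≡ descent g x
  commute-descent rt x = refl
  commute-descent tr x = refl

  braid-· : ∀ {g h} → Bond g h → ∀ x → g · h · g · h · x ≡ h · g · h · g · x
  braid-· rs x = refl
  braid-· sr x = refl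
  braid-· st x = refl
  braid-· ts x = refl

  -- If g and h both shorten x, the longest element ghgh of their dihedral group can be stripped off
  -- letter by letter. Each descent after some letters is a test on one of the four walls through
  -- the common vertex.
  bond-descents : ∀ {g h} → Bond g h → ∀ x → descent g x ≡ true → descent h x ≡ true →
    descent h (g · x) ≡ true × descent g (h · g · x) ≡ true × descent h (g · h · g · x) ≡ true
  bond-descents rs x p q with coords-neg x p q
  ... | nl , ni = trans (cong is-neg (k-r x)) nl , ni ,
    trans (cong is-neg (trans (k-r (s · r · x)) (trans (l-s (r · x)) (l-r x)))) q
  bond-descents sr x p q with coords-neg x q p
  ... | nl , ni = ni , trans (cong is-neg (trans (k-r (s · x)) (l-s x))) nl , q
  bond-descents ts x p q with coords-pos x q p
  ... | pl , pj = trans (cong is-neg (k-t x)) (trans (is-neg-neg (coord-l x)) pl) , pj ,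
    trans (cong is-neg (trans (k-t (s · t · x)) (trans (cong -_ (trans (l-s (t · x)) (l-t x))) (ℤ.neg-involutive _)))) q
  bond-descents st x p q with coords-pos x p q
  ... | pl , pj = pj , trans (cong is-neg (trans (k-t (s · x)) (cong -_ (l-s x)))) (trans (is-neg-neg (coord-l x)) pl) , q

  private
    nonneg : ∀ z → is-neg z ≡ false → ∃ λ n → z ≡ + n
    nonneg (+ n) _ = n , refl

    2a≡0 : ∀ a → a + a - 0ℤ ≡ 0ℤ → a ≡ 0ℤ
    2a≡0 (+ zero) p = refl

    2a-1≢0 : ∀ a {A : Set} → a + a - 1ℤ ≡ 0ℤ → A
    2a-1≢0 (+ zero) ()
    2a-1≢0 (+ suc n) p rewrite ℕ.+-suc n n with p
    ... | ()

    -- Parity of i and j excludes the signs, then a = b = 0, and k = 0 excludes the swap s, for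
    -- which k = -1.
    zero-coords : ∀ x → coord-i x ≡ 0ℤ → coord-j x ≡ 0ℤ → coord-k x ≡ 0ℤ → x ≡ ε
    zero-coords ⟨ σ , true , e₂ , a , b ⟩ p q u = 2a-1≢0 a p
    zero-coords ⟨ σ , false , true , a , b ⟩ p q u = 2a-1≢0 b q
    zero-coords ⟨ σ , false , false , a , b ⟩ p q u with 2a≡0 a p | 2a≡0 b q
    zero-coords ⟨ false , false , false , a , b ⟩ p q u | refl | refl = refl
    zero-coords ⟨ true , false , false , a , b ⟩ p q () | refl | refl

  -- Without descents j and k are nonnegative and i is not positive, while `coord-constraint` makes
  -- i the sum of 2k, j and two carries; so all of them vanish.
  no-descent : ∀ x → (∀ g → descent g x ≡ false) → x ≡ ε
  no-descent x nd with nonneg (coord-j x) (nd r) | nonneg (coord-k x) (nd s) | coord-constraint x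
  ... | j , pj | k , pk | p , q , pi , pl = conclude p q pi pl
    where
    conclude : ∀ p q → coord-i x ≡ coord-k x + coord-l x + ι p → coord-l x ≡ coord-k x + coord-j x + ι q → x ≡ ε
    conclude p q pi pl rewrite pl | pk | pj with nd t
    ... | ni rewrite pi = finish k j p q ni pj pk pi
      where
      finish : ∀ k j p q → is-pos (+ k + (+ k + + j + ι q) + ι p) ≡ false → coord-j x ≡ + j → coord-k x ≡ + k →
        coord-i x ≡ + k + (+ k + + j + ι q) + ι p → x ≡ ε
      finish zero zero false false _ pj pk pi = zero-coords x pi pj pk
      finish zero (suc j) false false () _ _ _
      finish zero zero true false () _ _ _
      finish zero zero false true () _ _ _
      finish zero zero true true () _ _ _
      finish zero (suc j) true false () _ _ _
      finish zero (suc j) false true () _ _ _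
      finish zero (suc j) true true () _ _ _
      finish (suc k) j true false () _ _ _
      finish (suc k) j false true () _ _ _
      finish (suc k) j true true () _ _ _
      finish (suc k) j false false () _ _ _

  descent-ε : ∀ g → descent g ε ≡ false
  descent-ε r = refl
  descent-ε s = refl
  descent-ε t = refl

open Descents

-- Words, the faithful action and the searched length.

module Words where
  open import Data.Integer using (_+_; _-_; -_)
  open import Data.Integer.Tactic.RingSolver using (solve-∀)

  nf : W → G
  nf [] = ε
  nf (g ∷ w) = g · nf w

  point : G → Pt → Pt
  point ⟨ false , e₁ , e₂ , a , b ⟩ (x , y) = a + a + neg-if e₁ x , b + b + neg-if e₂ y
  point ⟨ true , e₁ , e₂ , a , b ⟩ (x , y) = a + a + neg-if e₁ y , b + b + neg-if e₂ x

  private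
    point-neg : ∀ e b y → - (b + b + neg-if e y) ≡ - b + - b + neg-if (not e) y
    point-neg false b y = lem b y
      where lem : ∀ b y → - (b + b + y) ≡ - b + - b + - y
            lem = solve-∀
    point-neg true b y = lem b y
      where lem : ∀ b y → - (b + b + - y) ≡ - b + - b + y
            lem = solve-∀

    point-two-minus : ∀ e a x → (+ 2) - (a + a + neg-if e x) ≡ (1ℤ - a) + (1ℤ - a) + neg-if (not e) x
    point-two-minus false a x = lem a x
      where lem : ∀ a x → (+ 2) - (a + a + x) ≡ (1ℤ - a) + (1ℤ - a) + - x
            lem = solve-∀
    point-two-minus true a x = lem a x
      where lem : ∀ a x → (+ 2) - (a + a + - x) ≡ (1ℤ - a) + (1ℤ - a) + x
            lem = solve-∀

  act-point : ∀ g x p → act g (point x p) ≡ point (g · x) p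
  act-point r ⟨ false , e₁ , e₂ , a , b ⟩ (x , y) = cong (_ ,_) (point-neg e₂ b y)
  act-point r ⟨ true , e₁ , e₂ , a , b ⟩ (x , y) = cong (_ ,_) (point-neg e₂ b x)
  act-point s ⟨ false , e₁ , e₂ , a , b ⟩ (x , y) = refl
  act-point s ⟨ true , e₁ , e₂ , a , b ⟩ (x , y) = refl
  act-point t ⟨ false , e₁ , e₂ , a , b ⟩ (x , y) = cong (_, _) (point-two-minus e₁ a x)
  act-point t ⟨ true , e₁ , e₂ , a , b ⟩ (x , y) = cong (_, _) (point-two-minus e₁ a y)

  evPt-nf : ∀ w p → evPt w p ≡ point (nf w) p
  evPt-nf [] (x , y) = cong₂ _,_ (sym (ℤ.+-identityˡ x)) (sym (ℤ.+-identityˡ y))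
  evPt-nf (g ∷ w) p = trans (cong (act g) (evPt-nf w p)) (act-point g (nf w) p)

  nf⇒≈ : ∀ {u w} → nf u ≡ nf w → u ≈ w
  nf⇒≈ {u} {w} p = cong₂ _,_ (eq _) (cong₂ _,_ (eq _) (eq _))
    where
    eq : ∀ q → evPt u q ≡ evPt w q
    eq q = trans (evPt-nf u q) (trans (cong (λ x → point x q) p) (sym (evPt-nf w q)))

  private
    double-injective : ∀ a b → a + a ≡ b + b → a ≡ b
    double-injective a b p = ℤ.*-cancelˡ-≡ (+ 2) a b (trans (lem a) (trans p (sym (lem b))))
      where lem : ∀ a → (+ 2) ℤ.* a ≡ a + a
            lem = solve-∀

    neg-if-0 : ∀ e → neg-if e 0ℤ ≡ 0ℤ
    neg-if-0 false = refl
    neg-if-0 true = refl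

    origin : ∀ x → point x (0ℤ , 0ℤ) ≡ (G.a x + G.a x , G.b x + G.b x)
    origin ⟨ false , e₁ , e₂ , a , b ⟩ rewrite neg-if-0 e₁ | neg-if-0 e₂ = cong₂ _,_ (ℤ.+-identityʳ _) (ℤ.+-identityʳ _)
    origin ⟨ true , e₁ , e₂ , a , b ⟩ rewrite neg-if-0 e₁ | neg-if-0 e₂ = cong₂ _,_ (ℤ.+-identityʳ _) (ℤ.+-identityʳ _)

    -- The arguments are one coordinate of the two linear basis images. Exactly one of them is
    -- nonzero: its place gives σ, its value the sign. For the second coordinate of the map the two
    -- images change roles.
    decode : ℤ → ℤ → Bool × Bool
    decode u v = (if ⌊0⌋ u then true else false) , is-neg (u + v)
      where
      ⌊0⌋ : ℤ → Bool
      ⌊0⌋ (+ zero) = true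
      ⌊0⌋ _ = false

    decode-first : ∀ σ e → decode (neg-if e (if σ then 0ℤ else 1ℤ)) (neg-if e (if σ then 1ℤ else 0ℤ)) ≡ (σ , e)
    decode-first false false = refl
    decode-first false true = refl
    decode-first true false = refl
    decode-first true true = refl

    basis₁ : ∀ x → point x (1ℤ , 0ℤ) ≡
      (G.a x + G.a x + neg-if (G.e₁ x) (if G.σ x then 0ℤ else 1ℤ) , G.b x + G.b x + neg-if (G.e₂ x) (if G.σ x then 1ℤ else 0ℤ))
    basis₁ ⟨ false , e₁ , e₂ , a , b ⟩ = refl
    basis₁ ⟨ true , e₁ , e₂ , a , b ⟩ = refl

    basis₂ : ∀ x → point x (0ℤ , 1ℤ) ≡
      (G.a x + G.a x + neg-if (G.e₁ x) (if G.σ x then 1ℤ else 0ℤ) , G.b x + G.b x + neg-if (G.e₂ x) (if G.σ x then 0ℤ else 1ℤ))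
    basis₂ ⟨ false , e₁ , e₂ , a , b ⟩ = refl
    basis₂ ⟨ true , e₁ , e₂ , a , b ⟩ = refl

  point-injective : ∀ x y → (∀ p → p ∈ ((0ℤ , 0ℤ) ∷ (1ℤ , 0ℤ) ∷ (0ℤ , 1ℤ) ∷ []) → point x p ≡ point y p) → x ≡ y
  point-injective x@(⟨ σ , e₁ , e₂ , a , b ⟩) y@(⟨ σ' , e₁' , e₂' , a' , b' ⟩) h =
    cong-G′ (cong proj₁ first) (cong proj₂ first) (cong proj₂ second) pa pb
    where
    p₀ = trans (sym (origin x)) (trans (h _ (here refl)) (origin y))
    p₁ = trans (sym (basis₁ x)) (trans (h _ (there (here refl))) (basis₁ y))
    p₂ = trans (sym (basis₂ x)) (trans (h _ (there (there (here refl)))) (basis₂ y))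
    pa : a ≡ a'
    pa = double-injective a a' (cong proj₁ p₀)
    pb : b ≡ b'
    pb = double-injective b b' (cong proj₂ p₀)
    cancel : ∀ {c c' u v} → c ≡ c' → c + c + u ≡ c' + c' + v → u ≡ v
    cancel {c} {u = u} {v} refl q = ∙-cancelˡ (c + c) u v q
      where open import Algebra.Properties.AbelianGroup ℤ.+-0-abelianGroup using (∙-cancelˡ)
    first : (σ , e₁) ≡ (σ' , e₁')
    first = trans (sym (decode-first σ e₁))
      (trans (cong₂ decode (cancel pa (cong proj₁ p₁)) (cancel pa (cong proj₁ p₂))) (decode-first σ' e₁'))
    second : (σ , e₂) ≡ (σ' , e₂')
    second = trans (sym (decode-first σ e₂))
      (trans (cong₂ decode (cancel pb (cong proj₂ p₂)) (cancel pb (cong proj₂ p₁))) (decode-first σ' e₂'))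

  ≈⇒nf : ∀ {u w} → u ≈ w → nf u ≡ nf w
  ≈⇒nf {u} {w} p = point-injective (nf u) (nf w) λ
    { _ (here refl) → transport (cong proj₁ p)
    ; _ (there (here refl)) → transport (cong (proj₁ ∘ proj₂) p)
    ; _ (there (there (here refl))) → transport (cong (proj₂ ∘ proj₂) p) }
    where
    transport : ∀ {q} → evPt u q ≡ evPt w q → point (nf u) q ≡ point (nf w) q
    transport {q} e = trans (sym (evPt-nf u q)) (trans e (evPt-nf w q))

  nf-∷ʳ : ∀ w h → nf (w ++ h ∷ []) ≡ nf w ◂ h
  nf-∷ʳ [] r = refl
  nf-∷ʳ [] s = refl
  nf-∷ʳ [] t = refl
  nf-∷ʳ (g ∷ w) h = trans (cong (g ·_) (nf-∷ʳ w h)) (sym (·-◂-assoc g (nf w) h))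

  nf-reverse : ∀ w → nf (reverse w) ≡ inv (nf w)
  nf-reverse [] = refl
  nf-reverse (g ∷ w) = begin
    nf (reverse (g ∷ w))        ≡⟨ cong nf (unfold-reverse g w) ⟩
    nf (reverse w ++ g ∷ [])    ≡⟨ nf-∷ʳ (reverse w) g ⟩
    nf (reverse w) ◂ g          ≡⟨ cong (_◂ g) (nf-reverse w) ⟩
    inv (nf w) ◂ g              ≡⟨ inv-· g (nf w) ⟨
    inv (g · nf w)              ∎
    where open ≡-Reasoning

  len-·-≤ : ∀ g x → len (g · x) ≤ suc (len x)
  len-·-≤ g x with descent g x in eq
  ... | false = ℕ.≤-reflexive (len-up g x eq)
  ... | true = ℕ.m≤n⇒m≤1+n (ℕ.≤-trans (ℕ.n≤1+n _) (ℕ.≤-reflexive (sym (len-down g x eq))))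

  len-nf : ∀ w → len (nf w) ≤ length w
  len-nf [] = z≤n
  len-nf (g ∷ w) = ℕ.≤-trans (len-·-≤ g (nf w)) (s≤s (len-nf w))

  find-descent : ∀ x → x ≡ ε ⊎ ∃ λ g → descent g x ≡ true
  find-descent x with descent r x in er | descent s x in es | descent t x in et
  ... | true | _ | _ = inj₂ (r , er)
  ... | false | true | _ = inj₂ (s , es)
  ... | false | false | true = inj₂ (t , et)
  ... | false | false | false = inj₁ (no-descent x λ { r → er ; s → es ; t → et })

  reduced-word : ∀ n x → len x ≡ n → ∃ λ w → nf w ≡ x × length w ≡ n
  reduced-word n x p with find-descent x
  reduced-word n x p | inj₁ refl = [] , refl , p
  reduced-word zero x p | inj₂ (g , d) with trans (sym p) (len-down g x d)
  ... | ()
  reduced-word (suc n) x p | inj₂ (g , d) with reduced-word n (g · x) (ℕ.suc-injective (trans (sym (len-down g x d)) p))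
  ... | w , q , l = g ∷ w , trans (cong (g ·_) q) (·-involutive g x) , cong suc l

  -- Reversing a reduced word of x spells its inverse; applied twice this gives equality of lengths.
  len-inv-≤ : ∀ x → len (inv x) ≤ len x
  len-inv-≤ x with reduced-word (len x) x refl
  ... | w , p , l = ℕ.≤-trans (ℕ.≤-reflexive (cong len (trans (cong inv (sym p)) (sym (nf-reverse w)))))
    (ℕ.≤-trans (len-nf (reverse w)) (ℕ.≤-reflexive (trans (length-reverse w) l)))

  len-inv : ∀ x → len (inv x) ≡ len x
  len-inv x = ℕ.≤-antisym (len-inv-≤ x) (ℕ.≤-trans (ℕ.≤-reflexive (cong len (sym (inv-involutive x)))) (len-inv-≤ (inv x)))

  ∈-allWords⁺ : ∀ w → w ∈ allWords (length w)
  ∈-allWords⁺ [] = here refl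
  ∈-allWords⁺ (g ∷ w) = ∈-concatMap⁺ (λ v → map (_∷ v) gens) (Any.map (λ { refl → letter g }) (∈-allWords⁺ w))
    where
    letter : ∀ g → g ∷ w ∈ map (_∷ w) gens
    letter r = here refl
    letter s = there (here refl)
    letter t = there (there (here refl))

  ∈-allWords⁻ : ∀ n {w} → w ∈ allWords n → length w ≡ n
  ∈-allWords⁻ zero (here refl) = refl
  ∈-allWords⁻ (suc n) p with find (∈-concatMap⁻ (λ v → map (_∷ v) gens) {xs = allWords n} p)
  ... | v , v∈ , q with ∈-map⁻ (_∷ v) q
  ... | g , _ , refl = cong suc (∈-allWords⁻ n v∈)

  -- The search cannot stop before `len`, since a word of length k only represents elements with
  -- `len` at most k, and it cannot run past it, since a reduced word is a hit.
  lenFrom-len : ∀ k f w → k ≤ len (nf w) → k ℕ.+ f ≡ length w → lenFrom k f w ≡ len (nf w)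
  lenFrom-len k zero w p q = ℕ.≤-antisym p (ℕ.≤-trans (len-nf w) (ℕ.≤-reflexive (trans (sym q) (ℕ.+-identityʳ k))))
  lenFrom-len k (suc f) w p q with any? (λ v → ev v ≟E ev w) (allWords k)
  ... | yes a with find a
  ...   | v , v∈ , e = ℕ.≤-antisym p (ℕ.≤-trans (ℕ.≤-reflexive (cong len (sym (≈⇒nf {v} {w} e))))
                         (ℕ.≤-trans (len-nf v) (ℕ.≤-reflexive (∈-allWords⁻ k v∈))))
  lenFrom-len k (suc f) w p q | no ¬a = lenFrom-len (suc k) f w (ℕ.≤∧≢⇒< p k≢) (trans (sym (ℕ.+-suc k f)) q)
    where
    k≢ : k ≢ len (nf w)
    k≢ refl with reduced-word k (nf w) refl
    ... | v , e , l = ¬a (lose (subst (λ n → v ∈ allWords n) l (∈-allWords⁺ v)) (nf⇒≈ {v} {w} e))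

  ℓ-len : ∀ w → ℓ w ≡ len (nf w)
  ℓ-len w = lenFrom-len 0 (length w) w z≤n refl

  opaque
    -- All elements of length less than n, each once. It is opaque so that the enumeration of words
    -- is never unfolded; only membership and uniqueness are used.
    below : ℕ → List G
    below n = map nf (elemsBelow n)

    below-unique : ∀ n → Unique (below n)
    below-unique n = AllPairs.map⁺ (AllPairs.map (λ {u} {w} ≉ e → ≉ (nf⇒≈ {u} {w} e))
      (DecSetoid.deduplicate-! (On.decSetoid (≡.decSetoid _≟E_) ev) (concat (map allWords (upTo n)))))

    ∈-below⁺ : ∀ {n} x → len x < n → x ∈ below n
    ∈-below⁺ {n} x p with reduced-word (len x) x refl
    ... | w , e , l = Any.map⁺ (Any.map (λ {v} e' → trans (sym e) (sym (≈⇒nf {v} {w} e')))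
      (Any.deduplicate⁺ (λ u v → ev u ≟E ev v) (λ p q → trans p q)
        (Any.map (λ { refl → refl })
          (∈-concat⁺′ (subst (λ m → w ∈ allWords m) l (∈-allWords⁺ w)) (∈-map⁺ allWords (∈-upTo⁺ p))))))

    ∈-below⁻ : ∀ {n x} → x ∈ below n → len x < n
    ∈-below⁻ {n} x∈ with ∈-map⁻ nf x∈
    ... | w , w∈ , refl with ∈-concat⁻′ (map allWords (upTo n)) (∈-deduplicate⁻ (λ u v → ev u ≟E ev v) (concat (map allWords (upTo n))) w∈)
    ... | ws , w∈ws , ws∈ with ∈-map⁻ allWords ws∈
    ... | m , m∈ , refl = ℕ.≤-<-trans (len-nf w) (subst (_< n) (sym (∈-allWords⁻ m w∈ws)) (∈-upTo⁻ m∈))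

open Words

-- The Hecke algebra acting on coefficient functions.

module HeckeModule where
  open import Data.Integer using (_+_; _-_; -_; _*_)
  open import Data.Integer.Tactic.RingSolver using (solve-∀)

  *-zeroˡ : ∀ {a} b → a ≡ 0ℤ → a * b ≡ 0ℤ
  *-zeroˡ b refl = ℤ.*-zeroˡ b

  *-zeroʳ : ∀ a {b} → b ≡ 0ℤ → a * b ≡ 0ℤ
  *-zeroʳ a refl = ℤ.*-zeroʳ a

  interchange : ∀ a b c d → (a + b) + (c + d) ≡ (a + c) + (b + d)
  interchange = solve-∀

  opaque
    ∑ : ∀ {A : Set} → List A → (A → ℤ) → ℤ
    ∑ [] φ = 0ℤ
    ∑ (x ∷ xs) φ = φ x + ∑ xs φ

    ∑-[] : ∀ {A : Set} (φ : A → ℤ) → ∑ [] φ ≡ 0ℤ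
    ∑-[] φ = refl

    ∑-∷ : ∀ {A : Set} x (xs : List A) (φ : A → ℤ) → ∑ (x ∷ xs) φ ≡ φ x + ∑ xs φ
    ∑-∷ x xs φ = refl

    ∑-cong : ∀ {A : Set} (xs : List A) {φ ψ : A → ℤ} → (∀ {x} → x ∈ xs → φ x ≡ ψ x) → ∑ xs φ ≡ ∑ xs ψ
    ∑-cong [] h = refl
    ∑-cong (x ∷ xs) h = cong₂ _+_ (h (here refl)) (∑-cong xs (λ p → h (there p)))

    ∑-zero : ∀ {A : Set} (xs : List A) {φ : A → ℤ} → (∀ {x} → x ∈ xs → φ x ≡ 0ℤ) → ∑ xs φ ≡ 0ℤ
    ∑-zero [] h = refl
    ∑-zero (x ∷ xs) h = cong₂ _+_ (h (here refl)) (∑-zero xs (λ p → h (there p)))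

    ∑-+ : ∀ {A : Set} (xs : List A) (φ ψ : A → ℤ) → ∑ xs (λ x → φ x + ψ x) ≡ ∑ xs φ + ∑ xs ψ
    ∑-+ [] φ ψ = refl
    ∑-+ (x ∷ xs) φ ψ = trans (cong (_+_ (φ x + ψ x)) (∑-+ xs φ ψ)) (interchange (φ x) (ψ x) (∑ xs φ) (∑ xs ψ))

    ∑-* : ∀ {A : Set} (xs : List A) a (φ : A → ℤ) → ∑ xs (λ x → a * φ x) ≡ a * ∑ xs φ
    ∑-* [] a φ = sym (ℤ.*-zeroʳ a)
    ∑-* (x ∷ xs) a φ = trans (cong (_+_ (a * φ x)) (∑-* xs a φ)) (sym (ℤ.*-distribˡ-+ a (φ x) (∑ xs φ)))

    ∑-map : ∀ {A B : Set} (f : A → B) xs (φ : B → ℤ) → ∑ (map f xs) φ ≡ ∑ xs (λ x → φ (f x))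
    ∑-map f [] φ = refl
    ∑-map f (x ∷ xs) φ = cong (_+_ (φ (f x))) (∑-map f xs φ)

    ∑-single : ∀ {A : Set} {xs : List A} {φ : A → ℤ} {x} → Unique xs → x ∈ xs →
      (∀ {y} → y ∈ xs → y ≢ x → φ y ≡ 0ℤ) → ∑ xs φ ≡ φ x
    ∑-single {xs = x ∷ xs} {φ} (x∉ ∷ u) (here refl) h =
      trans (cong (_+_ (φ x)) (∑-zero xs (λ {y} p → h (there p) (λ { refl → All.lookup x∉ p refl })))) (ℤ.+-identityʳ (φ x))
    ∑-single {xs = x ∷ xs} {φ} {y} (x∉ ∷ u) (there p) h =
      trans (cong₂ _+_ (h (here refl) (λ { refl → All.lookup x∉ p refl })) (∑-single u p (λ q → h (there q)))) (ℤ.+-identityˡ (φ y))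

  -- f : Fun stands for the element ∑ₓ,ₖ f x k v⁻ᵏ Tₓ of the Hecke algebra.
  Fun : Set
  Fun = G → ℤ → ℤ

  infix 4 _≐_
  infixl 6 _⊞_
  infixl 7 _⊙_

  _≐_ : Fun → Fun → Set
  f ≐ g = ∀ x k → f x k ≡ g x k

  ≐-sym : ∀ {f g} → f ≐ g → g ≐ f
  ≐-sym p x k = sym (p x k)

  ≐-trans : ∀ {f g h} → f ≐ g → g ≐ h → f ≐ h
  ≐-trans p q x k = trans (p x k) (q x k)

  _⊞_ : Fun → Fun → Fun
  (f ⊞ g) x k = f x k + g x k

  _⊙_ : ℤ → Fun → Fun
  (a ⊙ f) x k = a * f x k

  -- left multiplication by T_g + v⁻¹
  Θ : Gen → Fun → Fun
  Θ g f x k = f (g · x) k + f x (k + sgn g x)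

  -- right multiplication by T_h + v⁻¹
  ρ : Gen → Fun → Fun
  ρ h f x k = f (x ◂ h) k + f x (k + sgn h (inv x))

  -- multiplication by v + v⁻¹
  V : Fun → Fun
  V f x k = f x (k + 1ℤ) + f x (k + -1ℤ)

  shifted : ℤ → Fun → Fun
  shifted d f x k = f x (k + d)

  ⊞-cong : ∀ {f f' g g'} → f ≐ f' → g ≐ g' → f ⊞ g ≐ f' ⊞ g'
  ⊞-cong p q x k = cong₂ _+_ (p x k) (q x k)

  Θ-cong : ∀ g {f f'} → f ≐ f' → Θ g f ≐ Θ g f'
  Θ-cong g p x k = cong₂ _+_ (p (g · x) k) (p x _)

  ρ-cong : ∀ g {f f'} → f ≐ f' → ρ g f ≐ ρ g f'
  ρ-cong g p x k = cong₂ _+_ (p (x ◂ g) k) (p x _)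

  V-cong : ∀ {f f'} → f ≐ f' → V f ≐ V f'
  V-cong p x k = cong₂ _+_ (p x _) (p x _)

  Θ-⊞ : ∀ g f f' → Θ g (f ⊞ f') ≐ Θ g f ⊞ Θ g f'
  Θ-⊞ g f f' x k = interchange (f (g · x) k) (f' (g · x) k) (f x (k + sgn g x)) (f' x (k + sgn g x))

  ρ-⊞ : ∀ g f f' → ρ g (f ⊞ f') ≐ ρ g f ⊞ ρ g f'
  ρ-⊞ g f f' x k = interchange (f (x ◂ g) k) (f' (x ◂ g) k) (f x (k + sgn g (inv x))) (f' x (k + sgn g (inv x)))

  Θ-⊙ : ∀ g a f → Θ g (a ⊙ f) ≐ a ⊙ Θ g f
  Θ-⊙ g a f x k = sym (ℤ.*-distribˡ-+ a (f (g · x) k) (f x (k + sgn g x)))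

  ρ-⊙ : ∀ g a f → ρ g (a ⊙ f) ≐ a ⊙ ρ g f
  ρ-⊙ g a f x k = sym (ℤ.*-distribˡ-+ a (f (x ◂ g) k) (f x (k + sgn g (inv x))))

  ∑-Fun : List G → (G → ℤ) → (G → Fun) → Fun
  ∑-Fun zs c F x k = ∑ zs (λ z → c z * F z x k)

  Θ-∑ : ∀ g zs c F → Θ g (∑-Fun zs c F) ≐ ∑-Fun zs c (λ z → Θ g (F z))
  Θ-∑ g zs c F x k = trans (sym (∑-+ zs _ _)) (∑-cong zs (λ {z} _ → Θ-⊙ g (c z) (F z) x k))

  ρ-∑ : ∀ g zs c F → ρ g (∑-Fun zs c F) ≐ ∑-Fun zs c (λ z → ρ g (F z))
  ρ-∑ g zs c F x k = trans (sym (∑-+ zs _ _)) (∑-cong zs (λ {z} _ → ρ-⊙ g (c z) (F z) x k))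

  V-∑ : ∀ zs c F → V (∑-Fun zs c F) ≐ ∑-Fun zs c (λ z → V (F z))
  V-∑ zs c F x k = trans (sym (∑-+ zs _ _))
    (∑-cong zs (λ {z} _ → sym (ℤ.*-distribˡ-+ (c z) (F z x (k + 1ℤ)) (F z x (k + -1ℤ)))))

  private
    swap-last : ∀ k a b → k + a + b ≡ k + b + a
    swap-last = solve-∀

  Θ-V : ∀ g f → Θ g (V f) ≐ V (Θ g f)
  Θ-V g f x k = trans
    (interchange (f (g · x) (k + 1ℤ)) (f (g · x) (k + -1ℤ)) (f x (k + sgn g x + 1ℤ)) (f x (k + sgn g x + -1ℤ)))
    (cong₂ (λ a b → f (g · x) (k + 1ℤ) + f x a + (f (g · x) (k + -1ℤ) + f x b)) (swap-last k (sgn g x) 1ℤ) (swap-last k (sgn g x) -1ℤ))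

  ρ-V : ∀ g f → ρ g (V f) ≐ V (ρ g f)
  ρ-V g f x k = trans
    (interchange (f (x ◂ g) (k + 1ℤ)) (f (x ◂ g) (k + -1ℤ)) (f x (k + sgn g (inv x) + 1ℤ)) (f x (k + sgn g (inv x) + -1ℤ)))
    (cong₂ (λ a b → f (x ◂ g) (k + 1ℤ) + f x a + (f (x ◂ g) (k + -1ℤ) + f x b)) (swap-last k (sgn g (inv x)) 1ℤ) (swap-last k (sgn g (inv x)) -1ℤ))

  sign-not : ∀ e → sign (not e) ≡ - sign e
  sign-not false = refl
  sign-not true = refl

  sgn-· : ∀ g x → sgn g (g · x) ≡ - sgn g x
  sgn-· g x = cong -_ (trans (cong sign (descent-· g x)) (sign-not (descent g x)))

  -- The quadratic relation T_g² = 1 + (v - v⁻¹)T_g rewritten for T_g + v⁻¹; it rests on `sgn g`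
  -- changing sign between x and gx.
  Θ-Θ : ∀ g f → Θ g (Θ g f) ≐ V (Θ g f)
  Θ-Θ g f x k rewrite ·-involutive g x | sgn-· g x with descent g x
  ... | true = trans (lem (f x k) (f (g · x) (k + -1ℤ)) (f (g · x) (k + 1ℤ)) (f x (k + 1ℤ + 1ℤ))) (cong (λ a → f (g · x) (k + 1ℤ) + f x (k + 1ℤ + 1ℤ) + (f (g · x) (k + -1ℤ) + f x a)) (back k))
    where
    lem : ∀ a b c d → (a + b) + (c + d) ≡ (c + d) + (b + a)
    lem = solve-∀
    back : ∀ k → k ≡ k + -1ℤ + 1ℤ
    back = solve-∀
  ... | false = trans (lem (f x k) (f (g · x) (k + 1ℤ)) (f (g · x) (k + -1ℤ)) (f x (k + -1ℤ + -1ℤ))) (cong (λ a → f (g · x) (k + 1ℤ) + f x a + (f (g · x) (k + -1ℤ) + f x (k + -1ℤ + -1ℤ))) (back k))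
    where
    lem : ∀ a b c d → (a + b) + (c + d) ≡ (b + a) + (c + d)
    lem = solve-∀
    back : ∀ k → k ≡ k + 1ℤ + -1ℤ
    back = solve-∀

  len-◂ : ∀ h x → + len (x ◂ h) ≡ + len x - sgn h (inv x)
  len-◂ h x = begin
    + len (x ◂ h)                       ≡⟨ cong +_ (len-inv (x ◂ h)) ⟨
    + len (inv (x ◂ h))                 ≡⟨ cong (λ y → + len y) (inv-◂ x h) ⟩
    + len (h · inv x)                   ≡⟨ len-· h (inv x) ⟩
    + len (inv x) - sgn h (inv x)       ≡⟨ cong (λ n → + n - sgn h (inv x)) (len-inv x) ⟩
    + len x - sgn h (inv x)             ∎
    where open ≡-Reasoning

  private
    sgn-agree : ∀ g h x → g · x ≡ x ◂ h → sgn g x ≡ sgn h (inv x)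
    sgn-agree g h x p = ℤ.neg-injective (∙-cancelˡ (+ len x) _ _
      (trans (sym (len-· g x)) (trans (cong (λ y → + len y) p) (len-◂ h x))))
      where open import Algebra.Properties.AbelianGroup ℤ.+-0-abelianGroup using (∙-cancelˡ)

  -- If gx = xh, the two multiplications see the same wall and act alike at x. Otherwise, by
  -- `exchange`, neither changes the other's descent, so the same four terms appear in a different
  -- order.
  Θ-ρ : ∀ g h f → Θ g (ρ h f) ≐ ρ h (Θ g f)
  Θ-ρ g h f x k = by-cases (exchange g x h) (exchange h (inv x) g)
    where
    same : g · x ≡ x ◂ h → Θ g (ρ h f) x k ≡ ρ h (Θ g f) x k
    same p rewrite ·-◂-assoc g x h | inv-· g x | sym p | ·-involutive g x | sgn-· g x | sgn-agree g h x p
      | trans (cong (sgn h) (trans (sym (inv-· g x)) (trans (cong inv p) (inv-◂ x h)))) (sgn-· h (inv x)) =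
      refl
    by-cases : _ → _ → _
    by-cases (inj₂ p) _ = same p
    by-cases (inj₁ _) (inj₂ q) = same (sym (begin
      x ◂ h               ≡⟨ inv-involutive (x ◂ h) ⟨
      inv (inv (x ◂ h))   ≡⟨ cong inv (trans (inv-◂ x h) q) ⟩
      inv (inv x ◂ g)     ≡⟨ cong inv (inv-· g x) ⟨
      inv (inv (g · x))   ≡⟨ inv-involutive (g · x) ⟩
      g · x               ∎))
      where open ≡-Reasoning
    by-cases (inj₁ p) (inj₁ q) rewrite ·-◂-assoc g x h | inv-· g x | p | q | swap-last k (sgn g x) (sgn h (inv x)) =
      interchange (f (g · (x ◂ h)) k) (f (g · x) (k + sgn h (inv x))) (f (x ◂ h) (k + sgn g x)) (f x (k + sgn h (inv x) + sgn g x))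

  -- Abstracts left multiplication by a fixed element: it respects powers of v and commutes with
  -- every right multiplication.
  record Natural (A : Fun → Fun) : Set where
    field
      cong-A : ∀ {f f'} → f ≐ f' → A f ≐ A f'
      shift-A : ∀ d f → A (shifted d f) ≐ shifted d (A f)
      ρ-A : ∀ h f → A (ρ h f) ≐ ρ h (A f)
  open Natural

  Θ-natural : ∀ g → Natural (Θ g)
  Θ-natural g .cong-A = Θ-cong g
  Θ-natural g .shift-A d f x k = cong (λ a → f (g · x) (k + d) + f x a) (swap-last k (sgn g x) d)
  Θ-natural g .ρ-A = Θ-ρ g

  ∘-natural : ∀ {A B} → Natural A → Natural B → Natural (λ f → A (B f))
  ∘-natural a b .cong-A p = cong-A a (cong-A b p)
  ∘-natural a b .shift-A d f = ≐-trans (cong-A a (shift-A b d f)) (shift-A a d _)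
  ∘-natural a b .ρ-A h f = ≐-trans (cong-A a (ρ-A b h f)) (ρ-A a h _)

  ⊞-natural : ∀ {A B} → Natural A → Natural B → Natural (λ f → A f ⊞ B f)
  ⊞-natural a b .cong-A p = ⊞-cong (cong-A a p) (cong-A b p)
  ⊞-natural a b .shift-A d f = ⊞-cong (shift-A a d f) (shift-A b d f)
  ⊞-natural {A} {B} a b .ρ-A h f = ≐-trans (⊞-cong (ρ-A a h f) (ρ-A b h f)) (≐-sym (ρ-⊞ h (A f) (B f)))

  -- The value at yg is the value of `ρ g` at y minus a value at y itself. Hence agreement at the
  -- identity in degree 0, for all f, spreads by induction on length. The induction runs on inverses
  -- because descents are left descents.
  natural-ext : ∀ {A B} → Natural A → Natural B → (∀ f → A f ε 0ℤ ≡ B f ε 0ℤ) → ∀ f → A f ≐ B f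
  natural-ext {A} {B} a b h f x k = subst (λ y → A f y k ≡ B f y k) (inv-involutive x)
    (go (len (inv x)) (inv x) refl f k)
    where
    go : ∀ n x → len x ≡ n → ∀ f k → A f (inv x) k ≡ B f (inv x) k
    go n x p f k with find-descent x
    go n x p f k | inj₁ refl = subst (λ j → A f ε j ≡ B f ε j) (ℤ.+-identityˡ k)
      (trans (sym (shift-A a k f ε 0ℤ)) (trans (h (shifted k f)) (shift-A b k f ε 0ℤ)))
    go zero x p f k | inj₂ (g , d) with trans (sym p) (len-down g x d)
    ... | ()
    go (suc n) x p f k | inj₂ (g , d) = subst (λ y → A f y k ≡ B f y k)
        (trans (sym (inv-· g (g · x))) (cong inv (·-involutive g x)))
        (cancel (trans (sym (ρ-A a g f y k)) (trans (ih (ρ g f) k) (ρ-A b g f y k))) (ih f (k + sgn g (inv y))))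
      where
      y = inv (g · x)
      ih : ∀ f k → A f y k ≡ B f y k
      ih = go n (g · x) (ℕ.suc-injective (trans (sym (len-down g x d)) p))
      open import Algebra.Properties.AbelianGroup ℤ.+-0-abelianGroup using (∙-cancelʳ)
      cancel : ∀ {a b c d} → a + c ≡ b + d → c ≡ d → a ≡ b
      cancel {a} {b} {c} p refl = ∙-cancelʳ c a b p

  Θ-commute : ∀ {g h} → Commute g h → ∀ f → Θ g (Θ h f) ≐ Θ h (Θ g f)
  Θ-commute {g} {h} c = natural-ext (∘-natural (Θ-natural g) (Θ-natural h)) (∘-natural (Θ-natural h) (Θ-natural g)) (at-ε c)
    where
    at-ε : ∀ {g h} → Commute g h → ∀ f → Θ g (Θ h f) ε 0ℤ ≡ Θ h (Θ g f) ε 0ℤ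
    swap : ∀ f → Θ r (Θ t f) ε 0ℤ ≡ Θ t (Θ r f) ε 0ℤ
    swap f = interchange (f (r · t · ε) 0ℤ) (f (r · ε) -1ℤ) (f (t · ε) -1ℤ) (f ε (-1ℤ + -1ℤ))
    at-ε rt f = swap f
    at-ε tr f = sym (swap f)

  -- For b_g = T_g + v⁻¹ the relation of order four reads b_g b_h b_g b_h - 2 b_g b_h = b_h b_g b_h
  -- b_g - 2 b_h b_g. The double products are moved across so that no subtraction occurs.
  braid-side : Gen → Gen → Fun → Fun
  braid-side g h f = Θ g (Θ h (Θ g (Θ h f))) ⊞ (Θ h (Θ g f) ⊞ Θ h (Θ g f))

  braid-natural : ∀ g h → Natural (braid-side g h)
  braid-natural g h = ⊞-natural (∘-natural (Θ-natural g) (∘-natural (Θ-natural h) (∘-natural (Θ-natural g) (Θ-natural h))))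
    (⊞-natural hg hg)
    where hg = ∘-natural (Θ-natural h) (Θ-natural g)

  private
    -- At the identity both sides are sums of values of f on the eight elements of the dihedral
    -- subgroup. Thirteen pairs of element and degree occur, in the same pattern for both bonds.
    braid-sum : ∀ x0 x1 x2 x3 x4 x5 x6 x7 x8 x9 x10 x11 x12 →
      ((((x0 + x1) + (x2 + x3)) + ((x4 + x5) + (x3 + x2))) + (((x6 + x7) + (x5 + x4)) + ((x8 + x9) + (x10 + x11)))) + (((x12 + x4) + (x2 + x5)) + ((x12 + x4) + (x2 + x5))) ≡
      ((((x0 + x6) + (x4 + x12)) + ((x2 + x5) + (x12 + x4))) + (((x1 + x8) + (x5 + x2)) + ((x7 + x10) + (x9 + x11)))) + (((x3 + x2) + (x4 + x5)) + ((x3 + x2) + (x4 + x5)))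
    braid-sum = solve-∀

    braid-ε-rs : ∀ f → braid-side r s f ε 0ℤ ≡ braid-side s r f ε 0ℤ
    braid-ε-rs f = braid-sum (f ⟨ false , true , true , 0ℤ , 0ℤ ⟩ 0ℤ) (f ⟨ true , true , true , 0ℤ , 0ℤ ⟩ -[1+ 0 ]) (f ⟨ false , false , true , 0ℤ , 0ℤ ⟩ -[1+ 0 ]) (f ⟨ true , true , false , 0ℤ , 0ℤ ⟩ 0ℤ) (f ⟨ true , false , false , 0ℤ , 0ℤ ⟩ -[1+ 0 ]) (f ⟨ false , false , false , 0ℤ , 0ℤ ⟩ -[1+ 1 ]) (f ⟨ false , true , false , 0ℤ , 0ℤ ⟩ -[1+ 0 ]) (f ⟨ true , false , true , 0ℤ , 0ℤ ⟩ -[1+ 1 ]) (f ⟨ true , true , false , 0ℤ , 0ℤ ⟩ -[1+ 1 ]) (f ⟨ false , false , true , 0ℤ , 0ℤ ⟩ -[1+ 2 ]) (f ⟨ true , false , false , 0ℤ , 0ℤ ⟩ -[1+ 2 ]) (f ⟨ false , false , false , 0ℤ , 0ℤ ⟩ -[1+ 3 ]) (f ⟨ true , false , true , 0ℤ , 0ℤ ⟩ 0ℤ)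

    braid-ε-st : ∀ f → braid-side s t f ε 0ℤ ≡ braid-side t s f ε 0ℤ
    braid-ε-st f = braid-sum (f ⟨ false , true , true , (+ 1) , (+ 1) ⟩ 0ℤ) (f ⟨ false , false , true , 0ℤ , (+ 1) ⟩ -[1+ 0 ]) (f ⟨ true , false , false , 0ℤ , 0ℤ ⟩ -[1+ 0 ]) (f ⟨ true , true , false , (+ 1) , 0ℤ ⟩ 0ℤ) (f ⟨ false , true , false , (+ 1) , 0ℤ ⟩ -[1+ 0 ]) (f ⟨ false , false , false , 0ℤ , 0ℤ ⟩ -[1+ 1 ]) (f ⟨ true , true , true , (+ 1) , (+ 1) ⟩ -[1+ 0 ]) (f ⟨ true , false , true , 0ℤ , (+ 1) ⟩ -[1+ 1 ]) (f ⟨ true , true , false , (+ 1) , 0ℤ ⟩ -[1+ 1 ]) (f ⟨ true , false , false , 0ℤ , 0ℤ ⟩ -[1+ 2 ]) (f ⟨ false , true , false , (+ 1) , 0ℤ ⟩ -[1+ 2 ]) (f ⟨ false , false , false , 0ℤ , 0ℤ ⟩ -[1+ 3 ]) (f ⟨ true , false , true , 0ℤ , (+ 1) ⟩ 0ℤ)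

  Θ-braid : ∀ {g h} → Bond g h → ∀ f → braid-side g h f ≐ braid-side h g f
  Θ-braid {g} {h} b = natural-ext (braid-natural g h) (braid-natural h g) (at-ε b)
    where
    at-ε : ∀ {g h} → Bond g h → ∀ f → braid-side g h f ε 0ℤ ≡ braid-side h g f ε 0ℤ
    at-ε rs f = braid-ε-rs f
    at-ε sr f = sym (braid-ε-rs f)
    at-ε st f = braid-ε-st f
    at-ε ts f = sym (braid-ε-st f)

open HeckeModule

-- The Kazhdan-Lusztig basis and its triangularity.

module CanonicalBasis where
  open import Data.Integer using (_+_; _-_; -_; _*_)
  open import Data.Integer.Tactic.RingSolver using (solve-∀)

  pick : G → Maybe Gen
  pick x = if descent r x then just r else if descent s x then just s else if descent t x then just t else nothing

  pick-just : ∀ x {g} → pick x ≡ just g → descent g x ≡ true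
  pick-just x p with descent r x in er | descent s x in es | descent t x in et
  pick-just x refl | true | _ | _ = er
  pick-just x refl | false | true | _ = es
  pick-just x refl | false | false | true = et

  pick-nothing : ∀ x → pick x ≡ nothing → x ≡ ε
  pick-nothing x p with descent r x in er | descent s x in es | descent t x in et
  pick-nothing x p | false | false | false = no-descent x λ { r → er ; s → es ; t → et }

  unit : ℤ → ℤ
  unit (+ zero) = 1ℤ
  unit (+ suc _) = 0ℤ
  unit -[1+ _ ] = 0ℤ

  δ : G → Fun
  δ w x k with x ≟ w
  ... | yes _ = unit k
  ... | no _ = 0ℤ

  δ-refl : ∀ w k → δ w w k ≡ unit k
  δ-refl w k with w ≟ w
  ... | yes _ = refl
  ... | no w≢w = ⊥-elim (w≢w refl)

  δ-≢ : ∀ {w x} k → x ≢ w → δ w x k ≡ 0ℤ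
  δ-≢ {w} {x} k x≢w with x ≟ w
  ... | yes x≡w = ⊥-elim (x≢w x≡w)
  ... | no _ = refl

  δ-zero : ∀ w x {k} → unit k ≡ 0ℤ → δ w x k ≡ 0ℤ
  δ-zero w x p with x ≟ w
  ... | yes _ = p
  ... | no _ = refl

  descent-after-up : ∀ g x → descent g x ≡ false → descent g (g · x) ≡ true
  descent-after-up g x p = trans (descent-· g x) (cong not p)

  ascent-after-down : ∀ g x → descent g x ≡ true → descent g (g · x) ≡ false
  ascent-after-down g x p = trans (descent-· g x) (cong not p)

  -- In C_v the coefficient of v⁻¹T_z is μ(z,v); only those z with gz < z enter the recursion.
  weight : Gen → Fun → G → ℤ
  weight g f z = if descent g z then f z 1ℤ else 0ℤ

  -- C w is the element ∑ₓ v^(ℓ(x)−ℓ(w)) P_{x,w}(v²) Tₓ of the Kazhdan–Lusztig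
  -- basis; the first argument of Cf is fuel.
  Cf : ℕ → G → Fun
  Cf-step : Maybe Gen → ℕ → G → Fun
  Cf zero w = δ ε
  Cf (suc n) w = Cf-step (pick w) n w
  Cf-step nothing n w = δ ε
  Cf-step (just g) n w = Θ g (Cf n (g · w)) ⊞ (-1ℤ ⊙ ∑-Fun (below (len (g · w))) (weight g (Cf n (g · w))) (Cf n))

  C : G → Fun
  C w = Cf (len w) w

  weight-cong : ∀ g {f f'} z → f ≐ f' → weight g f z ≡ weight g f' z
  weight-cong g z p with descent g z
  ... | true = p z 1ℤ
  ... | false = refl

  Cf-fuel : ∀ n m w → len w ≤ n → len w ≤ m → Cf n w ≐ Cf m w
  Cf-fuel n m w p q with find-descent w
  Cf-fuel zero zero w p q | _ = λ _ _ → refl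
  Cf-fuel zero (suc m) w p q | inj₁ refl = λ _ _ → refl
  Cf-fuel (suc n) zero w p q | inj₁ refl = λ _ _ → refl
  Cf-fuel zero (suc m) w p q | inj₂ (g , d) = ⊥-elim (ℕ.n≮0 (ℕ.≤-trans (ℕ.≤-reflexive (sym (len-down g w d))) p))
  Cf-fuel (suc n) zero w p q | inj₂ (g , d) = ⊥-elim (ℕ.n≮0 (ℕ.≤-trans (ℕ.≤-reflexive (sym (len-down g w d))) q))
  Cf-fuel (suc n) (suc m) w p q | _ with pick w in eq
  ... | nothing = λ _ _ → refl
  ... | just g = ⊞-cong (Θ-cong g ih) λ x k → cong (-1ℤ *_)
        (∑-cong (below (len (g · w))) λ {z} z∈ → cong₂ _*_ (weight-cong g z ih)
          (Cf-fuel n m z (shorter z∈ n≥) (shorter z∈ m≥) x k))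
    where
    lw = len-down g w (pick-just w eq)
    n≥ : len (g · w) ≤ n
    n≥ = ℕ.≤-pred (ℕ.≤-trans (ℕ.≤-reflexive (sym lw)) p)
    m≥ : len (g · w) ≤ m
    m≥ = ℕ.≤-pred (ℕ.≤-trans (ℕ.≤-reflexive (sym lw)) q)
    ih : Cf n (g · w) ≐ Cf m (g · w)
    ih = Cf-fuel n m (g · w) n≥ m≥
    shorter : ∀ {z i} → z ∈ below (len (g · w)) → len (g · w) ≤ i → len z ≤ i
    shorter z∈ = ℕ.≤-trans (ℕ.<⇒≤ (∈-below⁻ z∈))

  correction : Gen → G → Fun
  correction g v = ∑-Fun (below (len v)) (weight g (C v)) C

  recursion : Gen → G → Fun
  recursion g v = Θ g (C v) ⊞ (-1ℤ ⊙ correction g v)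

  C-pick : ∀ w {g} → pick w ≡ just g → C w ≐ recursion g (g · w)
  C-pick w {g} eq rewrite len-down g w (pick-just w eq) | eq =
    λ x k → cong (λ a → Θ g (C (g · w)) x k + -1ℤ * a)
      (∑-cong (below (len (g · w))) λ {z} z∈ → cong (weight g (C (g · w)) z *_)
        (Cf-fuel (len (g · w)) (len z) z (ℕ.<⇒≤ (∈-below⁻ z∈)) ℕ.≤-refl x k))

  -- `small` says that f is T_w plus terms in v⁻¹ℤ[v⁻¹]; `bound` says that degrees at Tₓ do not
  -- exceed ℓ(w) - ℓ(x), with the strict inequality written as an equation with a positive excess to
  -- suit ring reasoning.
  record Triangular (w : G) (f : Fun) : Set where
    field
      small : ∀ x m → f x (- (+ m)) ≡ δ w x (- (+ m))
      bound : ∀ x k m → k + + len x ≡ + len w + + suc m → f x k ≡ 0ℤ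
  open Triangular public

  private
    neg-suc-+1 : ∀ m → - (+ suc m) + 1ℤ ≡ - (+ m)
    neg-suc-+1 zero = refl
    neg-suc-+1 (suc m) = refl

    neg-+-1 : ∀ m → - (+ m) + -1ℤ ≡ - (+ suc m)
    neg-+-1 zero = refl
    neg-+-1 (suc m) = cong -[1+_] (cong suc (ℕ.+-identityʳ m))

  module _ (g : Gen) (v : G) (up : descent g v ≡ false) (tv : Triangular v (C v))
    (tz : ∀ z → len z < len v → Triangular z (C z)) where

    private
      weight-beyond : ∀ x → len v ≤ len x → weight g (C v) x ≡ 0ℤ
      weight-beyond x p with descent g x
      ... | false = refl
      ... | true with ℕ.m≤n⇒∃[o]m+o≡n p
      ...   | m , e = bound tv x 1ℤ m (cong +_ (trans (cong suc (sym e)) (sym (ℕ.+-suc (len v) m))))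

    -- Each C_z has its only degree-zero term at T_z, so degree 0 isolates the summand z = x. If x
    -- is too long to be summed over, the degree bound already makes its weight zero.
    correction-0 : ∀ x → correction g v x 0ℤ ≡ weight g (C v) x
    correction-0 x with len x ℕ.<? len v
    ... | yes p = trans (∑-single (below-unique (len v)) (∈-below⁺ x p)
        (λ {z} z∈ z≢x → *-zeroʳ (weight g (C v) z) (trans (small (tz z (∈-below⁻ z∈)) x 0) (δ-≢ {z} {x} 0ℤ (λ e → z≢x (sym e))))))
        (trans (cong (weight g (C v) x *_) (trans (small (tz x p) x 0) (δ-refl x 0ℤ))) (ℤ.*-identityʳ _))
    ... | no ¬p = trans (∑-zero (below (len v)) λ {z} z∈ →
        *-zeroʳ (weight g (C v) z) (trans (small (tz z (∈-below⁻ z∈)) x 0) (δ-≢ {z} {x} 0ℤ (λ { refl → ¬p (∈-below⁻ z∈) }))))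
        (sym (weight-beyond x (ℕ.≮⇒≥ ¬p)))

    correction-neg : ∀ x m → correction g v x (- (+ suc m)) ≡ 0ℤ
    correction-neg x m = ∑-zero (below (len v)) λ {z} z∈ →
      *-zeroʳ (weight g (C v) z) (trans (small (tz z (∈-below⁻ z∈)) x (suc m)) (δ-zero z x refl))

    private
      δ-· : ∀ x k → δ v (g · x) k ≡ δ (g · v) x k
      δ-· x k with (g · x) ≟ v | x ≟ (g · v)
      ... | yes p | yes q = refl
      ... | no p | no q = refl
      ... | yes p | no q = ⊥-elim (q (trans (sym (·-involutive g x)) (cong (g ·_) p)))
      ... | no p | yes q = ⊥-elim (p (trans (cong (g ·_) q) (·-involutive g v)))

      subtract : ∀ {a b c d e} → a ≡ d → b ≡ e → c ≡ e → (a + b) + -1ℤ * c ≡ d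
      subtract {d = d} {e} refl refl refl = lem d e
        where lem : ∀ d e → (d + e) + -1ℤ * e ≡ d
              lem = solve-∀

      small-R : ∀ x m → recursion g v x (- (+ m)) ≡ δ (g · v) x (- (+ m))
      small-R x m with descent g x in eq
      -- The one place where a correction is needed: multiplication by v lifts the coefficient of
      -- v⁻¹ at Tₓ to degree 0, and `correction-0` removes exactly that.
      small-R x zero | true = subtract (trans (small tv (g · x) 0) (δ-· x 0ℤ)) refl
        (trans (correction-0 x) (cong (λ b → if b then C v x 1ℤ else 0ℤ) eq))
      small-R x (suc m) | true = subtract (trans (small tv (g · x) (suc m)) (δ-· x _))
        (trans (cong (C v x) (neg-suc-+1 m)) (trans (small tv x m) (δ-≢ {v} {x} (- (+ m)) λ { refl → true≢false eq up })))
        (correction-neg x m)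
      small-R x m | false = subtract (trans (small tv (g · x) m) (δ-· x _))
        (trans (cong (C v x) (neg-+-1 m)) (trans (small tv x (suc m)) (δ-zero v x refl)))
        (no-correction m)
        where
        no-correction : ∀ m → correction g v x (- (+ m)) ≡ 0ℤ
        no-correction zero = trans (correction-0 x) (cong (λ b → if b then C v x 1ℤ else 0ℤ) eq)
        no-correction (suc m) = correction-neg x m

      bound-R : ∀ x k m → k + + len x ≡ + len (g · v) + + suc m → recursion g v x k ≡ 0ℤ
      bound-R x k m p rewrite len-up g v up = cong₂ (λ a b → a + -1ℤ * b)
        (Θ-part (descent g x) refl) (∑-zero (below (len v)) λ {z} z∈ → *-zeroʳ (weight g (C v) z) (correction-part z (∈-below⁻ z∈)))
        where
        lv = + len v
        Θ-part : ∀ b → descent g x ≡ b → C v (g · x) k + C v x (k + sgn g x) ≡ 0ℤ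
        Θ-part true eq = cong₂ _+_
          (bound tv (g · x) k m (trans (cong (λ n → k + n) (len-· g x)) (trans (cong (λ b → k + (+ len x - - sign b)) eq)
            (trans (lem k (+ len x)) (trans (cong (_- 1ℤ) p) (lem' lv (+ suc m)))))))
          (bound tv x _ (suc (suc m)) (trans (cong (λ b → k + - sign b + + len x) eq)
            (trans (lem'' k (+ len x)) (trans (cong (_+ 1ℤ) p) (lem''' lv (+ suc m))))))
          where
          lem : ∀ k l → k + (l - 1ℤ) ≡ k + l - 1ℤ
          lem = solve-∀
          lem' : ∀ l m → 1ℤ + l + m - 1ℤ ≡ l + m
          lem' = solve-∀
          lem'' : ∀ k l → k + 1ℤ + l ≡ k + l + 1ℤ
          lem'' = solve-∀
          lem''' : ∀ l m → 1ℤ + l + m + 1ℤ ≡ l + (1ℤ + (1ℤ + m))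
          lem''' = solve-∀
        Θ-part false eq = cong₂ _+_
          (bound tv (g · x) k (suc (suc m)) (trans (cong (λ n → k + n) (len-· g x)) (trans (cong (λ b → k + (+ len x - - sign b)) eq)
            (trans (lem k (+ len x)) (trans (cong (_+ 1ℤ) p) (lem' lv (+ suc m)))))))
          (bound tv x _ m (trans (cong (λ b → k + - sign b + + len x) eq)
            (trans (lem'' k (+ len x)) (trans (cong (_- 1ℤ) p) (lem''' lv (+ suc m))))))
          where
          lem : ∀ k l → k + (l - -1ℤ) ≡ k + l + 1ℤ
          lem = solve-∀
          lem' : ∀ l m → 1ℤ + l + m + 1ℤ ≡ l + (1ℤ + (1ℤ + m))
          lem' = solve-∀
          lem'' : ∀ k l → k + -1ℤ + l ≡ k + l - 1ℤ
          lem'' = solve-∀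
          lem''' : ∀ l m → 1ℤ + l + m - 1ℤ ≡ l + m
          lem''' = solve-∀
        correction-part : ∀ z → len z < len v → C z x k ≡ 0ℤ
        correction-part z q with ℕ.m≤n⇒∃[o]m+o≡n q
        ... | d , e = bound (tz z q) x k _ (trans p (cong +_ (trans (cong (λ n → suc (n ℕ.+ suc m)) (sym e)) (lem (len z) d m))))
          where
          lem : ∀ z d m → suc (suc z ℕ.+ d ℕ.+ suc m) ≡ z ℕ.+ suc (suc d ℕ.+ suc m)
          lem z d m = trans (cong (λ n → suc (suc n)) (ℕ.+-assoc z d (suc m)))
            (trans (cong suc (sym (ℕ.+-suc z (d ℕ.+ suc m)))) (sym (ℕ.+-suc z (suc d ℕ.+ suc m))))

    recursion-triangular : Triangular (g · v) (recursion g v)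
    recursion-triangular .small = small-R
    recursion-triangular .bound = bound-R

  triangular-cong : ∀ {w f f'} → f ≐ f' → Triangular w f' → Triangular w f
  triangular-cong p h .small x m = trans (p x _) (small h x m)
  triangular-cong p h .bound x k m e = trans (p x k) (bound h x k m e)

  δ-triangular : Triangular ε (δ ε)
  δ-triangular .small x m = refl
  δ-triangular .bound x k m e with x ≟ ε
  ... | no _ = refl
  ... | yes refl rewrite ℤ.+-identityʳ k | e = refl

  C-triangular : ∀ w → Triangular w (C w)
  C-triangular w = go (len w) w ℕ.≤-refl
    where
    go : ∀ n w → len w ≤ n → Triangular w (C w)
    go n w p with pick w in eq
    go n w p | nothing with pick-nothing w eq
    ... | refl = δ-triangular
    go zero w p | just g = ⊥-elim (ℕ.n≮0 (ℕ.≤-trans (ℕ.≤-reflexive (sym (len-down g w (pick-just w eq)))) p))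
    go (suc n) w p | just g = triangular-cong (C-pick w eq)
        (subst (λ y → Triangular y (recursion g (g · w))) (·-involutive g w)
          (recursion-triangular g (g · w) (ascent-after-down g w d) (go n (g · w) l)
            (λ z q → go n z (ℕ.≤-trans (ℕ.<⇒≤ q) l))))
      where
      d = pick-just w eq
      l : len (g · w) ≤ n
      l = ℕ.≤-pred (ℕ.≤-trans (ℕ.≤-reflexive (sym (len-down g w d))) p)

open CanonicalBasis

-- Uniqueness of elements with symmetric coefficients.

module Uniqueness where
  open import Data.Integer using (_+_; _-_; -_; _*_)
  open import Data.Integer.Tactic.RingSolver using (solve-∀)

  -- Combinations of the C z with ℓ(z) ≤ m whose coefficients are integer
  -- polynomials in v + v⁻¹; they play the role of the bar-invariant elements.
  data Span (m : ℕ) : Fun → Set where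
    basis  : ∀ z → len z ≤ m → Span m (C z)
    V-span : ∀ {f} → Span m f → Span m (V f)
    ⊞-span : ∀ {f g} → Span m f → Span m g → Span m (f ⊞ g)
    ⊙-span : ∀ a {f} → Span m f → Span m (a ⊙ f)
    ext    : ∀ {f g} → f ≐ g → Span m f → Span m g

  Span-mono : ∀ {m n f} → m ≤ n → Span m f → Span n f
  Span-mono p (basis z q) = basis z (ℕ.≤-trans q p)
  Span-mono p (V-span h) = V-span (Span-mono p h)
  Span-mono p (⊞-span h h') = ⊞-span (Span-mono p h) (Span-mono p h')
  Span-mono p (⊙-span a h) = ⊙-span a (Span-mono p h)
  Span-mono p (ext e h) = ext e (Span-mono p h)

  private
    excess : ∀ {a b} c → a < b → ∃ λ m → b ℕ.+ c ≡ a ℕ.+ suc m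
    excess {a} c p with ℕ.m≤n⇒∃[o]m+o≡n p
    ... | d , refl = d ℕ.+ c , trans (cong suc (ℕ.+-assoc a d c)) (sym (ℕ.+-suc a (d ℕ.+ c)))

  C-pos-zero : ∀ {z x n} → len z < n ℕ.+ len x → C z x (+ n) ≡ 0ℤ
  C-pos-zero {z} {x} {n} p with excess 0 p
  ... | m , e = bound (C-triangular z) x (+ n) m (cong +_ (trans (sym (ℕ.+-identityʳ _)) e))

  C-neg-zero : ∀ z x m → C z x -[1+ m ] ≡ 0ℤ
  C-neg-zero z x m = trans (small (C-triangular z) x (suc m)) (δ-zero z x refl)

  C-diag : ∀ z → C z z 0ℤ ≡ 1ℤ
  C-diag z = trans (small (C-triangular z) z 0) (δ-refl z 0ℤ)

  C-zero : ∀ {z x} → x ≢ z → C z x 0ℤ ≡ 0ℤ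
  C-zero {z} {x} p = trans (small (C-triangular z) x 0) (δ-≢ {z} {x} 0ℤ p)

  C-above : ∀ {z x} n → z ≢ x → len z ≤ len x → C z x (+ n) ≡ 0ℤ
  C-above zero z≢x p = C-zero (λ e → z≢x (sym e))
  C-above {z} {x} (suc n) z≢x p = C-pos-zero {z} {x} {suc n} (s≤s (ℕ.≤-trans p (ℕ.m≤n+m (len x) n)))

  module _ (M : ℕ) where

    private
      zs = below (suc M)
      js = upTo (suc M)

    -- Multiplies out a sum of c_z C_z with Laurent coefficients c_z. The inner sum may stop at M
    -- because C_z has no degree above ℓ(z).
    convolve : (G → ℤ → ℤ) → Fun
    convolve c x k = ∑ zs (λ z → ∑ js (λ j → c z (k - + j) * C z x (+ j)))

    record Expansion (f : Fun) : Set where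
      field
        coef : G → ℤ → ℤ
        symmetric : ∀ z k → coef z (- k) ≡ coef z k
        expand : f ≐ convolve coef
    open Expansion

    private
      unit-minus : ∀ {i j} → i ≢ j → unit (+ i - + j) ≡ 0ℤ
      unit-minus {i} {j} i≢j with + i - + j in eq
      ... | + zero = ⊥-elim (i≢j (ℤ.+-injective (ℤ.i-j≡0⇒i≡j (+ i) (+ j) eq)))
      ... | + suc _ = refl
      ... | -[1+ _ ] = refl

      unit-symmetric : ∀ k → unit (- k) ≡ unit k
      unit-symmetric (+ zero) = refl
      unit-symmetric (+ suc n) = refl
      unit-symmetric -[1+ n ] = refl

      unit-convolve : ∀ z x k → len z ≤ M → ∑ js (λ j → unit (k - + j) * C z x (+ j)) ≡ C z x k
      unit-convolve z x -[1+ m ] p = trans (∑-zero js λ {j} _ → *-zeroˡ (C z x (+ j)) (neg-unit j)) (sym (C-neg-zero z x m))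
        where
        neg-unit : ∀ j → unit (-[1+ m ] - + j) ≡ 0ℤ
        neg-unit zero = refl
        neg-unit (suc j) = refl
      unit-convolve z x (+ n) p with n ℕ.<? suc M
      ... | yes q = trans (∑-single (upTo⁺ (suc M)) (∈-upTo⁺ q) λ {j} _ j≢n → *-zeroˡ (C z x (+ j)) (unit-minus {n} {j} λ e → j≢n (sym e)))
        (trans (cong (λ a → unit a * C z x (+ n)) (ℤ.+-inverseʳ (+ n))) (ℤ.*-identityˡ _))
      ... | no ¬q = trans (∑-zero js λ {j} j∈ → *-zeroˡ (C z x (+ j)) (unit-minus {n} {j} λ { refl → ¬q (∈-upTo⁻ j∈) }))
        (sym (C-pos-zero {z} {x} {n} (ℕ.<-≤-trans (s≤s p) (ℕ.≤-trans (ℕ.≮⇒≥ ¬q) (ℕ.m≤m+n n (len x))))))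

      convolve-⊞ : ∀ c d → convolve (λ z k → c z k + d z k) ≐ convolve c ⊞ convolve d
      convolve-⊞ c d x k = trans (∑-cong zs λ {z} _ → trans
        (∑-cong js λ {j} _ → ℤ.*-distribʳ-+ (C z x (+ j)) (c z (k - + j)) (d z (k - + j)))
        (∑-+ js (λ j → c z (k - + j) * C z x (+ j)) (λ j → d z (k - + j) * C z x (+ j)))) (∑-+ zs _ _)

      convolve-⊙ : ∀ a c → convolve (λ z k → a * c z k) ≐ a ⊙ convolve c
      convolve-⊙ a c x k = trans (∑-cong zs λ {z} _ → trans
        (∑-cong js λ {j} _ → ℤ.*-assoc a (c z (k - + j)) (C z x (+ j)))
        (∑-* js a (λ j → c z (k - + j) * C z x (+ j)))) (∑-* zs a _)

      convolve-shift : ∀ d c x k → convolve (λ z k → c z (k + d)) x k ≡ convolve c x (k + d)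
      convolve-shift d c x k = ∑-cong zs λ {z} _ → ∑-cong js λ {j} _ → cong (λ a → c z a * C z x (+ j)) (lem k (+ j) d)
        where
        lem : ∀ k j d → k - j + d ≡ k + d - j
        lem = solve-∀

      neg-distrib : ∀ k d → - k + d ≡ - (k + - d)
      neg-distrib = solve-∀

    expansion : ∀ {m f} → m ≤ M → Span m f → Expansion f
    expansion p (basis z q) .coef z' = δ z z'
    expansion p (basis z q) .symmetric z' k with z' ≟ z
    ... | yes _ = unit-symmetric k
    ... | no _ = refl
    expansion p (basis z q) .expand x k = sym (trans
      (∑-single (below-unique (suc M)) (∈-below⁺ z (s≤s (ℕ.≤-trans q p)))
        λ {z'} _ z'≢z → ∑-zero js λ {j} _ → *-zeroˡ (C z' x (+ j)) (δ-≢ {z} {z'} (k - + j) z'≢z))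
      (trans (∑-cong js λ {j} _ → cong (_* C z x (+ j)) (δ-refl z (k - + j))) (unit-convolve z x k (ℕ.≤-trans q p))))
    expansion p (V-span h) = record
      { coef = λ z k → c z (k + 1ℤ) + c z (k + -1ℤ)
      ; symmetric = λ z k → trans (cong₂ _+_ (trans (cong (c z) (neg-distrib k 1ℤ)) (symmetric e z (k + -1ℤ)))
                                            (trans (cong (c z) (neg-distrib k -1ℤ)) (symmetric e z (k + 1ℤ))))
                              (ℤ.+-comm (c z (k + -1ℤ)) (c z (k + 1ℤ)))
      ; expand = λ x k → trans (V-cong (expand e) x k) (trans (sym (cong₂ _+_ (convolve-shift 1ℤ c x k) (convolve-shift -1ℤ c x k)))
                           (sym (convolve-⊞ (λ z k → c z (k + 1ℤ)) (λ z k → c z (k + -1ℤ)) x k))) }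
      where
      e = expansion p h
      c = coef e
    expansion p (⊞-span h h') = record
      { coef = λ z k → coef e z k + coef e' z k
      ; symmetric = λ z k → cong₂ _+_ (symmetric e z k) (symmetric e' z k)
      ; expand = ≐-trans (⊞-cong (expand e) (expand e')) (≐-sym (convolve-⊞ (coef e) (coef e'))) }
      where
      e = expansion p h
      e' = expansion p h'
    expansion p (⊙-span a h) = record
      { coef = λ z k → a * coef e z k
      ; symmetric = λ z k → cong (a *_) (symmetric e z k)
      ; expand = ≐-trans (λ x k → cong (a *_) (expand e x k)) (≐-sym (convolve-⊙ a (coef e))) }
      where e = expansion p h
    expansion p (ext q h) = record { coef = coef e ; symmetric = symmetric e ; expand = ≐-trans (≐-sym q) (expand e) }
      where e = expansion p h

    -- Downward induction on ℓ(z), with d bounding M - ℓ(z). Once the coefficients of longer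
    -- elements vanish, only C_z contributes at T_z. The hypothesis kills the half of c_z in degrees
    -- at most 0, and symmetry kills the other half.
    expansion-unique : ∀ {f} → Expansion f → (∀ x m → f x (- (+ m)) ≡ 0ℤ) → ∀ x k → f x k ≡ 0ℤ
    expansion-unique {f} e h x k = trans (expand e x k) (∑-zero zs λ {z} z∈ → ∑-zero js λ {j} _ →
        *-zeroˡ (C z x (+ j)) (all-zero z (ℕ.≤-pred (∈-below⁻ z∈)) (k - + j)))
      where
      c = coef e
      everywhere : ∀ z → (∀ m → c z (- (+ m)) ≡ 0ℤ) → ∀ k → c z k ≡ 0ℤ
      everywhere z q (+ n) = trans (sym (symmetric e z (+ n))) (q n)
      everywhere z q -[1+ n ] = q (suc n)
      go : ∀ d z → M ≤ len z ℕ.+ d → len z ≤ M → ∀ m → c z (- (+ m)) ≡ 0ℤ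
      go d z p q m = trans (sym main-term) (trans (sym (expand e z (- (+ m)))) (h z m))
        where
        diagonal : ∑ js (λ j → c z (- (+ m) - + j) * C z z (+ j)) ≡ c z (- (+ m))
        diagonal = trans (∑-single (upTo⁺ (suc M)) (∈-upTo⁺ (s≤s z≤n)) (λ
            { {zero} _ 0≢0 → ⊥-elim (0≢0 refl)
            ; {suc j} _ _ → *-zeroʳ (c z (- (+ m) - + suc j)) (C-pos-zero {z} {z} {suc j} (s≤s (ℕ.m≤n+m (len z) j))) }))
          (trans (cong₂ _*_ (cong (c z) (ℤ.+-identityʳ (- (+ m)))) (C-diag z)) (ℤ.*-identityʳ _))
        off : ∀ {z'} → z' ∈ zs → z' ≢ z → ∀ j → c z' (- (+ m) - + j) * C z' z (+ j) ≡ 0ℤ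
        off {z'} z'∈ z'≢z j with len z' ℕ.≤? len z
        ... | yes l = *-zeroʳ (c z' (- (+ m) - + j)) (C-above {z'} {z} j z'≢z l)
        ... | no ¬l = *-zeroˡ (C z' z (+ j)) (everywhere z' (higher d p) (- (+ m) - + j))
          where
          higher : ∀ d → M ≤ len z ℕ.+ d → ∀ m → c z' (- (+ m)) ≡ 0ℤ
          higher zero p = ⊥-elim (ℕ.<-irrefl refl (ℕ.<-≤-trans (ℕ.≰⇒> ¬l)
            (ℕ.≤-trans (ℕ.≤-pred (∈-below⁻ z'∈)) (ℕ.≤-trans p (ℕ.≤-reflexive (ℕ.+-identityʳ (len z)))))))
          higher (suc d) p = go d z' (ℕ.≤-trans p (ℕ.≤-trans (ℕ.≤-reflexive (ℕ.+-suc (len z) d)) (ℕ.+-monoˡ-≤ d (ℕ.≰⇒> ¬l))))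
            (ℕ.≤-pred (∈-below⁻ z'∈))
        main-term : convolve c z (- (+ m)) ≡ c z (- (+ m))
        main-term = trans (∑-single (below-unique (suc M)) (∈-below⁺ z (s≤s q)) λ z'∈ z'≢z → ∑-zero js λ {j} _ → off z'∈ z'≢z j) diagonal
      all-zero : ∀ z → len z ≤ M → ∀ k → c z k ≡ 0ℤ
      all-zero z q = everywhere z (go M z (ℕ.m≤n+m M (len z)) q)

  infixl 6 _⊟_
  _⊟_ : Fun → Fun → Fun
  f ⊟ g = f ⊞ (-1ℤ ⊙ g)

  private
    sub-cancel : ∀ a b → a + -1ℤ * b ≡ 0ℤ → a ≡ b
    sub-cancel a b p = trans (lem a b) (trans (cong (_+ b) p) (ℤ.+-identityˡ b))
      where
      lem : ∀ a b → a ≡ a + -1ℤ * b + b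
      lem = solve-∀

    sub-self : ∀ a → a + -1ℤ * a ≡ 0ℤ
    sub-self = solve-∀

  -- The substitute for the fact that a bar-invariant element is determined by its part in
  -- nonnegative powers of v, which are the degrees k ≤ 0.
  span-unique : ∀ {m f g} → Span m (f ⊟ g) → (∀ x j → f x (- (+ j)) ≡ g x (- (+ j))) → f ≐ g
  span-unique {m} {f} {g} p h x k = sub-cancel (f x k) (g x k) (expansion-unique m (expansion m ℕ.≤-refl p)
    (λ x j → trans (cong (_+ -1ℤ * g x (- (+ j))) (h x j)) (sub-self (g x (- (+ j))))) x k)

open Uniqueness

-- The recursion along an arbitrary left descent.

module Recursion where
  open import Data.Integer using (_+_; _-_; -_; _*_)
  open import Data.Integer.Tactic.RingSolver using (solve-∀)

  private
    zero-fun : ∀ {m} → Span m (0ℤ ⊙ C ε)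
    zero-fun = ⊙-span 0ℤ (basis ε z≤n)

  ∑-span : ∀ {m} zs c → (∀ {z} → z ∈ zs → len z ≤ m) → Span m (∑-Fun zs c C)
  ∑-span [] c h = ext (λ x k → trans (ℤ.*-zeroˡ (C ε x k)) (sym (∑-[] _))) zero-fun
  ∑-span (z ∷ zs) c h = ext (λ x k → sym (∑-∷ z zs _))
    (⊞-span (⊙-span (c z) (basis z (h (here refl)))) (∑-span zs c λ p → h (there p)))

  correction-span : ∀ g v → Span (len v) (correction g v)
  correction-span g v = ∑-span (below (len v)) (weight g (C v)) λ p → ℕ.<⇒≤ (∈-below⁻ p)

  ⊟-span : ∀ {m f g} → Span m f → Span m g → Span m (f ⊟ g)
  ⊟-span p q = ⊞-span p (⊙-span -1ℤ q)

  ⊟-sym : ∀ {m} f g → Span m (f ⊟ g) → Span m (g ⊟ f)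
  ⊟-sym f g p = ext (λ x k → lem (f x k) (g x k)) (⊙-span -1ℤ p)
    where
    lem : ∀ a b → -1ℤ * (a + -1ℤ * b) ≡ b + -1ℤ * a
    lem = solve-∀

  ⊟-trans : ∀ {m} f g h → Span m (f ⊟ g) → Span m (g ⊟ h) → Span m (f ⊟ h)
  ⊟-trans f g h p q = ext (λ x k → lem (f x k) (g x k) (h x k)) (⊞-span p q)
    where
    lem : ∀ a b c → (a + -1ℤ * b) + (b + -1ℤ * c) ≡ a + -1ℤ * c
    lem = solve-∀

  Recursive : ℕ → Set
  Recursive n = ∀ w → len w ≤ n → ∀ g → descent g w ≡ true → C w ≐ recursion g (g · w)

  module _ {n} (rec : Recursive n) where

    -- C_w is Θ_g C_{gw} minus multiples of C_z with gz < z. The first is an eigenvector by the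
    -- quadratic relation, the others by induction on length.
    eigen-≤ : ∀ w → len w ≤ n → ∀ g → descent g w ≡ true → Θ g (C w) ≐ V (C w)
    eigen-≤ w p g d = go (len w) w ℕ.≤-refl p d
      where
      go : ∀ m w → len w ≤ m → len w ≤ n → descent g w ≡ true → Θ g (C w) ≐ V (C w)
      go zero w q p d = ⊥-elim (ℕ.n≮0 (ℕ.≤-trans (ℕ.≤-reflexive (sym (len-down g w d))) q))
      go (suc m) w q p d x k = begin
        Θ g (C w) x k
          ≡⟨ Θ-cong g (rec w p g d) x k ⟩
        Θ g (Θ g (C v) ⊞ (-1ℤ ⊙ correction g v)) x k
          ≡⟨ Θ-⊞ g (Θ g (C v)) (-1ℤ ⊙ correction g v) x k ⟩
        Θ g (Θ g (C v)) x k + Θ g (-1ℤ ⊙ correction g v) x k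
          ≡⟨ cong₂ _+_ (Θ-Θ g (C v) x k) (trans (Θ-⊙ g -1ℤ (correction g v) x k) (cong (-1ℤ *_) corr)) ⟩
        V (Θ g (C v)) x k + -1ℤ * V (correction g v) x k
          ≡⟨ lem (Θ g (C v) x (k + 1ℤ)) (Θ g (C v) x (k + -1ℤ)) (correction g v x (k + 1ℤ)) (correction g v x (k + -1ℤ)) ⟩
        V (recursion g v) x k
          ≡⟨ V-cong (rec w p g d) x k ⟨
        V (C w) x k ∎
        where
        open ≡-Reasoning
        v = g · w
        lw = len-down g w d
        v<m : len v ≤ m
        v<m = ℕ.≤-pred (ℕ.≤-trans (ℕ.≤-reflexive (sym lw)) q)
        v<n : len v ≤ n
        v<n = ℕ.≤-trans (ℕ.n≤1+n _) (ℕ.≤-trans (ℕ.≤-reflexive (sym lw)) p)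
        term : ∀ z → len z < len v → weight g (C v) z * Θ g (C z) x k ≡ weight g (C v) z * V (C z) x k
        term z z<v with descent g z in e
        ... | true = cong (C v z 1ℤ *_) (go m z (ℕ.≤-trans (ℕ.<⇒≤ z<v) v<m) (ℕ.≤-trans (ℕ.<⇒≤ z<v) v<n) e x k)
        ... | false = trans (ℤ.*-zeroˡ (Θ g (C z) x k)) (sym (ℤ.*-zeroˡ (V (C z) x k)))
        corr : Θ g (correction g v) x k ≡ V (correction g v) x k
        corr = trans (Θ-∑ g (below (len v)) (weight g (C v)) C x k)
          (trans (∑-cong (below (len v)) λ {z} z∈ → term z (∈-below⁻ z∈))
            (sym (V-∑ (below (len v)) (weight g (C v)) C x k)))
        lem : ∀ a b c d → a + b + -1ℤ * (c + d) ≡ (a + -1ℤ * c) + (b + -1ℤ * d)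
        lem = solve-∀

    up-step : ∀ g z → descent g z ≡ false → suc (len z) ≤ n → Span (len z) (C (g · z) ⊟ Θ g (C z))
    up-step g z up p = ext (λ x k → sym (trans (cong (_+ -1ℤ * Θ g (C z) x k) (eq x k)) (lem (Θ g (C z) x k) (correction g z x k))))
        (⊙-span -1ℤ (correction-span g z))
      where
      eq : C (g · z) ≐ recursion g z
      eq = subst (λ y → C (g · z) ≐ recursion g y) (·-involutive g z)
        (rec (g · z) (ℕ.≤-trans (ℕ.≤-reflexive (len-up g z up)) p) g (descent-after-up g z up))
      lem : ∀ a b → a + -1ℤ * b + -1ℤ * a ≡ -1ℤ * b
      lem = solve-∀

    -- On C_z, Θ_g is multiplication by v + v⁻¹ at a descent; at an ascent it yields C_{gz} plus
    -- shorter terms, one letter longer at most.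
    Θ-span : ∀ g {m f} → suc m ≤ n → Span m f → Span (suc m) (Θ g f)
    Θ-span g p (basis z q) with descent g z in e
    ... | true = ext (≐-sym (eigen-≤ z (ℕ.≤-trans q (ℕ.≤-trans (ℕ.n≤1+n _) p)) g e)) (V-span (basis z (ℕ.m≤n⇒m≤1+n q)))
    ... | false = ext (λ x k → lem (C (g · z) x k) (Θ g (C z) x k))
        (⊟-span (basis (g · z) (ℕ.≤-trans (ℕ.≤-reflexive (len-up g z e)) (s≤s q)))
          (Span-mono (ℕ.m≤n⇒m≤1+n q) (up-step g z e (ℕ.≤-trans (s≤s q) p))))
      where
      lem : ∀ a b → a + -1ℤ * (a + -1ℤ * b) ≡ b
      lem = solve-∀
    Θ-span g p (V-span {f} h) = ext (≐-sym (Θ-V g f)) (V-span (Θ-span g p h))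
    Θ-span g p (⊞-span {f} {f'} h h') = ext (≐-sym (Θ-⊞ g f f')) (⊞-span (Θ-span g p h) (Θ-span g p h'))
    Θ-span g p (⊙-span a {f} h) = ext (≐-sym (Θ-⊙ g a f)) (⊙-span a (Θ-span g p h))
    Θ-span g p (ext e h) = ext (Θ-cong g e) (Θ-span g p h)

    Θ-⊟-span : ∀ g {m} f f' → suc m ≤ n → Span m (f ⊟ f') → Span (suc m) (Θ g f ⊟ Θ g f')
    Θ-⊟-span g f f' p h = ext (λ x k → trans (Θ-⊞ g f (-1ℤ ⊙ f') x k) (cong (λ z → Θ g f x k + z) (Θ-⊙ g -1ℤ f' x k))) (Θ-span g p h)

    -- The error stays strictly shorter than the leading element, so products of several Θ can be
    -- built up letter by letter.
    prepend : ∀ g z {m f} → descent g z ≡ false → len z ≡ suc m → suc (suc m) ≤ n →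
      Span m (C z ⊟ f) → Span (suc m) (C (g · z) ⊟ Θ g f)
    prepend g z {m} {f} up q p h = ⊟-trans (C (g · z)) (Θ g (C z)) (Θ g f)
      (Span-mono (ℕ.≤-reflexive q) (up-step g z up (ℕ.≤-trans (ℕ.≤-reflexive (cong suc q)) p)))
      (Θ-⊟-span g (C z) f (ℕ.≤-trans (ℕ.n≤1+n _) p) h)

    bond-chain : ∀ g h y → descent h y ≡ false → descent g (h · y) ≡ false → descent h (g · h · y) ≡ false →
      3 ℕ.+ len y ≤ n → Span (3 ℕ.+ len y) (Θ g (C (h · g · h · y)) ⊟ Θ g (Θ h (Θ g (Θ h (C y)))))
    bond-chain g h y u₁ u₂ u₃ p = Θ-⊟-span g (C (h · g · h · y)) (Θ h (Θ g (Θ h (C y)))) p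
      (prepend h (g · h · y) u₃ l₂ p
        (prepend g (h · y) u₂ l₁ (ℕ.≤-trans (ℕ.n≤1+n _) p)
          (up-step h y u₁ (ℕ.≤-trans (ℕ.m≤n+m _ 2) p))))
      where
      l₁ = len-up h y u₁
      l₂ = trans (len-up g (h · y) u₂) (cong suc l₁)

    -- Both descents give w = ghghy = hghgy with lengths adding. Modulo shorter elements C_{gw} is
    -- Θ_hΘ_gΘ_h C_y, and likewise with g and h exchanged; so the two candidates for C_w reduce to
    -- the two alternating fourfold products of C_y.
    bond-agree : ∀ {g h} → Bond g h → ∀ w → len w ≤ suc n → descent g w ≡ true → descent h w ≡ true →
      Span n (Θ g (C (g · w)) ⊟ Θ h (C (h · w)))
    bond-agree {g} {h} b w p dg dh with bond-descents b w dg dh | bond-descents (bond-sym b) w dh dg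
    ... | d₁ , d₂ , d₃ | e₁ , e₂ , e₃ = Span-mono y≤ (⊟-trans (Θ g (C (g · w))) (Θ⁴ g h) (Θ h (C (h · w)))
        (subst (λ z → Span (3 ℕ.+ len y) (Θ g (C z) ⊟ Θ⁴ g h)) (restore (g · w)) (bond-chain g h y u₁ u₂ u₃ y≤))
        (⊟-trans (Θ⁴ g h) (Θ⁴ h g) (Θ h (C (h · w))) middle
          (⊟-sym (Θ h (C (h · w))) (Θ⁴ h g)
            (subst (λ z → Span (3 ℕ.+ len y) (Θ h (C z) ⊟ Θ⁴ h g)) h-side (bond-chain h g y v₁ v₂ v₃ y≤)))))
      where
      y = h · g · h · g · w
      Θ⁴ : Gen → Gen → Fun
      Θ⁴ a b = Θ a (Θ b (Θ a (Θ b (C y))))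
      restore : ∀ x → h · g · h · h · g · h · x ≡ x
      restore x = trans (cong (λ z → h · g · z) (·-involutive h (g · h · x)))
        (trans (cong (h ·_) (·-involutive g (h · x))) (·-involutive h x))
      y-eq : y ≡ g · h · g · h · w
      y-eq = sym (braid-· b w)
      u₁ : descent h y ≡ false
      u₁ = ascent-after-down h _ d₃
      u₂ : descent g (h · y) ≡ false
      u₂ = trans (cong (descent g) (·-involutive h (g · h · g · w))) (ascent-after-down g _ d₂)
      u₃ : descent h (g · h · y) ≡ false
      u₃ = trans (cong (λ z → descent h (g · z)) (·-involutive h (g · h · g · w)))
        (trans (cong (descent h) (·-involutive g (h · g · w))) (ascent-after-down h _ d₁))
      v₁ : descent g y ≡ false
      v₁ = trans (cong (descent g) y-eq) (ascent-after-down g _ e₃)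
      v₂ : descent h (g · y) ≡ false
      v₂ = trans (cong (λ z → descent h (g · z)) y-eq)
        (trans (cong (descent h) (·-involutive g (h · g · h · w))) (ascent-after-down h _ e₂))
      v₃ : descent g (h · g · y) ≡ false
      v₃ = trans (cong (λ z → descent g (h · g · z)) y-eq)
        (trans (cong (λ z → descent g (h · z)) (·-involutive g (h · g · h · w)))
          (trans (cong (descent g) (·-involutive h (g · h · w))) (ascent-after-down g _ e₁)))
      h-side : g · h · g · y ≡ h · w
      h-side = trans (cong (λ z → g · h · g · z) y-eq)
        (trans (cong (λ z → g · h · z) (·-involutive g (h · g · h · w)))
          (trans (cong (g ·_) (·-involutive h (g · h · w))) (·-involutive g (h · w))))
      lw : len w ≡ 4 ℕ.+ len y
      lw = trans (len-down g w dg) (cong suc (trans (len-down h (g · w) d₁) (cong suc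
        (trans (len-down g (h · g · w) d₂) (cong suc (len-down h (g · h · g · w) d₃))))))
      y≤ : 3 ℕ.+ len y ≤ n
      y≤ = ℕ.≤-pred (ℕ.≤-trans (ℕ.≤-reflexive (sym lw)) p)
      Cy : Span (len y) (C y)
      Cy = basis y ℕ.≤-refl
      two-letters : ∀ a b → Span (2 ℕ.+ len y) (Θ a (Θ b (C y)))
      two-letters a b = Θ-span a (ℕ.≤-trans (ℕ.n≤1+n _) y≤) (Θ-span b (ℕ.≤-trans (ℕ.m≤n+m _ 2) y≤) Cy)
      -- Each fourfold product alone would reach length 4 + ℓ(y); by the braid relation their
      -- difference is a combination of twofold products.
      middle : Span (3 ℕ.+ len y) (Θ⁴ g h ⊟ Θ⁴ h g)
      middle = Span-mono (ℕ.n≤1+n _) (ext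
        (λ x k → sym (lem (Θ⁴ g h x k) (Θ⁴ h g x k) (Θ h (Θ g (C y)) x k) (Θ g (Θ h (C y)) x k) (Θ-braid b (C y) x k)))
        (⊟-span (⊞-span (two-letters g h) (two-letters g h)) (⊞-span (two-letters h g) (two-letters h g))))
        where
        lem : ∀ a a' b b' → a + (b + b) ≡ a' + (b' + b') → a + -1ℤ * a' ≡ b' + b' + -1ℤ * (b + b)
        lem a a' b b' e = trans (lem₁ a a' b) (trans (cong (λ z → z + -1ℤ * a' + -1ℤ * (b + b)) e) (lem₂ a' b' b))
          where
          lem₁ : ∀ a a' b → a + -1ℤ * a' ≡ a + (b + b) + -1ℤ * a' + -1ℤ * (b + b)
          lem₁ = solve-∀
          lem₂ : ∀ a' b' b → a' + (b' + b') + -1ℤ * a' + -1ℤ * (b + b) ≡ b' + b' + -1ℤ * (b + b)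
          lem₂ = solve-∀

    commute-agree : ∀ {g h} → Commute g h → ∀ w → len w ≤ suc n → descent g w ≡ true → descent h w ≡ true →
      Span n (Θ g (C (g · w)) ⊟ Θ h (C (h · w)))
    commute-agree {g} {h} c w p dg dh = Span-mono y≤ (⊟-trans (Θ g (C (g · w))) (Θ g (Θ h (C y))) (Θ h (C (h · w)))
        (Θ-⊟-span g (C (g · w)) (Θ h (C y)) y≤ (subst (λ z → Span (len y) (C z ⊟ Θ h (C y))) (·-involutive h (g · w)) (up-step h y uh y≤)))
        (ext (λ x k → cong (_+ -1ℤ * Θ h (C (h · w)) x k) (sym (Θ-commute c (C y) x k)))
          (⊟-sym (Θ h (C (h · w))) (Θ h (Θ g (C y)))
            (Θ-⊟-span h (C (h · w)) (Θ g (C y)) y≤ (subst (λ z → Span (len y) (C z ⊟ Θ g (C y))) g-side (up-step g y ug y≤))))))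
      where
      y = h · g · w
      dh' : descent h (g · w) ≡ true
      dh' = trans (commute-descent (commute-sym c) w) dh
      uh : descent h y ≡ false
      uh = ascent-after-down h _ dh'
      ug : descent g y ≡ false
      ug = trans (commute-descent c (g · w)) (ascent-after-down g _ dg)
      g-side : g · y ≡ h · w
      g-side = trans (cong (g ·_) (sym (commute-· c w))) (·-involutive g (h · w))
      y≤ : suc (len y) ≤ n
      y≤ = ℕ.≤-pred (ℕ.≤-trans (ℕ.≤-reflexive (sym (trans (len-down g w dg) (cong suc (len-down h (g · w) dh'))))) p)

    agree : ∀ g h w → len w ≤ suc n → descent g w ≡ true → descent h w ≡ true →
      Span n (Θ g (C (g · w)) ⊟ Θ h (C (h · w)))
    agree g h w p dg dh with trichotomy g h
    ... | inj₁ refl = ext (λ x k → lem (C ε x k) (Θ g (C (g · w)) x k)) zero-fun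
      where
      lem : ∀ a b → 0ℤ * a ≡ b + -1ℤ * b
      lem = solve-∀
    ... | inj₂ (inj₁ b) = bond-agree b w p dg dh
    ... | inj₂ (inj₂ c) = commute-agree c w p dg dh

    -- Both candidates equal T_w in degrees at most 0, and their difference lies in the span of
    -- elements of length at most n, so `span-unique` forces them to coincide.
    recursion-agree : ∀ g h w → len w ≤ suc n → descent g w ≡ true → descent h w ≡ true →
      recursion g (g · w) ≐ recursion h (h · w)
    recursion-agree g h w p dg dh = span-unique {n}
        (ext (λ x k → lem (Θ g (C (g · w)) x k) (Θ h (C (h · w)) x k) (correction g (g · w) x k) (correction h (h · w) x k))
          (⊟-span (agree g h w p dg dh)
            (⊟-span (Span-mono (shorter g dg) (correction-span g (g · w))) (Span-mono (shorter h dh) (correction-span h (h · w))))))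
        λ x j → trans (small-at g dg x j) (sym (small-at h dh x j))
      where
      lem : ∀ a b c d → a + -1ℤ * b + -1ℤ * (c + -1ℤ * d) ≡ (a + -1ℤ * c) + -1ℤ * (b + -1ℤ * d)
      lem = solve-∀
      shorter : ∀ a → descent a w ≡ true → len (a · w) ≤ n
      shorter a d = ℕ.≤-pred (ℕ.≤-trans (ℕ.≤-reflexive (sym (len-down a w d))) p)
      small-at : ∀ a → descent a w ≡ true → ∀ x j → recursion a (a · w) x (- (+ j)) ≡ δ w x (- (+ j))
      small-at a d x j = trans
        (small (recursion-triangular a (a · w) (ascent-after-down a _ d) (C-triangular (a · w)) (λ z _ → C-triangular z)) x j)
        (cong (λ y → δ y x (- (+ j))) (·-involutive a w))

  recursive : ∀ n → Recursive n
  recursive zero w p g d = ⊥-elim (ℕ.n≮0 (ℕ.≤-trans (ℕ.≤-reflexive (sym (len-down g w d))) p))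
  recursive (suc n) w p g d with pick w in eq
  ... | nothing with pick-nothing w eq
  ...   | refl with trans (sym d) (descent-ε g)
  ...     | ()
  recursive (suc n) w p g d | just h = ≐-trans (C-pick w eq) (recursion-agree (recursive n) h g w p (pick-just w eq) d)

  C-recursion : ∀ g w → descent g w ≡ true → C w ≐ recursion g (g · w)
  C-recursion g w d = recursive (len w) w ℕ.≤-refl g d

  C-eigen : ∀ g w → descent g w ≡ true → Θ g (C w) ≐ V (C w)
  C-eigen g w d = eigen-≤ (recursive (len w)) w ℕ.≤-refl g d

open Recursion

-- Vanishing of μ, inversion and strings.

module Symmetries where
  open import Data.Integer using (_+_; _-_; -_; _*_)
  open import Data.Integer.Tactic.RingSolver using (solve-∀)

  private
    +-cancelʳ : ∀ {a b} c → a + c ≡ b + c → a ≡ b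
    +-cancelʳ {a} {b} c p = ∙-cancelʳ c a b p
      where open import Algebra.Properties.AbelianGroup ℤ.+-0-abelianGroup using (∙-cancelʳ)

  -- Compare coefficients at Tₓ in Θ_g C_w = (v + v⁻¹)C_w: the terms of degree k - 1 cancel. For
  -- polynomials this is P_{x,w} = P_{gx,w}.
  C-lift : ∀ g w x k → descent g w ≡ true → descent g x ≡ false → C w x (k + 1ℤ) ≡ C w (g · x) k
  C-lift g w x k dw dx = sym (+-cancelʳ (C w x (k + -1ℤ))
    (trans (cong (λ b → C w (g · x) k + C w x (k + - sign b)) (sym dx)) (C-eigen g w dw x k)))

  C-step : ∀ g x → descent g x ≡ false → C (g · x) x 1ℤ ≡ 1ℤ
  C-step g x up = trans (C-lift g (g · x) x 0ℤ (descent-after-up g x up) up) (C-diag (g · x))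

  -- By `C-lift` the coefficient of v⁻¹ at Tₓ is the constant coefficient at T_{gx}, which is
  -- nonzero only for gx = w.
  C-skip : ∀ g w x → descent g w ≡ true → descent g x ≡ false → g · x ≢ w → C w x 1ℤ ≡ 0ℤ
  C-skip g w x dw dx ne = trans (C-lift g w x 0ℤ dw dx) (C-zero ne)

  Θ-span′ : ∀ g {m f} → Span m f → Span (suc m) (Θ g f)
  Θ-span′ g {m} = Θ-span (recursive (suc m)) g ℕ.≤-refl

  private
    transpose-· : ∀ g {x y} → g · x ≡ y → x ≡ g · y
    transpose-· g {x} p = trans (sym (·-involutive g x)) (cong (g ·_) p)

    ε◂ : ∀ g → ε ◂ g ≡ g · ε
    ε◂ r = refl
    ε◂ s = refl
    ε◂ t = refl

    transpose-◂ : ∀ g {x y} → x ◂ g ≡ y → x ≡ y ◂ g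
    transpose-◂ g {x} {y} p = begin
      x                       ≡⟨ inv-involutive x ⟨
      inv (inv x)             ≡⟨ cong inv (transpose-· g (trans (sym (inv-◂ x g)) (cong inv p))) ⟩
      inv (g · inv y)         ≡⟨ inv-· g (inv y) ⟩
      inv (inv y) ◂ g         ≡⟨ cong (_◂ g) (inv-involutive y) ⟩
      y ◂ g                   ∎
      where open ≡-Reasoning

    ρ-δ : ∀ g → ρ g (δ ε) ≐ Θ g (δ ε)
    ρ-δ g x k = cong₂ _+_ moved stayed
      where
      moved : δ ε (x ◂ g) k ≡ δ ε (g · x) k
      moved with (x ◂ g) ≟ ε | (g · x) ≟ ε
      ... | yes _ | yes _ = refl
      ... | no _ | no _ = refl
      ... | yes p | no q = ⊥-elim (q (trans (cong (g ·_) (trans (transpose-◂ g p) (ε◂ g))) (·-involutive g ε)))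
      ... | no p | yes q = ⊥-elim (p (trans (cong (_◂ g) (trans (transpose-· g q) (sym (ε◂ g)))) (sym (transpose-◂ g refl))))
      stayed : δ ε x (k + sgn g (inv x)) ≡ δ ε x (k + sgn g x)
      stayed with x ≟ ε
      ... | yes refl = refl
      ... | no _ = refl

  -- Since ρ commutes with Θ, it can be pushed through the recursion for C_z down to the identity,
  -- where left and right multiplication by g agree.
  ρ-basis : ∀ g m z → len z ≤ m → Span (suc m) (ρ g (C z))
  ρ-basis g m z p with find-descent z
  ρ-basis g m z p | inj₁ refl = ext (≐-sym (ρ-δ g)) (Θ-span′ g (basis ε z≤n))
  ρ-basis g zero z p | inj₂ (h , d) = ⊥-elim (ℕ.n≮0 (ℕ.≤-trans (ℕ.≤-reflexive (sym (len-down h z d))) p))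
  ρ-basis g (suc m) z p | inj₂ (h , d) = ext (λ x k → sym (eq x k))
      (⊟-span (Θ-span′ h (ρ-basis g m v v≤)) (∑-ρ (below (len v)) (λ q → ℕ.≤-trans (ℕ.<⇒≤ (∈-below⁻ q)) v≤)))
    where
    v = h · z
    v≤ : len v ≤ m
    v≤ = ℕ.≤-pred (ℕ.≤-trans (ℕ.≤-reflexive (sym (len-down h z d))) p)
    c = weight h (C v)
    ∑-ρ : ∀ zs → (∀ {y} → y ∈ zs → len y ≤ m) → Span (2 ℕ.+ m) (∑-Fun zs c (λ y → ρ g (C y)))
    ∑-ρ [] _ = ext (λ x k → trans (ℤ.*-zeroˡ (C ε x k)) (sym (∑-[] _))) (⊙-span 0ℤ (basis ε z≤n))
    ∑-ρ (y ∷ zs) q = ext (λ x k → sym (∑-∷ y zs _))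
      (⊞-span (⊙-span (c y) (Span-mono (ℕ.n≤1+n _) (ρ-basis g m y (q (here refl))))) (∑-ρ zs λ q' → q (there q')))
    eq : ρ g (C z) ≐ Θ h (ρ g (C v)) ⊟ ∑-Fun (below (len v)) c (λ y → ρ g (C y))
    eq x k = trans (ρ-cong g (C-recursion h z d) x k) (trans (ρ-⊞ g (Θ h (C v)) (-1ℤ ⊙ correction h v) x k)
      (cong₂ _+_ (sym (Θ-ρ h g (C v) x k))
        (trans (ρ-⊙ g -1ℤ (correction h v) x k) (cong (-1ℤ *_) (ρ-∑ g (below (len v)) c C x k)))))

  ρ-span : ∀ g {m f} → Span m f → Span (suc m) (ρ g f)
  ρ-span g (basis z q) = ρ-basis g _ z q
  ρ-span g (V-span {f} h) = ext (≐-sym (ρ-V g f)) (V-span (ρ-span g h))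
  ρ-span g (⊞-span {f} {f'} h h') = ext (≐-sym (ρ-⊞ g f f')) (⊞-span (ρ-span g h) (ρ-span g h'))
  ρ-span g (⊙-span a {f} h) = ext (≐-sym (ρ-⊙ g a f)) (⊙-span a (ρ-span g h))
  ρ-span g (ext e h) = ext (ρ-cong g e) (ρ-span g h)

  -- the anti-automorphism Tₓ ↦ T_{x⁻¹}
  flip : Fun → Fun
  flip f x k = f (inv x) k

  -- Inversion turns the left multiplication in the recursion into a right one, under which spans
  -- are stable by `ρ-span`.
  flip-basis : ∀ m w → len w ≤ m → Span m (flip (C w))
  flip-basis m w p with find-descent w
  flip-basis m w p | inj₁ refl = ext δ-flip (basis ε z≤n)
    where
    δ-flip : δ ε ≐ flip (δ ε)
    δ-flip x k with x ≟ ε | inv x ≟ ε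
    ... | yes _ | yes _ = refl
    ... | no _ | no _ = refl
    ... | yes refl | no q = ⊥-elim (q refl)
    ... | no p | yes q = ⊥-elim (p (trans (sym (inv-involutive x)) (cong inv q)))
  flip-basis zero w p | inj₂ (g , d) = ⊥-elim (ℕ.n≮0 (ℕ.≤-trans (ℕ.≤-reflexive (sym (len-down g w d))) p))
  flip-basis (suc m) w p | inj₂ (g , d) = ext (λ x k → sym (eq x k))
      (⊟-span (ρ-span g (flip-basis m v v≤)) (∑-flip (below (len v)) (λ q → ℕ.≤-trans (ℕ.<⇒≤ (∈-below⁻ q)) v≤)))
    where
    v = g · w
    v≤ : len v ≤ m
    v≤ = ℕ.≤-pred (ℕ.≤-trans (ℕ.≤-reflexive (sym (len-down g w d))) p)
    c = weight g (C v)
    ∑-flip : ∀ zs → (∀ {y} → y ∈ zs → len y ≤ m) → Span (suc m) (∑-Fun zs c (λ y → flip (C y)))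
    ∑-flip [] _ = ext (λ x k → trans (ℤ.*-zeroˡ (C ε x k)) (sym (∑-[] _))) (⊙-span 0ℤ (basis ε z≤n))
    ∑-flip (y ∷ zs) q = ext (λ x k → sym (∑-∷ y zs _))
      (⊞-span (⊙-span (c y) (Span-mono (ℕ.n≤1+n _) (flip-basis m y (q (here refl))))) (∑-flip zs λ q' → q (there q')))
    eq : flip (C w) ≐ ρ g (flip (C v)) ⊟ ∑-Fun (below (len v)) c (λ y → flip (C y))
    eq x k = trans (C-recursion g w d (inv x) k)
      (cong (λ y → C v y k + C v (inv x) (k + sgn g (inv x)) + -1ℤ * correction g v (inv x) k) (sym (inv-◂ x g)))

  C-inv : ∀ w x k → C (inv w) x k ≡ C w (inv x) k
  C-inv w = span-unique {len w} (⊟-span (basis (inv w) (ℕ.≤-reflexive (len-inv w))) (flip-basis (len w) w ℕ.≤-refl))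
    λ x j → trans (small (C-triangular (inv w)) x j) (trans (δ-inv x _) (sym (small (C-triangular w) (inv x) j)))
    where
    δ-inv : ∀ x k → δ (inv w) x k ≡ δ w (inv x) k
    δ-inv x k with x ≟ inv w | inv x ≟ w
    ... | yes _ | yes _ = refl
    ... | no _ | no _ = refl
    ... | yes p | no q = ⊥-elim (q (trans (cong inv p) (inv-involutive w)))
    ... | no p | yes q = ⊥-elim (p (trans (sym (inv-involutive x)) (cong inv q)))

  C-inv-inv : ∀ w x k → C (inv w) (inv x) k ≡ C w x k
  C-inv-inv w x k = trans (C-inv w (inv x) k) (cong (λ y → C w y k) (inv-involutive x))

  -- The element gx is minimal in its coset under the group generated by g and s, and each of x, sx,
  -- gsx has exactly one of g, s as left descent.
  record StringStart (g : Gen) (x : G) : Set where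
    field
      has-g : descent g x ≡ true
      no-s : descent s x ≡ false
      g-no-s : descent s (g · x) ≡ false
      s-no-g : descent g (s · x) ≡ false
      gs-no-s : descent s (g · s · x) ≡ false
  open StringStart

  private
    weight-true : ∀ g f z → descent g z ≡ true → weight g f z ≡ f z 1ℤ
    weight-true g f z p rewrite p = refl

    C-recursion-up : ∀ g v → descent g v ≡ false → C (g · v) ≐ recursion g v
    C-recursion-up g v up = subst (λ y → C (g · v) ≐ recursion g y) (·-involutive g v)
      (C-recursion g (g · v) (descent-after-up g v up))

  -- Lusztig's symmetry for ⟨g, s⟩-strings x, sx, gsx and y, sy, gsy, obtained by
  -- applying the recursion twice; almost all correction terms vanish because an
  -- edge z — y with L(y) ⊄ L(z) has to be y = hz for a generator h.
  string-symmetry : ∀ {g x y} → StringStart g x → StringStart g y →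
    C (g · s · y) x 1ℤ ≡ C y (g · s · x) 1ℤ
  string-symmetry {g} {x} {y} X Y = begin
    C y₃ x 1ℤ
      ≡⟨ C-recursion-up g y₂ (s-no-g Y) x 1ℤ ⟩
    C y₂ (g · x) 1ℤ + C y₂ x (1ℤ + sgn g x) + -1ℤ * correction g y₂ x 1ℤ
      ≡⟨ cong₂ (λ a b → a + -1ℤ * b) (cong₂ _+_ first second) corr₂ ⟩
    0ℤ + C y₂ x₂ 1ℤ + -1ℤ * C y x 1ℤ
      ≡⟨ cong (λ a → 0ℤ + a + -1ℤ * C y x 1ℤ) inner ⟩
    0ℤ + (C y x 1ℤ + C y x₃ 1ℤ + -1ℤ * 0ℤ) + -1ℤ * C y x 1ℤ
      ≡⟨ lem (C y x 1ℤ) (C y x₃ 1ℤ) ⟩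
    C y x₃ 1ℤ ∎
    where
    open ≡-Reasoning
    x₂ = s · x
    x₃ = g · x₂
    y₂ = s · y
    y₃ = g · y₂
    lem : ∀ a b → 0ℤ + (a + b + -1ℤ * 0ℤ) + -1ℤ * a ≡ b
    lem = solve-∀
    s-y₂ : descent s y₂ ≡ true
    s-y₂ = descent-after-up s y (no-s Y)
    s-x₂ : descent s x₂ ≡ true
    s-x₂ = descent-after-up s x (no-s X)
    first : C y₂ (g · x) 1ℤ ≡ 0ℤ
    first = C-skip s y₂ (g · x) s-y₂ (g-no-s X) λ e →
      true≢false (has-g Y) (trans (cong (descent g) (trans (sym (·-involutive s y)) (sym (transpose-· s e))))
        (ascent-after-down g x (has-g X)))
    second : C y₂ x (1ℤ + sgn g x) ≡ C y₂ x₂ 1ℤ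
    second = trans (cong (λ b → C y₂ x (1ℤ + - sign b)) (has-g X)) (C-lift s y₂ x 1ℤ s-y₂ (no-s X))
    -- Only z = y survives, with weight μ(y,sy) = 1. Its contribution μ(x,y) cancels the same term
    -- produced by `inner`, leaving μ(gsx,y).
    corr₂ : correction g y₂ x 1ℤ ≡ C y x 1ℤ
    corr₂ = trans (∑-single (below-unique (len y₂)) (∈-below⁺ y (ℕ.≤-reflexive (sym (len-up s y (no-s Y))))) λ {z} _ z≢y → other z z≢y)
        (trans (cong (_* C y x 1ℤ) (trans (weight-true g (C y₂) y (has-g Y)) (C-step s y (no-s Y)))) (ℤ.*-identityˡ _))
      where
      other : ∀ z → z ≢ y → weight g (C y₂) z * C z x 1ℤ ≡ 0ℤ
      other z z≢y with descent g z in gz | descent s z in sz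
      ... | false | _ = ℤ.*-zeroˡ (C z x 1ℤ)
      ... | true | false = *-zeroˡ (C z x 1ℤ) (C-skip s y₂ z s-y₂ sz λ e →
              z≢y (trans (transpose-· s e) (·-involutive s y)))
      ... | true | true = *-zeroʳ (C y₂ z 1ℤ) (C-skip s z x sz (no-s X) λ e →
              true≢false gz (trans (cong (descent g) (sym e)) (s-no-g X)))
    corr₁ : correction s y x₂ 1ℤ ≡ 0ℤ
    corr₁ = ∑-zero (below (len y)) λ {z} _ → other z
      where
      other : ∀ z → weight s (C y) z * C z x₂ 1ℤ ≡ 0ℤ
      other z with descent s z in sz | descent g z in gz
      ... | false | _ = ℤ.*-zeroˡ (C z x₂ 1ℤ)
      ... | true | false = *-zeroˡ (C z x₂ 1ℤ) (C-skip g y z (has-g Y) gz λ e →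
              true≢false sz (trans (cong (descent s) (transpose-· g e)) (g-no-s Y)))
      ... | true | true = *-zeroʳ (C y z 1ℤ) (C-skip g z x₂ gz (s-no-g X) λ e →
              true≢false sz (trans (cong (descent s) (sym e)) (gs-no-s X)))
    inner : C y₂ x₂ 1ℤ ≡ C y x 1ℤ + C y x₃ 1ℤ + -1ℤ * 0ℤ
    inner = trans (C-recursion-up s y (no-s Y) x₂ 1ℤ)
      (cong₂ (λ a b → a + -1ℤ * b)
        (cong₂ _+_ (cong (λ z → C y z 1ℤ) (·-involutive s x))
          (trans (cong (λ b → C y x₂ (1ℤ + - sign b)) s-x₂) (C-lift g y x₂ 1ℤ (has-g Y) (s-no-g X))))
        corr₁)

open Symmetries

-- From the basis to the polynomials of the definition.

module Polynomials where
  open import Data.Integer using (_+_; _-_; -_; _*_)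
  open import Data.Integer.Tactic.RingSolver using (solve-∀)

  private
    even-or-odd-ℕ : ∀ n → ∃ λ j → + n ≡ j + j ⊎ + n ≡ 1ℤ + (j + j)
    even-or-odd-ℕ zero = 0ℤ , inj₁ refl
    even-or-odd-ℕ (suc n) with even-or-odd-ℕ n
    ... | j , inj₁ p = j , inj₂ (cong (λ z → 1ℤ + z) p)
    ... | j , inj₂ p = j + 1ℤ , inj₁ (trans (cong (λ z → 1ℤ + z) p) (lem j))
      where lem : ∀ j → 1ℤ + (1ℤ + (j + j)) ≡ j + 1ℤ + (j + 1ℤ)
            lem = solve-∀

    even-or-odd : ∀ z → ∃ λ j → z ≡ j + j ⊎ z ≡ 1ℤ + (j + j)
    even-or-odd (+ n) = even-or-odd-ℕ n
    even-or-odd -[1+ n ] with even-or-odd-ℕ (suc n)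
    ... | j , inj₁ p = - j , inj₁ (trans (cong -_ p) (ℤ.neg-distrib-+ j j))
    ... | j , inj₂ p = - j - 1ℤ , inj₂ (trans (cong -_ p) (lem j))
      where lem : ∀ j → - (1ℤ + (j + j)) ≡ 1ℤ + (- j - 1ℤ + (- j - 1ℤ))
            lem = solve-∀

    odd≢0 : ∀ j → 0ℤ ≢ 1ℤ + (j + j)
    odd≢0 (+ n) ()
    odd≢0 -[1+ n ] ()

  weight-zero : ∀ g f z → f z 1ℤ ≡ 0ℤ → weight g f z ≡ 0ℤ
  weight-zero g f z p with descent g z
  ... | true = p
  ... | false = refl

  -- P is a polynomial in q = v², so only degrees of the parity of ℓ(w) - ℓ(x) occur. In the
  -- recursion every Θ term changes the length balance by one.
  C-parity : ∀ w x k j → + len w ≡ + len x + k + (1ℤ + (j + j)) → C w x k ≡ 0ℤ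
  C-parity w = go (len w) w ℕ.≤-refl
    where
    go : ∀ m w → len w ≤ m → ∀ x k j → + len w ≡ + len x + k + (1ℤ + (j + j)) → C w x k ≡ 0ℤ
    go m w p x k j e with find-descent w
    go m w p x k j e | inj₁ refl with x ≟ ε
    ... | no _ = refl
    ... | yes refl = unit-odd k e
      where
      unit-odd : ∀ k → 0ℤ ≡ 0ℤ + k + (1ℤ + (j + j)) → unit k ≡ 0ℤ
      unit-odd (+ zero) e = ⊥-elim (odd≢0 j (trans e (ℤ.+-identityˡ _)))
      unit-odd (+ suc n) e = refl
      unit-odd -[1+ n ] e = refl
    go zero w p x k j e | inj₂ (g , d) = ⊥-elim (ℕ.n≮0 (ℕ.≤-trans (ℕ.≤-reflexive (sym (len-down g w d))) p))
    go (suc m) w p x k j e | inj₂ (g , d) = trans (C-recursion g w d x k)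
        (cong₂ (λ a b → a + -1ℤ * b) (Θ-part (descent g x) refl)
          (∑-zero (below (len v)) λ {z} z∈ → term z (ℕ.≤-trans (ℕ.<⇒≤ (∈-below⁻ z∈)) v≤)))
      where
      v = g · w
      lw = len-down g w d
      v≤ : len v ≤ m
      v≤ = ℕ.≤-pred (ℕ.≤-trans (ℕ.≤-reflexive (sym lw)) p)
      lv : + len v ≡ + len x + k + (j + j)
      lv = trans (lem₁ (+ len v)) (trans (cong (_- 1ℤ) (trans (cong +_ (sym lw)) e)) (lem₂ (+ len x) k j))
        where
        lem₁ : ∀ a → a ≡ 1ℤ + a - 1ℤ
        lem₁ = solve-∀
        lem₂ : ∀ a k j → a + k + (1ℤ + (j + j)) - 1ℤ ≡ a + k + (j + j)
        lem₂ = solve-∀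
      Θ-part : ∀ b → descent g x ≡ b → C v (g · x) k + C v x (k + sgn g x) ≡ 0ℤ
      Θ-part true eq = cong₂ _+_
        (go m v v≤ (g · x) k j (trans lv (trans (lem₁ (+ len x) k j)
          (cong (λ l → l + k + (1ℤ + (j + j))) (sym (trans (len-· g x) (cong (λ b → + len x - - sign b) eq)))))))
        (go m v v≤ x (k + sgn g x) (j - 1ℤ) (trans lv (trans (lem₂ (+ len x) k j)
          (cong (λ b → + len x + (k + - sign b) + (1ℤ + (j - 1ℤ + (j - 1ℤ)))) (sym eq)))))
        where
        lem₁ : ∀ a k j → a + k + (j + j) ≡ a - 1ℤ + k + (1ℤ + (j + j))
        lem₁ = solve-∀
        lem₂ : ∀ a k j → a + k + (j + j) ≡ a + (k + 1ℤ) + (1ℤ + (j - 1ℤ + (j - 1ℤ)))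
        lem₂ = solve-∀
      Θ-part false eq = cong₂ _+_
        (go m v v≤ (g · x) k (j - 1ℤ) (trans lv (trans (lem₁ (+ len x) k j)
          (cong (λ l → l + k + (1ℤ + (j - 1ℤ + (j - 1ℤ)))) (sym (trans (len-· g x) (cong (λ b → + len x - - sign b) eq)))))))
        (go m v v≤ x (k + sgn g x) j (trans lv (trans (lem₂ (+ len x) k j)
          (cong (λ b → + len x + (k + - sign b) + (1ℤ + (j + j))) (sym eq)))))
        where
        lem₁ : ∀ a k j → a + k + (j + j) ≡ a - -1ℤ + k + (1ℤ + (j - 1ℤ + (j - 1ℤ)))
        lem₁ = solve-∀
        lem₂ : ∀ a k j → a + k + (j + j) ≡ a + (k + -1ℤ) + (1ℤ + (j + j))
        lem₂ = solve-∀
      term : ∀ z → len z ≤ m → weight g (C v) z * C z x k ≡ 0ℤ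
      -- Either ℓ(v) - ℓ(z) is even and the weight of z vanishes, or it is odd and C_z inherits the
      -- wrong parity at x.
      term z z≤ with even-or-odd (+ len v - + len z - 1ℤ)
      ... | i , inj₂ q = *-zeroˡ (C z x k) (weight-zero g (C v) z (go m v v≤ z 1ℤ i
              (trans (lem (+ len v) (+ len z)) (cong (λ a → + len z + 1ℤ + a) q))))
        where
        lem : ∀ a b → a ≡ b + 1ℤ + (a - b - 1ℤ)
        lem = solve-∀
      ... | i , inj₁ q = *-zeroʳ (weight g (C v) z) (go m z z≤ x k (j - i - 1ℤ)
              (trans (lem (+ len v) (+ len z)) (trans (cong₂ (λ a b → a - b - 1ℤ) lv q) (lem' (+ len x) k j i))))
        where
        lem : ∀ a b → b ≡ a - (a - b - 1ℤ) - 1ℤ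
        lem = solve-∀
        lem' : ∀ x k j i → x + k + (j + j) - (i + i) - 1ℤ ≡ x + k + (1ℤ + (j - i - 1ℤ + (j - i - 1ℤ)))
        lem' = solve-∀

  coeff-⊕ : ∀ i p q → coeff i (p ⊕ q) ≡ coeff i p + coeff i q
  coeff-⊕ i [] q = sym (ℤ.+-identityˡ _)
  coeff-⊕ i (a ∷ p) [] = sym (ℤ.+-identityʳ _)
  coeff-⊕ zero (a ∷ p) (b ∷ q) = refl
  coeff-⊕ (suc i) (a ∷ p) (b ∷ q) = coeff-⊕ i p q

  coeff-scale : ∀ i c p → coeff i (scale c p) ≡ c * coeff i p
  coeff-scale i c [] = sym (ℤ.*-zeroʳ c)
  coeff-scale zero c (a ∷ p) = refl
  coeff-scale (suc i) c (a ∷ p) = coeff-scale i c p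

  coeff-⊖ : ∀ i p q → coeff i (p ⊖ q) ≡ coeff i p + -1ℤ * coeff i q
  coeff-⊖ i p q = trans (coeff-⊕ i p (scale (- 1ℤ) q)) (cong (λ a → coeff i p + a) (coeff-scale i -1ℤ q))

  opaque
    unfolding ∑ below

    coeff-sumP : ∀ {A : Set} i (T : A → Poly) xs → coeff i (sumP (map T xs)) ≡ ∑ xs (λ z → coeff i (T z))
    coeff-sumP i T [] = refl
    coeff-sumP i T (x ∷ xs) = trans (coeff-⊕ i (T x) (sumP (map T xs))) (cong (λ a → coeff i (T x) + a) (coeff-sumP i T xs))

    ∑-elemsBelow : ∀ n (φ : G → ℤ) → ∑ (below n) φ ≡ ∑ (elemsBelow n) (λ z → φ (nf z))
    ∑-elemsBelow n φ = ∑-map nf (elemsBelow n) φ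

    len-elemsBelow : ∀ {n z} → z ∈ elemsBelow n → len (nf z) < n
    len-elemsBelow p = ∈-below⁻ (∈-map⁺ nf p)

  -- p holds the coefficients F a, F (a − 2), F (a − 4), …, and F vanishes above a.
  record Samples (p : Poly) (F : ℤ → ℤ) (a : ℤ) : Set where
    field
      sample : ∀ i → coeff i p ≡ F (a - (+ i + + i))
      vanish : ∀ m → F (a + + suc m) ≡ 0ℤ
  open Samples

  -- The zeros inserted by `shift` are correct samples because F vanishes above a.
  coeff-shift : ∀ {p F a} → Samples p F a → ∀ m i → coeff i (shift m p) ≡ F (a + (+ m + + m) - (+ i + + i))
  coeff-shift {F = F} {a} h zero i = trans (sample h i) (cong (λ b → F (b - (+ i + + i))) (sym (ℤ.+-identityʳ a)))
  coeff-shift {F = F} {a} h (suc m) zero = sym (trans (cong F (trans (ℤ.+-identityʳ (a + (+ suc m + + suc m))) (cong (λ z → a + + z) (ℕ.+-suc (suc m) m))))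
    (vanish h (suc m ℕ.+ m)))
  coeff-shift {F = F} {a} h (suc m) (suc i) = trans (coeff-shift h m i) (cong F (lem a (+ m) (+ i)))
    where
    lem : ∀ a m i → a + (m + m) - (i + i) ≡ a + (1ℤ + m + (1ℤ + m)) - (1ℤ + i + (1ℤ + i))
    lem = solve-∀

  -- The power q^i in P_{x,w} carries v to the exponent ℓ(x) - ℓ(w) + 2i in C_w, and functions are
  -- indexed by minus that exponent.
  IsKL : Poly → W → W → Set
  IsKL p x w = ∀ i → coeff i p ≡ C (nf w) (nf x) (+ len (nf w) - + len (nf x) - (+ i + + i))

  IsKL-samples : ∀ {p} x w → IsKL p x w → Samples p (C (nf w) (nf x)) (+ len (nf w) - + len (nf x))
  IsKL-samples x w h .sample = h
  IsKL-samples x w h .vanish m = bound (C-triangular (nf w)) (nf x) _ m (lem (+ len (nf w)) (+ len (nf x)) (+ suc m))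
    where
    lem : ∀ a b c → a - b + c + b ≡ a + c
    lem = solve-∀

  private
    double : ∀ m → m ℕ.* 2 ≡ m ℕ.+ m
    double m = trans (ℕ.*-comm m 2) (cong (m ℕ.+_) (ℕ.+-identityʳ m))

    mod-2 : ∀ n → (∃ λ m → n % 2 ≡ 0 × n / 2 ≡ m × n ≡ m ℕ.+ m) ⊎ (∃ λ m → n % 2 ≡ 1 × n / 2 ≡ m × n ≡ suc (m ℕ.+ m))
    mod-2 n with n % 2 in e | m%n<n n 2 | m≡m%n+[m/n]*n n 2
    ... | 0 | _ | q = inj₁ (n / 2 , refl , refl , trans q (double (n / 2)))
    ... | 1 | _ | q = inj₂ (n / 2 , refl , refl , trans q (cong suc (double (n / 2))))
    ... | suc (suc _) | s≤s (s≤s ()) | _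

    minus-plus : ∀ {a b} → a < b → + b ≡ + a + + (b ∸ a)
    minus-plus p = cong +_ (sym (ℕ.m+[n∸m]≡n (ℕ.<⇒≤ p)))

    odd-half : ∀ m → (suc (m ℕ.+ m) ∸ 1) / 2 ≡ m
    odd-half m = trans (cong (_/ 2) (trans (cong (m ℕ.+_) (sym (ℕ.+-identityʳ m))) (ℕ.*-comm 2 m))) (m*n/n≡m m 2)

  -- The middle exponent of the definition corresponds to degree 1. Where the definition returns 0
  -- by default, degree 1 vanishes by the length bound or by parity.
  μFrom-C : ∀ p z v → IsKL p z v → μFrom p z v ≡ C (nf v) (nf z) 1ℤ
  μFrom-C p z v h with ℓ z <? ℓ v | (ℓ v ∸ ℓ z) % 2 ℕ.≟ 1
  ... | no ¬lt | _ = sym (C-pos-zero {nf v} {nf z} {1} (s≤s (subst₂ _≤_ (ℓ-len v) (ℓ-len z) (ℕ.≮⇒≥ ¬lt))))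
  ... | yes lt | no ¬odd with mod-2 (ℓ v ∸ ℓ z)
  ...   | inj₂ (m , odd , _) = ⊥-elim (¬odd odd)
  ...   | inj₁ (m , _ , _ , e) = sym (C-parity (nf v) (nf z) 1ℤ (+ m - 1ℤ) (trans (subst₂ (λ a b → + b ≡ + a + + (m ℕ.+ m)) (ℓ-len z) (ℓ-len v)
            (trans (minus-plus lt) (cong (λ n → + ℓ z + + n) e))) (lem (+ len (nf z)) (+ m))))
    where
    lem : ∀ a m → a + (m + m) ≡ a + 1ℤ + (1ℤ + (m - 1ℤ + (m - 1ℤ)))
    lem = solve-∀
  μFrom-C p z v h | yes lt | yes odd with mod-2 (ℓ v ∸ ℓ z)
  ... | inj₁ (m , even , _) with trans (sym odd) even
  ...   | ()
  μFrom-C p z v h | yes lt | yes odd | inj₂ (m , _ , _ , e) =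
    trans (cong (λ n → coeff n p) (trans (cong (λ n → (n ∸ 1) / 2) e) (odd-half m)))
      (trans (h m) (cong (C (nf v) (nf z)) (trans (cong (λ a → a - + len (nf z) - (+ m + + m)) lv) (lem (+ len (nf z)) (+ m)))))
    where
    lv : + len (nf v) ≡ + len (nf z) + (1ℤ + (+ m + + m))
    lv = subst₂ (λ a b → + b ≡ + a + + suc (m ℕ.+ m)) (ℓ-len z) (ℓ-len v) (trans (minus-plus lt) (cong (λ n → + ℓ z + + n) e))
    lem : ∀ a m → a + (1ℤ + (m + m)) - a - (m + m) ≡ 1ℤ
    lem = solve-∀

  <⇒descent : ∀ g x → len (g · x) < len x → descent g x ≡ true
  <⇒descent g x lt with descent g x in e
  ... | true = refl
  ... | false = ⊥-elim (ℕ.<-irrefl refl (ℕ.<-trans lt (ℕ.≤-reflexive (sym (len-up g x e)))))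

  descent⇒< : ∀ g x → descent g x ≡ true → len (g · x) < len x
  descent⇒< g x d = ℕ.≤-reflexive (sym (len-down g x d))

  ∈𝓛⇒descent : ∀ {g w} → g ∈𝓛 w → descent g (nf w) ≡ true
  ∈𝓛⇒descent {g} {w} p = <⇒descent g (nf w) (subst₂ _<_ (ℓ-len (g ∷ w)) (ℓ-len w) p)

  descent⇒∈𝓛 : ∀ {g w} → descent g (nf w) ≡ true → g ∈𝓛 w
  descent⇒∈𝓛 {g} {w} p = subst₂ _<_ (sym (ℓ-len (g ∷ w))) (sym (ℓ-len w)) (descent⇒< g (nf w) p)

  ∉𝓛⇒ascent : ∀ {g w} → ¬ g ∈𝓛 w → descent g (nf w) ≡ false
  ∉𝓛⇒ascent {g} {w} p with descent g (nf w) in e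
  ... | true = ⊥-elim (p (descent⇒∈𝓛 {g} {w} e))
  ... | false = refl

  pickDesc-pick : ∀ w → pickDesc w ≡ pick (nf w)
  pickDesc-pick w with ℓ (r ∷ w) <? ℓ w
  ... | yes p rewrite ∈𝓛⇒descent {r} {w} p = refl
  ... | no ¬p rewrite ∉𝓛⇒ascent {r} {w} ¬p with ℓ (s ∷ w) <? ℓ w
  ...   | yes p rewrite ∈𝓛⇒descent {s} {w} p = refl
  ...   | no ¬p' rewrite ∉𝓛⇒ascent {s} {w} ¬p' with ℓ (t ∷ w) <? ℓ w
  ...     | yes p rewrite ∈𝓛⇒descent {t} {w} p = refl
  ...     | no ¬p'' rewrite ∉𝓛⇒ascent {t} {w} ¬p'' = refl

  δe-IsKL : ∀ x w → nf w ≡ ε → IsKL (δe x) x w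
  δe-IsKL x w p i rewrite p with ev x ≟E ev []
  ... | yes q rewrite ≈⇒nf {x} {[]} q = one i
    where
    one : ∀ i → coeff i (1ℤ ∷ []) ≡ unit (0ℤ - (+ i + + i))
    one zero = refl
    one (suc i) = refl
  ... | no ¬q = sym (δ-≢ {ε} {nf x} (0ℤ - + len (nf x) - (+ i + + i)) λ e → ¬q (nf⇒≈ {x} {[]} e))

  -- The local functions of `KL` depend on a case split and have no name outside it. Obtaining them
  -- as witnesses lets their values be determined separately, by the descents of x and z.
  KL-shape : ∀ n x w g → pickDesc w ≡ just g → Σ Poly λ M → Σ (W → Poly) λ T →
    KL (suc n) x w ≡ M ⊖ sumP (map T (elemsBelow (ℓ (g ∷ w))))
  KL-shape n x w g eq with pickDesc w
  KL-shape n x w g refl | .(just g) = _ , _ , refl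

  KL-main : ∀ n x w g eq → descent g (nf x) ≡ true →
    proj₁ (KL-shape n x w g eq) ≡ KL n (g ∷ x) (g ∷ w) ⊕ shift 1 (KL n x (g ∷ w))
  KL-main n x w g eq d with pickDesc w
  KL-main n x w g refl d | .(just g) with ℓ (g ∷ x) <? ℓ x
  ... | yes _ = refl
  ... | no ¬p = ⊥-elim (¬p (descent⇒∈𝓛 {g} {x} d))

  KL-main′ : ∀ n x w g eq → descent g (nf x) ≡ false →
    proj₁ (KL-shape n x w g eq) ≡ shift 1 (KL n (g ∷ x) (g ∷ w)) ⊕ KL n x (g ∷ w)
  KL-main′ n x w g eq d with pickDesc w
  KL-main′ n x w g refl d | .(just g) with ℓ (g ∷ x) <? ℓ x
  ... | no _ = refl
  ... | yes p with trans (sym (∈𝓛⇒descent {g} {x} p)) d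
  ...   | ()

  KL-term : ∀ n x w g eq z → descent g (nf z) ≡ true →
    proj₁ (proj₂ (KL-shape n x w g eq)) z ≡ scale (μFrom (KL n z (g ∷ w)) z (g ∷ w)) (shift ((ℓ w ∸ ℓ z) / 2) (KL n x z))
  KL-term n x w g eq z d with pickDesc w
  KL-term n x w g refl z d | .(just g) with ℓ (g ∷ z) <? ℓ z
  ... | yes _ = refl
  ... | no ¬p = ⊥-elim (¬p (descent⇒∈𝓛 {g} {z} d))

  KL-term′ : ∀ n x w g eq z → descent g (nf z) ≡ false → proj₁ (proj₂ (KL-shape n x w g eq)) z ≡ []
  KL-term′ n x w g eq z d with pickDesc w
  KL-term′ n x w g refl z d | .(just g) with ℓ (g ∷ z) <? ℓ z
  ... | no _ = refl
  ... | yes p with trans (sym (∈𝓛⇒descent {g} {z} p)) d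
  ...   | ()

  KL-nothing : ∀ n x w → pickDesc w ≡ nothing → KL (suc n) x w ≡ δe x
  KL-nothing n x w eq with pickDesc w
  KL-nothing n x w refl | .nothing = refl

  KL-IsKL : ∀ n x w → len (nf w) ≤ n → IsKL (KL n x w) x w
  KL-IsKL zero x w p = δe-IsKL x w (len-0 (nf w) p)
    where
    len-0 : ∀ y → len y ≤ 0 → y ≡ ε
    len-0 y q with find-descent y
    ... | inj₁ e = e
    ... | inj₂ (g , d) = ⊥-elim (ℕ.n≮0 (ℕ.≤-trans (ℕ.≤-reflexive (sym (len-down g y d))) q))
  KL-IsKL (suc n) x w p = by (pickDesc w) refl
    where
    by : ∀ h → pickDesc w ≡ h → IsKL (KL (suc n) x w) x w
    by nothing eq = subst (λ q → IsKL q x w) (sym (KL-nothing n x w eq))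
      (δe-IsKL x w (pick-nothing (nf w) (trans (sym (pickDesc-pick w)) eq)))
    by (just g) eq i = trans (cong (coeff i) (proj₂ (proj₂ (KL-shape n x w g eq))))
      (trans (coeff-⊖ i M (sumP (map T (elemsBelow (ℓ (g ∷ w))))))
        (trans (cong₂ (λ a b → a + -1ℤ * b) (main-part (descent g (nf x)) refl) correction-part)
          (sym (C-recursion g (nf w) d (nf x) k))))
      where
      M = proj₁ (KL-shape n x w g eq)
      T = proj₁ (proj₂ (KL-shape n x w g eq))
      lw = + len (nf w)
      lx = + len (nf x)
      k = lw - lx - (+ i + + i)
      v = g · nf w
      d : descent g (nf w) ≡ true
      d = pick-just (nf w) (trans (sym (pickDesc-pick w)) eq)
      w≡ : len (nf w) ≡ suc (len v)
      w≡ = len-down g (nf w) d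
      v≤ : len v ≤ n
      v≤ = ℕ.≤-pred (ℕ.≤-trans (ℕ.≤-reflexive (sym w≡)) p)
      l-w : lw ≡ 1ℤ + + len v
      l-w = cong +_ w≡
      ih : ∀ y → IsKL (KL n y (g ∷ w)) y (g ∷ w)
      ih y = KL-IsKL n y (g ∷ w) v≤
      main-part : ∀ b → descent g (nf x) ≡ b → coeff i M ≡ C v (g · nf x) k + C v (nf x) (k + sgn g (nf x))
      main-part true e = trans (cong (coeff i) (KL-main n x w g eq e))
        (trans (coeff-⊕ i (KL n (g ∷ x) (g ∷ w)) (shift 1 (KL n x (g ∷ w))))
          (cong₂ _+_
            (trans (ih (g ∷ x) i) (cong (C v (g · nf x)) (trans (cong (λ a → + len v - a - (+ i + + i)) l-gx) (trans (lem₁ (+ len v) lx (+ i)) (cong (λ a → a - lx - (+ i + + i)) (sym l-w))))))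
            (trans (coeff-shift (IsKL-samples x (g ∷ w) (ih x)) 1 i) (cong (C v (nf x)) (trans (lem₂ (+ len v) lx (+ i))
              (cong₂ (λ a b → a - lx - (+ i + + i) + - sign b) (sym l-w) (sym e)))))))
        where
        l-gx : + len (g · nf x) ≡ lx - 1ℤ
        l-gx = trans (len-· g (nf x)) (cong (λ b → lx - - sign b) e)
        lem₁ : ∀ v x i → v - (x - 1ℤ) - (i + i) ≡ 1ℤ + v - x - (i + i)
        lem₁ = solve-∀
        lem₂ : ∀ v x i → v - x + (1ℤ + 1ℤ) - (i + i) ≡ 1ℤ + v - x - (i + i) + 1ℤ
        lem₂ = solve-∀
      main-part false e = trans (cong (coeff i) (KL-main′ n x w g eq e))
        (trans (coeff-⊕ i (shift 1 (KL n (g ∷ x) (g ∷ w))) (KL n x (g ∷ w)))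
          (cong₂ _+_
            (trans (coeff-shift (IsKL-samples (g ∷ x) (g ∷ w) (ih (g ∷ x))) 1 i) (cong (C v (g · nf x)) (trans (cong (λ a → + len v - a + (1ℤ + 1ℤ) - (+ i + + i)) l-gx)
              (trans (lem₁ (+ len v) lx (+ i)) (cong (λ a → a - lx - (+ i + + i)) (sym l-w))))))
            (trans (ih x i) (cong (C v (nf x)) (trans (lem₂ (+ len v) lx (+ i))
              (cong₂ (λ a b → a - lx - (+ i + + i) + - sign b) (sym l-w) (sym e)))))))
        where
        l-gx : + len (g · nf x) ≡ lx - -1ℤ
        l-gx = trans (len-· g (nf x)) (cong (λ b → lx - - sign b) e)
        lem₁ : ∀ v x i → v - (x - -1ℤ) + (1ℤ + 1ℤ) - (i + i) ≡ 1ℤ + v - x - (i + i)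
        lem₁ = solve-∀
        lem₂ : ∀ v x i → v - x - (i + i) ≡ 1ℤ + v - x - (i + i) + -1ℤ
        lem₂ = solve-∀
      term-part : ∀ z → len (nf z) < len v → coeff i (T z) ≡ weight g (C v) (nf z) * C (nf z) (nf x) k
      term-part z z<v with descent g (nf z) in e
      ... | false = trans (cong (coeff i) (KL-term′ n x w g eq z e)) (sym (ℤ.*-zeroˡ (C (nf z) (nf x) k)))
      ... | true = trans (cong (coeff i) (KL-term n x w g eq z e))
          (trans (coeff-scale i (μFrom (KL n z (g ∷ w)) z (g ∷ w)) (shift ((ℓ w ∸ ℓ z) / 2) (KL n x z)))
            (trans (cong₂ _*_ (μFrom-C (KL n z (g ∷ w)) z (g ∷ w) (ih z)) (coeff-shift (IsKL-samples x z (KL-IsKL n x z (ℕ.≤-trans (ℕ.<⇒≤ z<v) v≤))) ((ℓ w ∸ ℓ z) / 2) i))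
              (parity-cases (mod-2 (ℓ w ∸ ℓ z)))))
        where
        lz = + len (nf z)
        z<w : ℓ z < ℓ w
        z<w = subst₂ _<_ (sym (ℓ-len z)) (sym (ℓ-len w)) (ℕ.<-trans z<v (ℕ.≤-reflexive (sym w≡)))
        l-wz : lw ≡ lz + + (ℓ w ∸ ℓ z)
        l-wz = subst₂ (λ a b → + b ≡ + a + + (ℓ w ∸ ℓ z)) (ℓ-len z) (ℓ-len w) (minus-plus z<w)
        parity-cases : _ → C v (nf z) 1ℤ * C (nf z) (nf x) (lz - lx + (+ ((ℓ w ∸ ℓ z) / 2) + + ((ℓ w ∸ ℓ z) / 2)) - (+ i + + i)) ≡ C v (nf z) 1ℤ * C (nf z) (nf x) k
        parity-cases (inj₁ (m , _ , h , q)) rewrite h = cong (λ a → C v (nf z) 1ℤ * C (nf z) (nf x) a)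
          (trans (lem lz lx (+ i) (+ m)) (cong (λ a → a - lx - (+ i + + i)) (sym (trans l-wz (cong (λ n → lz + + n) q)))))
          where
          lem : ∀ z x i m → z - x + (m + m) - (i + i) ≡ z + (m + m) - x - (i + i)
          lem = solve-∀
        -- For odd ℓ(w) - ℓ(z) the halved exponent is rounded down and would be wrong, but then
        -- μ(z,v) = 0 by parity.
        parity-cases (inj₂ (m , _ , _ , q)) = trans (*-zeroˡ _ no-edge) (sym (*-zeroˡ (C (nf z) (nf x) k) no-edge))
          where
          lem : ∀ v z m → 1ℤ + v ≡ z + (1ℤ + (m + m)) → v ≡ z + 1ℤ + (1ℤ + (m - 1ℤ + (m - 1ℤ)))
          lem v z m h = trans (lem₁ v) (trans (cong (_- 1ℤ) h) (lem₂ z m))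
            where
            lem₁ : ∀ v → v ≡ 1ℤ + v - 1ℤ
            lem₁ = solve-∀
            lem₂ : ∀ z m → z + (1ℤ + (m + m)) - 1ℤ ≡ z + 1ℤ + (1ℤ + (m - 1ℤ + (m - 1ℤ)))
            lem₂ = solve-∀
          no-edge : C v (nf z) 1ℤ ≡ 0ℤ
          no-edge = C-parity v (nf z) 1ℤ (+ m - 1ℤ) (lem (+ len v) lz (+ m) (trans (sym l-w) (trans l-wz (cong (λ n → lz + + n) q))))
      correction-part : coeff i (sumP (map T (elemsBelow (ℓ (g ∷ w))))) ≡ correction g v (nf x) k
      correction-part rewrite ℓ-len (g ∷ w) = trans (coeff-sumP i T (elemsBelow (len v)))
        (trans (∑-cong (elemsBelow (len v)) λ {z} z∈ → term-part z (len-elemsBelow z∈))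
          (sym (∑-elemsBelow (len v) (λ z → weight g (C v) z * C z (nf x) k))))

  μ-C : ∀ u w → μ u w ≡ C (nf w) (nf u) 1ℤ
  μ-C u w = μFrom-C (P u w) u w (KL-IsKL (ℓ w) u w (ℕ.≤-reflexive (sym (ℓ-len w))))

open Polynomials

-- Right descents along the left preorder.

open import Data.Nat using (_+_; _*_)

private
  len-∷ʳ : ∀ w h → ℓ (w ++ h ∷ []) ≡ len (h · inv (nf w))
  len-∷ʳ w h = trans (ℓ-len (w ++ h ∷ [])) (trans (cong len (nf-∷ʳ w h))
    (trans (sym (len-inv (nf w ◂ h))) (cong len (inv-◂ (nf w) h))))

  ℓ-len-inv : ∀ w → ℓ w ≡ len (inv (nf w))
  ℓ-len-inv w = trans (ℓ-len w) (sym (len-inv (nf w)))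

∈𝓡⇒descent : ∀ {h} w → h ∈𝓡 w → descent h (inv (nf w)) ≡ true
∈𝓡⇒descent {h} w p = <⇒descent h (inv (nf w)) (subst₂ _<_ (len-∷ʳ w h) (ℓ-len-inv w) p)

descent⇒∈𝓡 : ∀ {h} w → descent h (inv (nf w)) ≡ true → h ∈𝓡 w
descent⇒∈𝓡 {h} w d = subst₂ _<_ (sym (len-∷ʳ w h)) (sym (ℓ-len-inv w)) (descent⇒< h (inv (nf w)) d)

-- If h stopped being a right descent, `exchange` would give xh = gx, although xh is shorter than x
-- and gx is longer.
right-descent-up : ∀ g h x → descent g x ≡ false → descent h (inv x) ≡ true → descent h (inv (g · x)) ≡ true
right-descent-up g h x up d with exchange h (inv x) g
... | inj₁ e = trans (cong (descent h) (inv-· g x)) (trans e d)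
... | inj₂ e = ⊥-elim (ℕ.1+n≰n (ℕ.≤-trans (ℕ.≤-reflexive (sym (cong suc gx-len))) (ℕ.≤-trans (ℕ.≤-reflexive (sym lx)) (ℕ.≤-trans (ℕ.n≤1+n _) (ℕ.≤-reflexive (sym (len-up g x up)))))))
  where
  lx : len x ≡ suc (len (h · inv x))
  lx = trans (sym (len-inv x)) (len-down h (inv x) d)
  gx-len : len (h · inv x) ≡ len (g · x)
  gx-len = trans (cong len (trans e (sym (inv-· g x)))) (len-inv (g · x))

-- Suppose h ∈ R(y) but h ∉ R(x). If the edge has x below y, `C-skip` for inverses forces y = xh >
-- x, and then L(x) ⊆ L(y). If y is below x, any g in L(x) outside L(y) forces x = gy, and h would
-- pass on to R(x). Both contradict L(x) ⊄ L(y).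
≤L-step-right : ∀ x y → (x ≈ y) ⊎ (Edge x y × ¬ (x ⊆𝓛 y)) →
  ∀ h → descent h (inv (nf y)) ≡ true → descent h (inv (nf x)) ≡ true
≤L-step-right x y (inj₁ e) h d = trans (cong (λ z → descent h (inv z)) (≈⇒nf {x} {y} e)) d
≤L-step-right x y (inj₂ (edge , ¬⊆)) h d with descent h (inv (nf x)) in hx
... | true = refl
... | false = ⊥-elim (¬⊆ (contained edge))
  where
  contained : Edge x y → x ⊆𝓛 y
  contained (inj₁ (_ , μ≢0)) g g∈ with (h · inv (nf x)) ≟ inv (nf y)
  ... | no ne = ⊥-elim (μ≢0 (trans (μ-C x y) (trans (sym (C-inv-inv (nf y) (nf x) 1ℤ))
          (C-skip h (inv (nf y)) (inv (nf x)) d hx ne))))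
  ... | yes e = descent⇒∈𝓛 {g} {y} (trans (cong (descent g) (trans (sym (inv-involutive (nf y))) (cong inv (sym e))))
          (right-descent-up h g (inv (nf x)) hx (trans (cong (descent g) (inv-involutive (nf x))) (∈𝓛⇒descent {g} {x} g∈))))
  contained (inj₂ (_ , μ≢0)) g g∈ with descent g (nf y) in gy
  ... | true = descent⇒∈𝓛 {g} {y} gy
  ... | false with (g · nf y) ≟ nf x
  ...   | no ne = ⊥-elim (μ≢0 (trans (μ-C y x) (C-skip g (nf x) (nf y) (∈𝓛⇒descent {g} {x} g∈) gy ne)))
  ...   | yes e = true≢false (trans (cong (λ z → descent h (inv z)) (sym e)) (right-descent-up g h (nf y) gy d)) hx

≤L-right : ∀ {x y} → x ≤L y → ∀ h → descent h (inv (nf y)) ≡ true → descent h (inv (nf x)) ≡ true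
≤L-right done h d = d
≤L-right (_then_ {x} {y} p q) h d = ≤L-step-right x y p h (≤L-right q h d)

∼L-right : ∀ {x y} → x ∼L y → ∀ h → descent h (inv (nf x)) ≡ descent h (inv (nf y))
∼L-right {x} {y} (p , q) h with descent h (inv (nf x)) in ex | descent h (inv (nf y)) in ey
... | true | true = refl
... | false | false = refl
... | true | false = sym (trans (sym ey) (≤L-right q h ex))
... | false | true = trans (sym ex) (≤L-right p h ey)

-- Elements of c₂ by their two arms.

data Arm : Set where
  [e] [s] [ts] [rs] : Arm

left right : Arm → W
left [e] = []
left [s] = s ∷ []
left [ts] = t ∷ s ∷ []
left [rs] = r ∷ s ∷ []
right [e] = []
right [s] = s ∷ []
right [ts] = s ∷ t ∷ []
right [rs] = s ∷ r ∷ []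

size : Arm → ℕ
size [e] = 0
size [s] = 1
size [ts] = 2
size [rs] = 2

descents : Arm → Gen → Bool
descents [e] r = true
descents [e] s = false
descents [e] t = true
descents [s] r = false
descents [s] s = true
descents [s] t = false
descents [ts] r = false
descents [ts] s = false
descents [ts] t = true
descents [rs] r = true
descents [rs] s = false
descents [rs] t = false

descents-injective : ∀ α β → (∀ g → descents α g ≡ descents β g) → α ≡ β
descents-injective α β h = decode-all α β (h r) (h s) (h t)
  where
  decode-all : ∀ α β → descents α r ≡ descents β r → descents α s ≡ descents β s → descents α t ≡ descents β t → α ≡ β
  decode-all [e] [e] _ _ _ = refl
  decode-all [s] [s] _ _ _ = refl
  decode-all [ts] [ts] _ _ _ = refl
  decode-all [rs] [rs] _ _ _ = refl
  decode-all [e] [s] () _ _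
  decode-all [e] [ts] () _ _
  decode-all [e] [rs] _ _ ()
  decode-all [s] [e] () _ _
  decode-all [s] [ts] _ () _
  decode-all [s] [rs] () _ _
  decode-all [ts] [e] () _ _
  decode-all [ts] [s] _ () _
  decode-all [ts] [rs] () _ _
  decode-all [rs] [e] _ _ ()
  decode-all [rs] [s] () _ _
  decode-all [rs] [ts] () _ _

stair : ℕ → Arm → G
stair m β = nf (srtPow m ++ right β)

cword : Arm → ℕ → Arm → W
cword α m β = left α ++ (r ∷ t ∷ srtPow m) ++ right β

form : Arm → ℕ → Arm → G
form α m β = nf (cword α m β)

InC2-form : ∀ {w} → InC2 w → ∃ λ α → ∃ λ m → ∃ λ β → w ≈ cword α m β
InC2-form {w} (a , b , m , a∈ , b∈ , e) with left-arm a∈ | right-arm b∈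
  where
  left-arm : ∀ {a} → a ∈ Us → ∃ λ α → a ≡ left α
  left-arm (here refl) = [e] , refl
  left-arm (there (here refl)) = [s] , refl
  left-arm (there (there (here refl))) = [ts] , refl
  left-arm (there (there (there (here refl)))) = [rs] , refl
  right-arm : ∀ {b} → b ∈ Vs → ∃ λ β → b ≡ right β
  right-arm (here refl) = [e] , refl
  right-arm (there (here refl)) = [s] , refl
  right-arm (there (there (here refl))) = [ts] , refl
  right-arm (there (there (there (here refl)))) = [rs] , refl
... | α , refl | β , refl = α , m , β , e

nf-++ : ∀ u {w w'} → nf w ≡ nf w' → nf (u ++ w) ≡ nf (u ++ w')
nf-++ [] e = e
nf-++ (g ∷ u) e = cong (g ·_) (nf-++ u e)

reverse-left : ∀ α → reverse (left α) ≡ right α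
reverse-left [e] = refl
reverse-left [s] = refl
reverse-left [ts] = refl
reverse-left [rs] = refl

reverse-right : ∀ α → reverse (right α) ≡ left α
reverse-right [e] = refl
reverse-right [s] = refl
reverse-right [ts] = refl
reverse-right [rs] = refl

srtPow-suc : ∀ m c → srtPow m ++ (s ∷ r ∷ t ∷ c) ≡ srtPow (suc m) ++ c
srtPow-suc zero c = refl
srtPow-suc (suc m) c = cong (λ w → s ∷ r ∷ t ∷ w) (srtPow-suc m c)

reverse-∷³ : ∀ (a b c : Gen) w → reverse (a ∷ b ∷ c ∷ w) ≡ reverse w ++ (c ∷ b ∷ a ∷ [])
reverse-∷³ a b c w = reverse-++ (a ∷ b ∷ c ∷ []) w

-- Reversal turns the blocks srt into trs. Since r and t commute, the sequence regroups as rt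
-- followed by blocks srt, so the middle part is its own inverse.
reverse-core : ∀ m c → nf (reverse (srtPow m) ++ (t ∷ r ∷ c)) ≡ nf ((r ∷ t ∷ srtPow m) ++ c)
reverse-core zero c = refl
reverse-core (suc m) c = begin
  nf (reverse (s ∷ r ∷ t ∷ srtPow m) ++ (t ∷ r ∷ c))
    ≡⟨ cong (λ w → nf (w ++ (t ∷ r ∷ c))) (reverse-∷³ s r t (srtPow m)) ⟩
  nf ((reverse (srtPow m) ++ (t ∷ r ∷ s ∷ [])) ++ (t ∷ r ∷ c))
    ≡⟨ cong nf (++-assoc (reverse (srtPow m)) (t ∷ r ∷ s ∷ []) (t ∷ r ∷ c)) ⟩
  nf (reverse (srtPow m) ++ (t ∷ r ∷ s ∷ t ∷ r ∷ c))
    ≡⟨ reverse-core m (s ∷ t ∷ r ∷ c) ⟩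
  nf ((r ∷ t ∷ srtPow m) ++ (s ∷ t ∷ r ∷ c))
    ≡⟨ nf-++ (r ∷ t ∷ srtPow m) {s ∷ t ∷ r ∷ c} {s ∷ r ∷ t ∷ c} refl ⟩
  nf ((r ∷ t ∷ srtPow m) ++ (s ∷ r ∷ t ∷ c))
    ≡⟨ cong (λ w → nf (r ∷ t ∷ w)) (srtPow-suc m c) ⟩
  nf ((r ∷ t ∷ srtPow (suc m)) ++ c) ∎
  where open ≡-Reasoning

inv-form : ∀ α m β → inv (form α m β) ≡ form β m α
inv-form α m β = begin
  inv (nf (cword α m β))
    ≡⟨ nf-reverse (cword α m β) ⟨
  nf (reverse (left α ++ (core ++ right β)))
    ≡⟨ cong nf (reverse-++ (left α) (core ++ right β)) ⟩
  nf (reverse (core ++ right β) ++ reverse (left α))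
    ≡⟨ cong₂ (λ p q → nf (p ++ q)) (reverse-++ core (right β)) (reverse-left α) ⟩
  nf ((reverse (right β) ++ reverse core) ++ right α)
    ≡⟨ cong₂ (λ p q → nf ((p ++ q) ++ right α)) (reverse-right β) (reverse-++ (r ∷ t ∷ []) (srtPow m)) ⟩
  nf ((left β ++ (reverse (srtPow m) ++ (t ∷ r ∷ []))) ++ right α)
    ≡⟨ cong nf (trans (++-assoc (left β) _ (right α)) (cong (left β ++_) (++-assoc (reverse (srtPow m)) (t ∷ r ∷ []) (right α)))) ⟩
  nf (left β ++ (reverse (srtPow m) ++ (t ∷ r ∷ right α)))
    ≡⟨ nf-++ (left β) (reverse-core m (right α)) ⟩
  nf (cword β m α) ∎
  where
  open ≡-Reasoning
  core = r ∷ t ∷ srtPow m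

-- The strip of alcoves between the arms.

record Stair (x : G) : Set where
  field
    i≤0 : is-pos (coord-i x) ≡ false
    j≥0 : is-neg (coord-j x) ≡ false
    k≤0 : is-pos (coord-k x) ≡ false
    l≡0 : coord-l x ≡ 0ℤ
open Stair

private
  pos-−1− : ∀ z → is-neg z ≡ false → is-pos (-1ℤ ℤ.- z) ≡ false
  pos-−1− (+ zero) _ = refl
  pos-−1− (+ suc n) _ = refl

  neg-1− : ∀ z → is-pos z ≡ false → is-neg (1ℤ ℤ.- z) ≡ false
  neg-1− (+ zero) _ = refl
  neg-1− -[1+ n ] _ = refl

  pos-−1+ : ∀ z → is-pos z ≡ false → is-pos (-1ℤ ℤ.- (ℤ.- z)) ≡ false
  pos-−1+ (+ zero) _ = refl
  pos-−1+ -[1+ n ] _ = refl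

  neg-neg : ∀ z → is-pos z ≡ false → is-neg (ℤ.- z) ≡ false
  neg-neg z p = trans (is-neg-neg z) p

  neg-zero : ∀ {z} → z ≡ 0ℤ → is-neg z ≡ false
  neg-zero refl = refl

  k-rt : ∀ x → coord-k (r · t · x) ≡ ℤ.- coord-k x
  k-rt x = trans (k-r (t · x)) (l-t x)

  l-rt : ∀ x → coord-l (r · t · x) ≡ ℤ.- coord-l x
  l-rt x = trans (l-r (t · x)) (k-t x)

  i-srt : ∀ x → coord-i (s · r · t · x) ≡ -1ℤ ℤ.- coord-j x
  i-srt x = j-r (t · x)

  j-srt : ∀ x → coord-j (s · r · t · x) ≡ 1ℤ ℤ.- coord-i x
  j-srt x = i-t x

-- The product srt is the glide reflection (x,y) ↦ (-y, 2 - x); it maps the strip 0 < X + Y < 2 to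
-- itself and moves along it in the direction of growing Y.
stair-srt : ∀ {x} → Stair x → Stair (s · r · t · x)
stair-srt {x} S .i≤0 = trans (cong is-pos (i-srt x)) (pos-−1− (coord-j x) (j≥0 S))
stair-srt {x} S .j≥0 = trans (cong is-neg (j-srt x)) (neg-1− (coord-i x) (i≤0 S))
stair-srt {x} S .k≤0 = trans (cong is-pos (trans (k-s (r · t · x)) (cong (λ z → -1ℤ ℤ.- z) (k-rt x)))) (pos-−1+ (coord-k x) (k≤0 S))
stair-srt {x} S .l≡0 = trans (l-s (r · t · x)) (trans (l-rt x) (cong ℤ.-_ (l≡0 S)))

stair-Stair : ∀ m β → Stair (stair m β)
stair-Stair zero [e] = record { i≤0 = refl ; j≥0 = refl ; k≤0 = refl ; l≡0 = refl }
stair-Stair zero [s] = record { i≤0 = refl ; j≥0 = refl ; k≤0 = refl ; l≡0 = refl }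
stair-Stair zero [ts] = record { i≤0 = refl ; j≥0 = refl ; k≤0 = refl ; l≡0 = refl }
stair-Stair zero [rs] = record { i≤0 = refl ; j≥0 = refl ; k≤0 = refl ; l≡0 = refl }
stair-Stair (suc m) β = stair-srt (stair-Stair m β)

infixr 7 _∙_
_∙_ : Arm → G → G
[e] ∙ x = r · t · x
[s] ∙ x = s · r · t · x
[ts] ∙ x = t · s · r · t · x
[rs] ∙ x = r · s · r · t · x

form-∙ : ∀ α m β → form α m β ≡ α ∙ stair m β
form-∙ [e] m β = refl
form-∙ [s] m β = refl
form-∙ [ts] m β = refl
form-∙ [rs] m β = refl

module _ {x} (S : Stair x) where

  ∙-descents : ∀ α g → descent g (α ∙ x) ≡ descents α g
  ∙-descents [e] r = descent-after-up r (t · x) (j≥0 S)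
  ∙-descents [e] s = trans (cong is-neg (k-rt x)) (neg-neg (coord-k x) (k≤0 S))
  ∙-descents [e] t = trans (commute-descent tr (t · x)) (descent-after-up t x (i≤0 S))
  ∙-descents [s] r = j≥0 (stair-srt S)
  ∙-descents [s] s = descent-after-up s ([e] ∙ x) (∙-descents [e] s)
  ∙-descents [s] t = i≤0 (stair-srt S)
  ∙-descents [ts] r = j≥0 (stair-srt S)
  ∙-descents [ts] s = neg-zero (trans (k-t (s · r · t · x)) (cong ℤ.-_ (l≡0 (stair-srt S))))
  ∙-descents [ts] t = descent-after-up t ([s] ∙ x) (∙-descents [s] t)
  ∙-descents [rs] r = descent-after-up r ([s] ∙ x) (∙-descents [s] r)
  ∙-descents [rs] s = neg-zero (trans (k-r (s · r · t · x)) (l≡0 (stair-srt S)))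
  ∙-descents [rs] t = i≤0 (stair-srt S)

  private
    len-[e] : len ([e] ∙ x) ≡ 2 + len x
    len-[e] = trans (len-up r (t · x) (j≥0 S)) (cong suc (len-up t x (i≤0 S)))

    len-[s] : len ([s] ∙ x) ≡ 3 + len x
    len-[s] = trans (len-up s ([e] ∙ x) (∙-descents [e] s)) (cong suc len-[e])

  len-∙ : ∀ α → len (α ∙ x) ≡ size α + (2 + len x)
  len-∙ [e] = len-[e]
  len-∙ [s] = len-[s]
  len-∙ [ts] = trans (len-up t ([s] ∙ x) (∙-descents [s] t)) (cong suc len-[s])
  len-∙ [rs] = trans (len-up r ([s] ∙ x) (∙-descents [s] r)) (cong suc len-[s])

  string-t : StringStart t ([e] ∙ x)
  string-t = record
    { has-g = ∙-descents [e] t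
    ; no-s = ∙-descents [e] s
    -- Here t · ([e] ∙ x) is r · x, and r exchanges the coordinates k and l; the strip condition l =
    -- 0 is what excludes s.
    ; g-no-s = neg-zero (trans (cong coord-k (cong (r ·_) (·-involutive t x))) (trans (k-r x) (l≡0 S)))
    ; s-no-g = ∙-descents [s] t
    ; gs-no-s = ∙-descents [ts] s }

  string-r : StringStart r ([e] ∙ x)
  string-r = record
    { has-g = ∙-descents [e] r
    ; no-s = ∙-descents [e] s
    ; g-no-s = neg-zero (trans (cong coord-k (·-involutive r (t · x))) (trans (k-t x) (cong ℤ.-_ (l≡0 S))))
    ; s-no-g = ∙-descents [s] r
    ; gs-no-s = ∙-descents [rs] s }

form-descents : ∀ α m β g → descent g (form α m β) ≡ descents α g
form-descents α m β g = trans (cong (descent g) (form-∙ α m β)) (∙-descents (stair-Stair m β) α g)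

len-stair : ∀ m β → len (stair m β) ≡ m * 3 + size β
len-stair zero [e] = refl
len-stair zero [s] = refl
len-stair zero [ts] = refl
len-stair zero [rs] = refl
len-stair (suc m) β = trans (len-∙ (stair-Stair m β) [s]) (cong (λ n → 3 + n) (len-stair m β))

len-form : ∀ α m β → len (form α m β) ≡ size α + (2 + (m * 3 + size β))
len-form α m β = trans (cong len (form-∙ α m β)) (trans (len-∙ (stair-Stair m β) α) (cong (λ n → size α + (2 + n)) (len-stair m β)))

-- Edges between arms and right equivalence.

private
  one≢zero : 1ℤ ≢ 0ℤ
  one≢zero ()

-- After the symmetry the edge joins gsx and y, and h is a left descent of y only; `C-step` and
-- `C-skip` then decide it.
string-edge : ∀ g h {x y} → StringStart g x → StringStart g y → descent h y ≡ true → descent h (g · s · x) ≡ false →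
  (h · g · s · x ≡ y → C (g · s · y) x 1ℤ ≡ 1ℤ) × (h · g · s · x ≢ y → C (g · s · y) x 1ℤ ≡ 0ℤ)
string-edge g h {x} {y} X Y dy dx =
  (λ { refl → trans (string-symmetry X Y) (C-step h (g · s · x) dx) }) ,
  (λ ne → trans (string-symmetry X Y) (C-skip h y (g · s · x) dy dx ne))

module _ (α : Arm) where

  private
    word : ℕ → Arm → W
    word m β = cword α m β

    inv-word : ∀ m β → inv (nf (word m β)) ≡ form β m α
    inv-word m β = inv-form α m β

    right-descents : ∀ m β h → descent h (inv (nf (word m β))) ≡ descents β h
    right-descents m β h = trans (cong (descent h) (inv-word m β)) (form-descents β m α h)

    μ-word : ∀ m β m' β' → μ (word m β) (word m' β') ≡ C (form β' m' α) (form β m α) 1ℤ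
    μ-word m β m' β' = trans (μ-C (word m β) (word m' β')) (trans (sym (C-inv-inv (nf (word m' β')) (nf (word m β)) 1ℤ))
      (cong₂ (λ y x → C y x 1ℤ) (inv-word m' β') (inv-word m β)))

    -- The inverse of `word m β` is `form β m α`, so appending h to a word appears here as left
    -- multiplication by h.
    step-up : ∀ m β m' β' h → form β' m' α ≡ h · form β m α → descents β h ≡ false →
      (word m β ≤B word m' β') × (μ (word m β) (word m' β') ≢ 0ℤ)
    step-up m β m' β' h e d = (inj₂ ([] , h , nf⇒≈ {word m' β'} {word m β ++ h ∷ []} same , longer) then done) , edge
      where
      up : descent h (form β m α) ≡ false
      up = trans (form-descents β m α h) d
      same : nf (word m' β') ≡ nf (word m β ++ h ∷ [])
      same = begin
        nf (word m' β')              ≡⟨ inv-involutive (nf (word m' β')) ⟨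
        inv (inv (nf (word m' β')))  ≡⟨ cong inv (trans (inv-word m' β') e) ⟩
        inv (h · form β m α)         ≡⟨ inv-· h (form β m α) ⟩
        inv (form β m α) ◂ h         ≡⟨ cong (_◂ h) (inv-form β m α) ⟩
        nf (word m β) ◂ h            ≡⟨ nf-∷ʳ (word m β) h ⟨
        nf (word m β ++ h ∷ [])      ∎
        where open ≡-Reasoning
      lengths : ∀ m β → ℓ (word m β) ≡ len (form β m α)
      lengths m β = trans (ℓ-len (word m β)) (trans (sym (len-inv (nf (word m β)))) (cong len (inv-word m β)))
      longer : ℓ (word m β) < ℓ (word m' β')
      longer = ℕ.≤-reflexive (sym (trans (lengths m' β') (trans (cong len e) (trans (len-up h (form β m α) up) (cong suc (sym (lengths m β)))))))
      edge : μ (word m β) (word m' β') ≢ 0ℤ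
      edge z = one≢zero (trans (sym (trans (μ-word m β m' β') (trans (cong (λ y → C y (form β m α) 1ℤ) e) (C-step h (form β m α) up)))) z)

    ⊈𝓡 : ∀ m β m' β' h → descents β h ≡ true → descents β' h ≡ false → ¬ (word m β ⊆𝓡 word m' β')
    ⊈𝓡 m β m' β' h d d' sub = true≢false (∈𝓡⇒descent {h} (word m' β') (sub h (descent⇒∈𝓡 {h} (word m β) (trans (right-descents m β h) d))))
      (trans (right-descents m' β' h) d')

    ascend : ∀ m β m' β' h → form β' m' α ≡ h · form β m α → descents β h ≡ false →
      ∀ g → descents β g ≡ true → descents β' g ≡ false → word m β ≤R word m' β'
    ascend m β m' β' h e d g p q = inj₂ (inj₁ (step-up m β m' β' h e d) , ⊈𝓡 m β m' β' g p q) then done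

    descend : ∀ m β m' β' h → form β' m' α ≡ h · form β m α → descents β h ≡ false →
      ∀ g → descents β' g ≡ true → descents β g ≡ false → word m' β' ≤R word m β
    descend m β m' β' h e d g p q = inj₂ (inj₂ (step-up m β m' β' h e d) , ⊈𝓡 m' β' m β g p q) then done

    -- The one-letter edge from arm [ts] at m to arm [e] at m + 1 enlarges the right descents, so it
    -- only leads from m + 1 back to m. Going up uses the edge of length five, which is
    -- `string-edge` for the inverses with g = t and h = r; the right descent r is lost on the way.
    leap : ∀ m → word m [e] ≤R word (suc m) [ts]
    leap m = inj₂ (inj₁ (bruhat , edge) , ⊈𝓡 m [e] (suc m) [ts] r refl refl) then done
      where
      bruhat : word m [e] ≤B word (suc m) [ts]
      bruhat = proj₁ (step-up m [e] m [s] s refl refl) ++ˢ (proj₁ (step-up m [s] m [ts] t refl refl)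
        ++ˢ (proj₁ (step-up m [ts] (suc m) [e] r refl refl) ++ˢ (proj₁ (step-up (suc m) [e] (suc m) [s] s refl refl)
        ++ˢ proj₁ (step-up (suc m) [s] (suc m) [ts] t refl refl))))
      S = stair-Stair m α
      S′ = stair-Stair (suc m) α
      edge : μ (word m [e]) (word (suc m) [ts]) ≢ 0ℤ
      edge z = one≢zero (trans (sym (trans (μ-word m [e] (suc m) [ts])
        (proj₁ (string-edge t r (string-t S) (string-t S′) (∙-descents S′ [e] r) (∙-descents S [ts] r)) refl))) z)

    s-to-[e] : ∀ m → word m [s] ≤R word m [e]
    s-to-[e] m = descend m [e] m [s] s refl refl s refl refl

    to-[e] : ∀ m β → word m β ≤R word m [e]
    to-[e] m [e] = done
    to-[e] m [s] = s-to-[e] m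
    to-[e] m [ts] = descend m [s] m [ts] t refl refl t refl refl ++ˢ s-to-[e] m
    to-[e] m [rs] = descend m [s] m [rs] r refl refl r refl refl ++ˢ s-to-[e] m

    s-from-[e] : ∀ m → word m [e] ≤R word m [s]
    s-from-[e] m = ascend m [e] m [s] s refl refl r refl refl

    from-[e] : ∀ m β → word m [e] ≤R word m β
    from-[e] m [e] = done
    from-[e] m [s] = s-from-[e] m
    from-[e] m [ts] = s-from-[e] m ++ˢ ascend m [s] m [ts] t refl refl s refl refl
    from-[e] m [rs] = s-from-[e] m ++ˢ ascend m [s] m [rs] r refl refl s refl refl

    shrink : ∀ m → word m [e] ≤R word 0 [e]
    shrink zero = done
    shrink (suc m) = descend m [ts] (suc m) [e] r refl refl r refl refl ++ˢ (to-[e] m [ts] ++ˢ shrink m)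

    grow : ∀ m → word 0 [e] ≤R word m [e]
    grow zero = done
    grow (suc m) = grow m ++ˢ (leap m ++ˢ to-[e] (suc m) [ts])

    connect : ∀ m β m' β' → word m β ≤R word m' β'
    connect m β m' β' = to-[e] m β ++ˢ (shrink m ++ˢ (grow m' ++ˢ from-[e] m' β'))

  same-arm-∼R : ∀ {u w} m β m' β' → u ≈ cword α m β → w ≈ cword α m' β' → u ∼R w
  same-arm-∼R m β m' β' eu ew =
    (inj₁ eu then (connect m β m' β' ++ˢ (inj₁ (sym ew) then done))) ,
    (inj₁ ew then (connect m' β' m β ++ˢ (inj₁ (sym eu) then done)))

-- Lengths and the comparison of arms.

private
  no-1-mod-3 : ∀ m m' → m' * 3 ≢ suc (m * 3)
  no-1-mod-3 (suc m) (suc m') p = no-1-mod-3 m m' (ℕ.suc-injective (ℕ.suc-injective (ℕ.suc-injective p)))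

  no-2-mod-3 : ∀ m m' → m' * 3 ≢ suc (suc (m * 3))
  no-2-mod-3 (suc m) (suc m') p = no-2-mod-3 m m' (ℕ.suc-injective (ℕ.suc-injective (ℕ.suc-injective p)))

  triple-injective : ∀ m m' → m' * 3 ≡ m * 3 → m' ≡ m
  triple-injective m m' = ℕ.*-cancelʳ-≡ m' m 3

  drop-tail : ∀ a a' c b d d' → len (form a' d' b) ≡ len (form a d b) + c → size a' + d' * 3 ≡ size a + d * 3 + c
  drop-tail a a' c b d d' e = ℕ.+-cancelʳ-≡ (2 + size b) _ _ (begin
      size a' + d' * 3 + (2 + size b)       ≡⟨ regroup (size a') (d' * 3) (size b) ⟩
      size a' + (2 + (d' * 3 + size b))     ≡⟨ len-form a' d' b ⟨
      len (form a' d' b)                    ≡⟨ e ⟩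
      len (form a d b) + c                  ≡⟨ cong (_+ c) (len-form a d b) ⟩
      size a + (2 + (d * 3 + size b)) + c   ≡⟨ cong (_+ c) (regroup (size a) (d * 3) (size b)) ⟨
      size a + d * 3 + (2 + size b) + c     ≡⟨ swap (size a + d * 3) (2 + size b) c ⟩
      size a + d * 3 + c + (2 + size b)     ∎)
    where
    open ≡-Reasoning
    open import Data.Nat.Tactic.RingSolver using (solve-∀)
    regroup : ∀ x y z → x + y + (2 + z) ≡ x + (2 + (y + z))
    regroup = solve-∀
    swap : ∀ x y z → x + y + z ≡ x + z + y
    swap = solve-∀

module _ (u w : W) (α α' : Arm) (m m' : ℕ) (β : Arm) (eu : nf u ≡ form α m β) (ew : nf w ≡ form α' m' β) where

  private
    lengths : ∀ c → ℓ w ≡ ℓ u + c → size α' + m' * 3 ≡ size α + m * 3 + c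
    lengths c e = drop-tail α α' c β m m' (trans (sym (trans (ℓ-len w) (cong len ew))) (trans e (cong (_+ c) (trans (ℓ-len u) (cong len eu)))))

    μ-form : μ u w ≡ C (form α' m' β) (form α m β) 1ℤ
    μ-form = trans (μ-C u w) (cong₂ (λ y x → C y x 1ℤ) ew eu)

    in-w : ∀ g → descents α' g ≡ true → g ∈𝓛 w
    in-w g d = descent⇒∈𝓛 {g} {w} (trans (cong (descent g) ew) (trans (form-descents α' m' β g) d))

    not-in-u : ∀ g → descents α g ≡ false → ¬ (g ∈𝓛 u)
    not-in-u g d p = true≢false (∈𝓛⇒descent {g} {u} p) (trans (cong (descent g) eu) (trans (form-descents α m β g) d))

    Conclusion : Set
    Conclusion = (¬ (w ⊆𝓛 u) → (ℓ w ≡ ℓ u + 1 → μ u w ≡ 1ℤ) × (ℓ w ≢ ℓ u + 1 → μ u w ≡ 0ℤ))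
      × (w ⊆𝓛 u → (ℓ w ≡ ℓ u + 5 → μ u w ≡ 1ℤ) × (ℓ w ≢ ℓ u + 5 → μ u w ≡ 0ℤ))

  -- Here μ(u,w) is 1 exactly when gu = w. The hypothesis `forced` supplies the converse of the
  -- length count: among elements with these arms, length difference one leaves no other w.
  not-contained : ∀ g → descents α' g ≡ true → descents α g ≡ false →
    (size α' + m' * 3 ≡ size α + m * 3 + 1 → form α' m' β ≡ g · form α m β) → Conclusion
  not-contained g dw du forced = (λ _ → one , other) , λ sub → ⊥-elim (not-in-u g du (sub g (in-w g dw)))
    where
    up : descent g (form α m β) ≡ false
    up = trans (form-descents α m β g) du
    down : descent g (form α' m' β) ≡ true
    down = trans (form-descents α' m' β g) dw
    one : ℓ w ≡ ℓ u + 1 → μ u w ≡ 1ℤ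
    one e = trans μ-form (trans (cong (λ y → C y (form α m β) 1ℤ) (forced (lengths 1 e))) (C-step g (form α m β) up))
    other : ℓ w ≢ ℓ u + 1 → μ u w ≡ 0ℤ
    other ne = trans μ-form (C-skip g (form α' m' β) (form α m β) down up λ e → ne (begin
      ℓ w                        ≡⟨ trans (ℓ-len w) (cong len ew) ⟩
      len (form α' m' β)         ≡⟨ cong len e ⟨
      len (g · form α m β)       ≡⟨ len-up g (form α m β) up ⟩
      suc (len (form α m β))     ≡⟨ cong suc (trans (ℓ-len u) (cong len eu)) ⟨
      suc (ℓ u)                  ≡⟨ ℕ.+-comm 1 (ℓ u) ⟩
      ℓ u + 1                    ∎))
      where open ≡-Reasoning

  contained : (∀ g → descents α' g ≡ true → descents α g ≡ true) →
    (m' ≡ suc m → C (form α' m' β) (form α m β) 1ℤ ≡ 1ℤ) → (m' ≢ suc m → C (form α' m' β) (form α m β) 1ℤ ≡ 0ℤ) →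
    size α' ≡ 2 → size α ≡ 0 → Conclusion
  contained sub edge no-edge s' s₀ =
    (λ ¬⊆ → ⊥-elim (¬⊆ λ g p → descent⇒∈𝓛 {g} {u} (trans (cong (descent g) eu) (trans (form-descents α m β g)
      (sub g (trans (sym (trans (cong (descent g) ew) (form-descents α' m' β g))) (∈𝓛⇒descent {g} {w} p))))))) ,
    λ _ → (λ e → trans μ-form (edge (triple-injective (suc m) m' (five (lengths 5 e))))) ,
          (λ ne → trans μ-form (no-edge λ e → ne (back e)))
    where
    open import Data.Nat.Tactic.RingSolver using (solve-∀)
    -- With sizes 2 and 0 the equation reads 2 + 3m' = 3m + 5, that is m' = m + 1.
    five : size α' + m' * 3 ≡ size α + m * 3 + 5 → m' * 3 ≡ suc m * 3
    five e = ℕ.suc-injective (ℕ.suc-injective (trans (subst₂ (λ a b → a + m' * 3 ≡ b + m * 3 + 5) s' s₀ e) (ℕ.+-comm (m * 3) 5)))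
    back : m' ≡ suc m → ℓ w ≡ ℓ u + 5
    back refl = begin
      ℓ w                                        ≡⟨ trans (ℓ-len w) (cong len ew) ⟩
      len (form α' m' β)                         ≡⟨ len-form α' m' β ⟩
      size α' + (2 + (suc m * 3 + size β))       ≡⟨ cong (_+ (2 + (suc m * 3 + size β))) s' ⟩
      7 + (m * 3 + size β)                       ≡⟨ lem (m * 3 + size β) ⟩
      2 + (m * 3 + size β) + 5                   ≡⟨ cong (λ a → a + (2 + (m * 3 + size β)) + 5) s₀ ⟨
      size α + (2 + (m * 3 + size β)) + 5        ≡⟨ cong (_+ 5) (len-form α m β) ⟨
      len (form α m β) + 5                       ≡⟨ cong (_+ 5) (trans (ℓ-len u) (cong len eu)) ⟨
      ℓ u + 5                                    ∎
      where
      open ≡-Reasoning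
      lem : ∀ n → 7 + n ≡ 2 + n + 5
      lem = solve-∀

private
  top-index : ∀ m m' β → [e] ∙ (s · [e] ∙ stair m β) ≡ [e] ∙ stair m' β → m' ≡ suc m
  top-index m m' β e = triple-injective (suc m) m' (ℕ.+-cancelʳ-≡ (size β) (m' * 3) (suc m * 3)
    (ℕ.suc-injective (ℕ.suc-injective (trans (sym (len-form [e] m' β)) (trans (cong len (sym e)) (len-form [e] (suc m) β))))))

theorem5p8 : (u w : W) → InC2 u → InC2 w → u ≤B w → u ∼L w → ¬ (u ∼R w) →
    (¬ (w ⊆𝓛 u) → (ℓ w ≡ ℓ u + 1 → μ u w ≡ 1ℤ) × (ℓ w ≢ ℓ u + 1 → μ u w ≡ 0ℤ))
    × (w ⊆𝓛 u → (ℓ w ≡ ℓ u + 5 → μ u w ≡ 1ℤ) × (ℓ w ≢ ℓ u + 5 → μ u w ≡ 0ℤ))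
theorem5p8 u w cu cw _ u∼w u≁w = conclude (InC2-form {u} cu) (InC2-form {w} cw)
  where
  by-arms : ∀ m m' β α α' → nf u ≡ form α m β → nf w ≡ form α' m' β → α ≢ α' →
    (¬ (w ⊆𝓛 u) → (ℓ w ≡ ℓ u + 1 → μ u w ≡ 1ℤ) × (ℓ w ≢ ℓ u + 1 → μ u w ≡ 0ℤ))
    × (w ⊆𝓛 u → (ℓ w ≡ ℓ u + 5 → μ u w ≡ 1ℤ) × (ℓ w ≢ ℓ u + 5 → μ u w ≡ 0ℤ))
  by-arms m m' β [e] [e] eu ew ne = ⊥-elim (ne refl)
  by-arms m m' β [s] [s] eu ew ne = ⊥-elim (ne refl)
  by-arms m m' β [ts] [ts] eu ew ne = ⊥-elim (ne refl)
  by-arms m m' β [rs] [rs] eu ew ne = ⊥-elim (ne refl)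
  by-arms m m' β [e] [s] eu ew _ = not-contained u w [e] [s] m m' β eu ew s refl refl λ e →
    cong (λ n → form [s] n β) (triple-injective m m' (ℕ.suc-injective (trans e (ℕ.+-comm (m * 3) 1))))
  by-arms m m' β [s] [ts] eu ew _ = not-contained u w [s] [ts] m m' β eu ew t refl refl λ e →
    cong (λ n → form [ts] n β) (triple-injective m m' (ℕ.suc-injective (ℕ.suc-injective (trans e (ℕ.+-comm (1 + m * 3) 1)))))
  by-arms m m' β [s] [rs] eu ew _ = not-contained u w [s] [rs] m m' β eu ew r refl refl λ e →
    cong (λ n → form [rs] n β) (triple-injective m m' (ℕ.suc-injective (ℕ.suc-injective (trans e (ℕ.+-comm (1 + m * 3) 1)))))
  -- The added letter completes a new block srt, hence m' = m + 1; since r and t commute, either of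
  -- the arms [ts], [rs] closes up to [e].
  by-arms m m' β [ts] [e] eu ew _ = not-contained u w [ts] [e] m m' β eu ew r refl refl λ e →
    cong (λ n → form [e] n β) (triple-injective (suc m) m' (trans e (ℕ.+-comm (2 + m * 3) 1)))
  by-arms m m' β [rs] [e] eu ew _ = not-contained u w [rs] [e] m m' β eu ew t refl refl λ e →
    cong (λ n → form [e] n β) (triple-injective (suc m) m' (trans e (ℕ.+-comm (2 + m * 3) 1)))
  -- For this and the next four pairs of arms, length difference one is impossible modulo 3.
  by-arms m m' β [s] [e] eu ew _ = not-contained u w [s] [e] m m' β eu ew r refl refl λ e →
    ⊥-elim (no-2-mod-3 m m' (trans e (ℕ.+-comm (1 + m * 3) 1)))
  by-arms m m' β [ts] [s] eu ew _ = not-contained u w [ts] [s] m m' β eu ew s refl refl λ e →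
    ⊥-elim (no-2-mod-3 m m' (ℕ.suc-injective (trans e (ℕ.+-comm (2 + m * 3) 1))))
  by-arms m m' β [rs] [s] eu ew _ = not-contained u w [rs] [s] m m' β eu ew s refl refl λ e →
    ⊥-elim (no-2-mod-3 m m' (ℕ.suc-injective (trans e (ℕ.+-comm (2 + m * 3) 1))))
  by-arms m m' β [ts] [rs] eu ew _ = not-contained u w [ts] [rs] m m' β eu ew r refl refl λ e →
    ⊥-elim (no-1-mod-3 m m' (ℕ.suc-injective (ℕ.suc-injective (trans e (ℕ.+-comm (2 + m * 3) 1)))))
  by-arms m m' β [rs] [ts] eu ew _ = not-contained u w [rs] [ts] m m' β eu ew t refl refl λ e →
    ⊥-elim (no-1-mod-3 m m' (ℕ.suc-injective (ℕ.suc-injective (trans e (ℕ.+-comm (2 + m * 3) 1)))))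
  -- With g = t and h = r, the element rtsu has arm [e] and index m + 1, so the edge exists exactly
  -- for m' = m + 1. The next clause exchanges r and t.
  by-arms m m' β [e] [ts] eu ew _ = contained u w [e] [ts] m m' β eu ew (λ { t _ → refl })
      (λ { refl → proj₁ edge refl }) (λ ne → proj₂ edge λ e → ne (top-index m m' β e)) refl refl
    where
    S = stair-Stair m β
    S′ = stair-Stair m' β
    edge = string-edge t r (string-t S) (string-t S′) (∙-descents S′ [e] r) (∙-descents S [ts] r)
  by-arms m m' β [e] [rs] eu ew _ = contained u w [e] [rs] m m' β eu ew (λ { r _ → refl })
      (λ { refl → proj₁ edge refl }) (λ ne → proj₂ edge λ e → ne (top-index m m' β e)) refl refl
    where
    S = stair-Stair m β
    S′ = stair-Stair m' β
    edge = string-edge r t (string-r S) (string-r S′) (∙-descents S′ [e] t) (∙-descents S [rs] t)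
  same-right : ∀ α m β α' m' β' → u ≈ cword α m β → w ≈ cword α' m' β' → β ≡ β'
  same-right α m β α' m' β' eu ew = descents-injective β β' λ g → begin
    descents β g                            ≡⟨ form-descents β m α g ⟨
    descent g (form β m α)                  ≡⟨ cong (descent g) (inv-form α m β) ⟨
    descent g (inv (nf (cword α m β)))      ≡⟨ cong (λ x → descent g (inv x)) (≈⇒nf {u} {cword α m β} eu) ⟨
    descent g (inv (nf u))                  ≡⟨ ∼L-right {u} {w} u∼w g ⟩
    descent g (inv (nf w))                  ≡⟨ cong (λ x → descent g (inv x)) (≈⇒nf {w} {cword α' m' β'} ew) ⟩
    descent g (inv (nf (cword α' m' β')))   ≡⟨ cong (descent g) (inv-form α' m' β') ⟩
    descent g (form β' m' α')               ≡⟨ form-descents β' m' α' g ⟩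
    descents β' g                           ∎
    where open ≡-Reasoning
  conclude : (∃ λ α → ∃ λ m → ∃ λ β → u ≈ cword α m β) → (∃ λ α → ∃ λ m → ∃ λ β → w ≈ cword α m β) →
    (¬ (w ⊆𝓛 u) → (ℓ w ≡ ℓ u + 1 → μ u w ≡ 1ℤ) × (ℓ w ≢ ℓ u + 1 → μ u w ≡ 0ℤ))
    × (w ⊆𝓛 u → (ℓ w ≡ ℓ u + 5 → μ u w ≡ 1ℤ) × (ℓ w ≢ ℓ u + 5 → μ u w ≡ 0ℤ))
  conclude (α , m , β , eu) (α' , m' , β' , ew) = by-arms m m' β α α' (≈⇒nf {u} {cword α m β} eu)
    (≈⇒nf {w} {cword α' m' β} ew′) λ { refl → u≁w (same-arm-∼R α m β m' β eu ew′) }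
    where
    ew′ : w ≈ cword α' m' β
    ew′ = subst (λ γ → w ≈ cword α' m' γ) (sym (same-right α m β α' m' β' eu ew)) ew
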